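{- Let $A=\bigoplus_{n\ge0}A_n$ be a filtered tower of algebras over $\mathbb{C}$, with filtrations $A_n=A_n^{(0)}\supset A_n^{(1)}\supset\cdots$, and suppose that there exists a multiplication $*$ on $G(A)_q=G(A)\otimes_{\mathbb{Z}}\mathbb{Z}[q]$ quantizing $G(A)$ such that: (Q1) $*$ is a well-defined associative product on $G(A)_q$; (Q2) $G(A)_q$, with the product $*$ and the $\mathbb{Z}[q]$-linear extension of the usual coproduct of $G(A)$, is a $q$-twisted Hopf algebra; (Q3) for all $n$, $\beta^{*n}=[A_n]_q=\sum_{i\ge0}q^i\,[A_n^{(i)}/A_n^{(i+1)}]$ in $G(A)_q$. Then for all $n\ge 0$ $$\sum_{i\ge0}q^i\dim_{\mathbb{C}}\left(A_n^{(i)}/A_n^{(i+1)}\right)=r^n\,[n]!,$$ where $r=\dim_{\mathbb{C}}(A_1)$.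
   Context: A tower of algebras is a graded algebra $A=\bigoplus_{n\ge0}A_n$ over $\mathbb{C}$ with (external, associative) multiplication $\rho_{m,n}\colon A_m\otimes A_n\to A_{m+n}$, such that: (1) each $A_n$ is itself a finite-dimensional associative algebra with internal multiplication and unit $1_n$, and $A_0\cong\mathbb{C}$; (2) each $\rho_{m,n}$ is an injective homomorphism of algebras sending $1_m\otimes 1_n$ to $1_{m+n}$; (3) $A_{m+n}$ is projective both as a left and as a right $A_m\otimes A_n$-module via $\rho_{m,n}$. A filtered tower of algebras is a tower of algebras in which each $A_n$ is equipped with a filtration $A_n=A_n^{(0)}\supset A_n^{(1)}\supset\cdots$ by left ideals $A_n^{(k)}$. $G_0(A_n)$ is the Grothendieck group of finitely generated left $A_n$-modules, and $G(A)=\bigoplus_{n\ge0}G_0(A_n)$, with multiplication $[M][N]=[\mathrm{Ind}_{A_m\otimes A_n}^{A_{m+n}}M\otimes N]$ and coproduct $\Delta([N])=\sum_{k+l=n}[\mathrm{Res}^{A_n}_{A_k\otimes A_l}N]$ (for $N$ an $A_n$-module), induction and restriction being along $\rho$. A multiplication on $G(A)\otimes_{\mathbb{Z}}\mathbb{Z}[q]$ (graded, $\mathbb{Z}[q]$-bilinear) quantizes $G(A)$ if it reduces to the usual multiplication of $G(A)$ at $q=1$. (The motivating choice of $*$ is: for $M$ an $A_m$-module and $N$ an $A_n$-module, $[M]*[N]=\sum_{i\ge 0}q^i[I^{(i)}/I^{(i+1)}]$, where $I=\mathrm{Ind}_{A_m\otimes A_n}^{A_{m+n}}M\otimes N$ and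 $I^{(i)}=A_{m+n}^{(i)}\cdot(M\otimes N)$.) A $q$-twisted Hopf algebra is a graded connected algebra $H$ over $\mathbb{Z}[q]$ with a (co)associative graded coproduct $\Delta\colon H\to H\otimes_{\mathbb{Z}[q]}H$ (and the usual unit, counit, antipode) such that $\Delta(ab)=\Delta(a)\cdot_q\Delta(b)$ for all $a,b\in H$, where for homogeneous elements $(a\otimes b)\cdot_q(a'\otimes b')=q^{\deg(b)\deg(a')}\,aa'\otimes bb'$. Let $S^{(1)}_1,\dots,S^{(1)}_t$ be the simple $A_1$-modules up to isomorphism, with projective covers $P^{(1)}_1,\dots,P^{(1)}_t$. Then $\beta=\sum_{i=1}^t \dim(P^{(1)}_i)\,[S^{(1)}_i]\in G_0(A_1)$, and $\beta^{*n}$ is its $n$-th power under $*$. $[k]=1+q+\cdots+q^{k-1}$ and $[n]!=[n][n-1]\cdots[1]$. -}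

module Defs where

open import Level using (Level; 0ℓ; _⊔_) renaming (suc to lsuc)
open import Algebra.Bundles using (AbelianGroup; Ring; CommutativeRing)
open import Algebra.Core using (Op₂)
open import Algebra.Definitions.RawMonoid using (sum)
open import Algebra.Module.Bundles using (LeftModule; RightModule; Bimodule)
open import Algebra.Module.Morphism.Structures using (module LeftModuleMorphisms; module RightModuleMorphisms)
open import Algebra.Module.Structures using (IsModule; IsLeftModule; IsBimodule)
open import Algebra.Module.Structures.Biased using (IsModuleFromLeft)
open import Algebra.Morphism.Bundles using (RingHomomorphism)
open import Algebra.Structures using (IsAbelianGroup; IsRing)
import Algebra.Module.Construct.TensorUnit as TensorUnit
import Algebra.Properties.AbelianGroup as AbelianGroupProperties
import Algebra.Properties.CommutativeSemigroup as CommutativeSemigroupProperties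
import Algebra.Properties.Monoid.Mult as MultProperties
import Algebra.Properties.Ring as RingProperties
open import Algebra.Construct.DirectProduct using (abelianGroup)
open import Axiom.ExcludedMiddle using (ExcludedMiddle)
open import Data.Empty using (⊥-elim)
open import Data.Fin.Base using (Fin; zero; suc; toℕ)
open import Data.Fin.Properties using (toℕ≤pred[n])
open import Data.Integer.Base as ℤ using (ℤ; 0ℤ; 1ℤ)
import Data.Integer.Properties as ℤ
open import Data.List.Base using (List; []; _∷_; [_]; map; replicate; _++_; cartesianProductWith)
open import Data.List.Membership.Propositional using (_∈_)
open import Data.List.Membership.Propositional.Properties using (∈-cartesianProductWith⁺; ∈-map⁺)
open import Data.List.Relation.Unary.All using (All; []; _∷_)
open import Data.List.Relation.Unary.Any using (here; there)
open import Data.Nat.Base as ℕ using (ℕ; zero; suc; _∸_; _≤_)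
import Data.Nat.Properties as ℕ
open import Data.Product.Base using (Σ; ∃; ∃-syntax; _×_; _,_; proj₁; proj₂)
open import Data.Sum.Base using (_⊎_; inj₁; inj₂)
open import Data.Vec.Functional using (Vector) renaming (_∷_ to _◂_)
open import Function.Base using (id; _∘_; flip)
open import Function.Definitions using (Injective; Surjective; Bijective)
open import Relation.Binary.Core using (Rel)
open import Relation.Binary.Structures using (IsTotalOrder)
open import Relation.Binary.PropositionalEquality as ≡ using (_≡_)
import Relation.Binary.Reasoning.Setoid as SetoidReasoning
open import Relation.Nullary.Decidable.Core using (yes; no)
open import Relation.Nullary.Negation.Core using (¬_)
open import Relation.Unary using (Pred)

private
  variable
    a b r s m n x ℓ ℓ₁ ℓ₂ ℓm ℓn ℓr ℓs : Level

data FreeAb (X : Set x) : Set x where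
  gen  : X → FreeAb X
  0ᶠ   : FreeAb X
  _+ᶠ_ : FreeAb X → FreeAb X → FreeAb X
  -ᶠ_  : FreeAb X → FreeAb X

infixl 6 _+ᶠ_
infix 8 -ᶠ_

data AbCongruence {X : Set x} (R : Rel (FreeAb X) r) : Rel (FreeAb X) (x ⊔ r) where
  rel       : ∀ {t u} → R t u → AbCongruence R t u
  reflᶠ     : ∀ {t} → AbCongruence R t t
  symᶠ      : ∀ {t u} → AbCongruence R t u → AbCongruence R u t
  transᶠ    : ∀ {t u v} → AbCongruence R t u → AbCongruence R u v → AbCongruence R t v
  +ᶠ-cong   : ∀ {t t′ u u′} → AbCongruence R t t′ → AbCongruence R u u′ → AbCongruence R (t +ᶠ u) (t′ +ᶠ u′)
  -ᶠ-cong   : ∀ {t t′} → AbCongruence R t t′ → AbCongruence R (-ᶠ t) (-ᶠ t′)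
  +ᶠ-assoc  : ∀ t u v → AbCongruence R ((t +ᶠ u) +ᶠ v) (t +ᶠ (u +ᶠ v))
  +ᶠ-comm   : ∀ t u → AbCongruence R (t +ᶠ u) (u +ᶠ t)
  +ᶠ-idˡ    : ∀ t → AbCongruence R (0ᶠ +ᶠ t) t
  +ᶠ-invˡ   : ∀ t → AbCongruence R ((-ᶠ t) +ᶠ t) 0ᶠ

opaque
  isAbelianGroupᶠ : {X : Set x} {R : Rel (FreeAb X) r} → IsAbelianGroup (AbCongruence R) _+ᶠ_ 0ᶠ -ᶠ_
  isAbelianGroupᶠ = record
    { isGroup = record
      { isMonoid = record
        { isSemigroup = record
          { isMagma = record
            { isEquivalence = record { refl = reflᶠ ; sym = symᶠ ; trans = transᶠ }
            ; ∙-cong = +ᶠ-cong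
            }
          ; assoc = +ᶠ-assoc
          }
        ; identity = +ᶠ-idˡ , λ t → transᶠ (+ᶠ-comm t 0ᶠ) (+ᶠ-idˡ t)
        }
      ; inverse = +ᶠ-invˡ , λ t → transᶠ (+ᶠ-comm t (-ᶠ t)) (+ᶠ-invˡ t)
      ; ⁻¹-cong = -ᶠ-cong
      }
    ; comm = +ᶠ-comm
    }

Ab⟨_∣_⟩ : (X : Set x) → Rel (FreeAb X) r → AbelianGroup x (x ⊔ r)
Ab⟨ X ∣ R ⟩ = record
  { Carrier = FreeAb X ; _≈_ = AbCongruence R ; _∙_ = _+ᶠ_ ; ε = 0ᶠ ; _⁻¹ = -ᶠ_ ; isAbelianGroup = isAbelianGroupᶠ }

-- The additive extension of a function on generators. On a presented group it is well defined on classes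
-- as soon as it respects the defining relations (extend-cong).

module _ (G : AbelianGroup a ℓ) where
  private
    module G = AbelianGroup G
    module GP = AbelianGroupProperties G
    module GS = CommutativeSemigroupProperties G.commutativeSemigroup

  extend : {X : Set x} → (X → G.Carrier) → FreeAb X → G.Carrier
  extend f (gen y)  = f y
  extend f 0ᶠ       = G.ε
  extend f (t +ᶠ u) = extend f t G.∙ extend f u
  extend f (-ᶠ t)   = extend f t G.⁻¹

  extend-cong : {X : Set x} {R : Rel (FreeAb X) r} (f : X → G.Carrier) →
                (∀ {t u} → R t u → extend f t G.≈ extend f u) →
                ∀ {t u} → AbCongruence R t u → extend f t G.≈ extend f u
  extend-cong f p (rel e)          = p e
  extend-cong f p reflᶠ            = G.refl
  extend-cong f p (symᶠ e)         = G.sym (extend-cong f p e)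
  extend-cong f p (transᶠ e e′)    = G.trans (extend-cong f p e) (extend-cong f p e′)
  extend-cong f p (+ᶠ-cong e e′)   = G.∙-cong (extend-cong f p e) (extend-cong f p e′)
  extend-cong f p (-ᶠ-cong e)      = G.⁻¹-cong (extend-cong f p e)
  extend-cong f p (+ᶠ-assoc t u v) = G.assoc _ _ _
  extend-cong f p (+ᶠ-comm t u)    = G.comm _ _
  extend-cong f p (+ᶠ-idˡ t)       = G.identityˡ _
  extend-cong f p (+ᶠ-invˡ t)      = G.inverseˡ _

  extend-≈ : {X : Set x} {f g : X → G.Carrier} → (∀ y → f y G.≈ g y) → ∀ t → extend f t G.≈ extend g t
  extend-≈ e (gen y)  = e y
  extend-≈ e 0ᶠ       = G.refl
  extend-≈ e (t +ᶠ u) = G.∙-cong (extend-≈ e t) (extend-≈ e u)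
  extend-≈ e (-ᶠ t)   = G.⁻¹-cong (extend-≈ e t)

  extend-+ : {X : Set x} {f g : X → G.Carrier} → ∀ t → extend (λ y → f y G.∙ g y) t G.≈ extend f t G.∙ extend g t
  extend-+ (gen y)  = G.refl
  extend-+ 0ᶠ       = G.sym (G.identityˡ _)
  extend-+ (t +ᶠ u) = G.trans (G.∙-cong (extend-+ t) (extend-+ u)) (GS.interchange _ _ _ _)
  extend-+ (-ᶠ t)   = G.trans (G.⁻¹-cong (extend-+ t)) (G.sym (GP.⁻¹-∙-comm _ _))

  extend-0 : {X : Set x} (t : FreeAb X) → extend (λ _ → G.ε) t G.≈ G.ε
  extend-0 (gen y)  = G.refl
  extend-0 0ᶠ       = G.refl
  extend-0 (t +ᶠ u) = G.trans (G.∙-cong (extend-0 t) (extend-0 u)) (G.identityˡ _)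
  extend-0 (-ᶠ t)   = G.trans (G.⁻¹-cong (extend-0 t)) GP.ε⁻¹≈ε

  extend-neg : {X : Set x} {f : X → G.Carrier} → ∀ t → extend (λ y → f y G.⁻¹) t G.≈ extend f t G.⁻¹
  extend-neg (gen y)  = G.refl
  extend-neg 0ᶠ       = G.sym GP.ε⁻¹≈ε
  extend-neg (t +ᶠ u) = G.trans (G.∙-cong (extend-neg t) (extend-neg u)) (GP.⁻¹-∙-comm _ _)
  extend-neg (-ᶠ t)   = G.⁻¹-cong (extend-neg t)

module _ (R : Ring r ℓr) (G : AbelianGroup m ℓm) where
  private
    module R = Ring R
    module G = AbelianGroup G
    module GP = AbelianGroupProperties G

    double⇒ε : ∀ {y} → y G.∙ y G.≈ y → y G.≈ G.ε
    double⇒ε {y} e = GP.identityˡ-unique y y e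

  opaque
    isLeftModuleFrom : (_·_ : R.Carrier → G.Carrier → G.Carrier) →
                       (∀ {p p′ u u′} → p R.≈ p′ → u G.≈ u′ → (p · u) G.≈ (p′ · u′)) →
                       (∀ p p′ u → ((p R.+ p′) · u) G.≈ ((p · u) G.∙ (p′ · u))) →
                       (∀ p u u′ → (p · (u G.∙ u′)) G.≈ ((p · u) G.∙ (p · u′))) →
                       (∀ u → (R.1# · u) G.≈ u) →
                       (∀ p p′ u → ((p R.* p′) · u) G.≈ (p · (p′ · u))) →
                       IsLeftModule R G._≈_ G._∙_ G.ε G._⁻¹ _·_
    isLeftModuleFrom _·_ cong distribʳ distribˡ one assoc = record
      { isLeftSemimodule = record
        { +ᴹ-isCommutativeMonoid = G.isCommutativeMonoid
        ; isPreleftSemimodule = record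
          { *ₗ-cong = cong
          ; *ₗ-zeroˡ = λ u → double⇒ε
              (G.trans (G.sym (distribʳ R.0# R.0# u)) (cong (R.+-identityˡ R.0#) G.refl))
          ; *ₗ-distribʳ = λ u p p′ → distribʳ p p′ u
          ; *ₗ-identityˡ = one
          ; *ₗ-assoc = assoc
          ; *ₗ-zeroʳ = λ p → double⇒ε
              (G.trans (G.sym (distribˡ p G.ε G.ε)) (cong R.refl (G.identityˡ G.ε)))
          ; *ₗ-distribˡ = distribˡ
          }
        }
      ; -ᴹ‿cong = G.⁻¹-cong
      ; -ᴹ‿inverse = G.inverse
      }

record LeftModuleHom {R : Ring r ℓr} (M : LeftModule R m ℓm) (N : LeftModule R n ℓn) : Set (r ⊔ m ⊔ n ⊔ ℓm ⊔ ℓn) where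
  private
    module M = LeftModule M
    module N = LeftModule N
  field
    ⟦_⟧    : M.Carrierᴹ → N.Carrierᴹ
    isHom  : LeftModuleMorphisms.IsLeftModuleHomomorphism M.rawLeftModule N.rawLeftModule ⟦_⟧
  IsInjective IsSurjective IsBijective : Set _
  IsInjective  = Injective M._≈ᴹ_ N._≈ᴹ_ ⟦_⟧
  IsSurjective = Surjective M._≈ᴹ_ N._≈ᴹ_ ⟦_⟧
  IsBijective  = Bijective M._≈ᴹ_ N._≈ᴹ_ ⟦_⟧

record RightModuleHom {R : Ring r ℓr} (M : RightModule R m ℓm) (N : RightModule R n ℓn) : Set (r ⊔ m ⊔ n ⊔ ℓm ⊔ ℓn) where
  private
    module M = RightModule M
    module N = RightModule N
  field
    ⟦_⟧    : M.Carrierᴹ → N.Carrierᴹ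
    isHom  : RightModuleMorphisms.IsRightModuleHomomorphism M.rawRightModule N.rawRightModule ⟦_⟧
  IsSurjective : Set _
  IsSurjective = Surjective M._≈ᴹ_ N._≈ᴹ_ ⟦_⟧

infix 4 _≅ᴹ_
_≅ᴹ_ : {R : Ring r ℓr} → LeftModule R m ℓm → LeftModule R n ℓn → Set _
M ≅ᴹ N = Σ (LeftModuleHom M N) LeftModuleHom.IsBijective

IsProjectiveˡ : {R : Ring r ℓr} → LeftModule R m ℓm → Set _
IsProjectiveˡ {m = m} {ℓm = ℓm} {R = R} P =
  (M N : LeftModule R m ℓm) (g : LeftModuleHom M N) → LeftModuleHom.IsSurjective g →
  (f : LeftModuleHom P N) →
  Σ (LeftModuleHom P M) λ h → ∀ y → LeftModule._≈ᴹ_ N (LeftModuleHom.⟦_⟧ g (LeftModuleHom.⟦_⟧ h y)) (LeftModuleHom.⟦_⟧ f y)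

IsProjectiveʳ : {R : Ring r ℓr} → RightModule R m ℓm → Set _
IsProjectiveʳ {m = m} {ℓm = ℓm} {R = R} P =
  (M N : RightModule R m ℓm) (g : RightModuleHom M N) → RightModuleHom.IsSurjective g →
  (f : RightModuleHom P N) →
  Σ (RightModuleHom P M) λ h → ∀ y → RightModule._≈ᴹ_ N (RightModuleHom.⟦_⟧ g (RightModuleHom.⟦_⟧ h y)) (RightModuleHom.⟦_⟧ f y)

record Submodule {R : Ring r ℓr} (M : LeftModule R m ℓm) ℓ : Set (r ⊔ m ⊔ ℓm ⊔ lsuc ℓ) where
  open LeftModule M
  field
    Member  : Pred Carrierᴹ ℓ
    resp    : ∀ {u v} → u ≈ᴹ v → Member u → Member v
    0∈      : Member 0ᴹ
    +∈      : ∀ {u v} → Member u → Member v → Member (u +ᴹ v)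
    *∈      : ∀ p {u} → Member u → Member (p *ₗ u)

data Span {R : Ring r ℓr} (M : LeftModule R m ℓm) (S : Pred (LeftModule.Carrierᴹ M) s) :
          LeftModule.Carrierᴹ M → Set (r ⊔ m ⊔ ℓm ⊔ s) where
  incl   : ∀ {u} → S u → Span M S u
  0-span : Span M S (LeftModule.0ᴹ M)
  +-span : ∀ {u v} → Span M S u → Span M S v → Span M S (LeftModule._+ᴹ_ M u v)
  *-span : ∀ p {u} → Span M S u → Span M S (LeftModule._*ₗ_ M p u)
  ≈-span : ∀ {u v} → LeftModule._≈ᴹ_ M u v → Span M S u → Span M S v

record FinitelyGenerated {R : Ring r ℓr} (M : LeftModule R m ℓm) : Set (r ⊔ m ⊔ ℓm) where
  constructor _,_
  field
    generators : List (LeftModule.Carrierᴹ M)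
    generate   : ∀ u → Span M (_∈ generators) u

record FGModule (R : Ring r ℓr) m ℓm : Set (r ⊔ ℓr ⊔ lsuc (m ⊔ ℓm)) where
  constructor _⟨fg:_⟩
  field
    module′           : LeftModule R m ℓm
    finitelyGenerated : FinitelyGenerated module′
  open LeftModule module′ public

open FGModule using (module′; finitelyGenerated)

record RingHom (R : Ring r ℓr) (S : Ring s ℓs) : Set (r ⊔ s ⊔ ℓr ⊔ ℓs) where
  field
    ringHomomorphism : RingHomomorphism (Ring.rawRing R) (Ring.rawRing S)
  open RingHomomorphism ringHomomorphism public

module _ {R : Ring r ℓr} {S : Ring s ℓs} (f : RingHom R S) where
  private
    module R = Ring R
    module S = Ring S
    module f = RingHom f

  opaque
    Res-isLeftModule : (M : LeftModule S m ℓm) → let module M = LeftModule M in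
                       IsLeftModule R M._≈ᴹ_ M._+ᴹ_ M.0ᴹ M.-ᴹ_ (λ p u → f.⟦ p ⟧ M.*ₗ u)
    Res-isLeftModule M = isLeftModuleFrom R M.+ᴹ-abelianGroup (λ p u → f.⟦ p ⟧ M.*ₗ u)
      (λ e e′ → M.*ₗ-cong (f.⟦⟧-cong e) e′)
      (λ p p′ u → M.≈ᴹ-trans (M.*ₗ-congʳ (f.+-homo p p′)) (M.*ₗ-distribʳ u _ _))
      (λ p → M.*ₗ-distribˡ _)
      (λ u → M.≈ᴹ-trans (M.*ₗ-congʳ f.1#-homo) (M.*ₗ-identityˡ u))
      (λ p p′ u → M.≈ᴹ-trans (M.*ₗ-congʳ (f.*-homo p p′)) (M.*ₗ-assoc _ _ u))
      where module M = LeftModule M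

  Res : LeftModule S m ℓm → LeftModule R m ℓm
  Res M = record
    { Carrierᴹ = M.Carrierᴹ ; _≈ᴹ_ = M._≈ᴹ_ ; _+ᴹ_ = M._+ᴹ_ ; _*ₗ_ = λ p u → f.⟦ p ⟧ M.*ₗ u ; 0ᴹ = M.0ᴹ ; -ᴹ_ = M.-ᴹ_
    ; isLeftModule = Res-isLeftModule M
    }
    where module M = LeftModule M

  opaque
    viaHom-isBimodule : IsBimodule S R S._≈_ S._+_ S.0# S.-_ S._*_ (λ u p → u S.* f.⟦ p ⟧)
    viaHom-isBimodule = record
      { isBisemimodule = record
        { +ᴹ-isCommutativeMonoid = S.+-isCommutativeMonoid
        ; isPreleftSemimodule = LeftModule.isPreleftSemimodule (TensorUnit.leftModule {R = S})
        ; isPrerightSemimodule = record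
          { *ᵣ-cong = λ e e′ → S.*-cong e (f.⟦⟧-cong e′)
          ; *ᵣ-zeroʳ = λ u → S.trans (S.*-congˡ f.0#-homo) (S.zeroʳ u)
          ; *ᵣ-distribˡ = λ u p p′ → S.trans (S.*-congˡ (f.+-homo p p′)) (S.distribˡ u _ _)
          ; *ᵣ-identityʳ = λ u → S.trans (S.*-congˡ f.1#-homo) (S.*-identityʳ u)
          ; *ᵣ-assoc = λ u p p′ → S.trans (S.*-assoc u _ _) (S.*-congˡ (S.sym (f.*-homo p p′)))
          ; *ᵣ-zeroˡ = λ p → S.zeroˡ _
          ; *ᵣ-distribʳ = λ p u v → S.distribʳ _ u v
          }
        ; *ₗ-*ᵣ-assoc = λ p u p′ → S.*-assoc p u _
        }
      ; -ᴹ‿cong = S.-‿cong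
      ; -ᴹ‿inverse = S.-‿inverse
      }

  viaHom : Bimodule S R s ℓs
  viaHom = record
    { Carrierᴹ = S.Carrier ; _≈ᴹ_ = S._≈_ ; _+ᴹ_ = S._+_ ; _*ₗ_ = S._*_
    ; _*ᵣ_ = λ u p → u S.* f.⟦ p ⟧ ; 0ᴹ = S.0# ; -ᴹ_ = S.-_
    ; isBimodule = viaHom-isBimodule
    }

opaque
  fromLeft-isBimodule : (K : CommutativeRing r ℓr) (M : LeftModule (CommutativeRing.ring K) m ℓm) → let module M = LeftModule M in
                        IsBimodule (CommutativeRing.ring K) (CommutativeRing.ring K) M._≈ᴹ_ M._+ᴹ_ M.0ᴹ M.-ᴹ_ M._*ₗ_ (flip M._*ₗ_)
  fromLeft-isBimodule K M = IsModule.isBimodule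
    (IsModuleFromLeft.isModule {commutativeRing = K} (record { isLeftModule = LeftModule.isLeftModule M }))

commutativeBimodule : (K : CommutativeRing r ℓr) → LeftModule (CommutativeRing.ring K) m ℓm →
                      Bimodule (CommutativeRing.ring K) (CommutativeRing.ring K) m ℓm
commutativeBimodule K M = record
  { Carrierᴹ = M.Carrierᴹ ; _≈ᴹ_ = M._≈ᴹ_ ; _+ᴹ_ = M._+ᴹ_ ; _*ₗ_ = M._*ₗ_ ; _*ᵣ_ = flip M._*ₗ_ ; 0ᴹ = M.0ᴹ ; -ᴹ_ = M.-ᴹ_
  ; isBimodule = fromLeft-isBimodule K M
  }
  where module M = LeftModule M

module _ {S : Ring s ℓs} {R : Ring r ℓr} (M : Bimodule S R m ℓm) (N : LeftModule R n ℓn) where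
  private
    module S = Ring S
    module R = Ring R
    module M = Bimodule M
    module N = LeftModule N

  data TensorRel : Rel (FreeAb (M.Carrierᴹ × N.Carrierᴹ)) (m ⊔ n ⊔ ℓm ⊔ ℓn ⊔ r) where
    ⊗-cong    : ∀ {u u′ v v′} → u M.≈ᴹ u′ → v N.≈ᴹ v′ → TensorRel (gen (u , v)) (gen (u′ , v′))
    ⊗-distribʳ : ∀ u u′ v → TensorRel (gen (u M.+ᴹ u′ , v)) (gen (u , v) +ᶠ gen (u′ , v))
    ⊗-distribˡ : ∀ u v v′ → TensorRel (gen (u , v N.+ᴹ v′)) (gen (u , v) +ᶠ gen (u , v′))
    ⊗-balanced : ∀ u p v → TensorRel (gen (u M.*ᵣ p , v)) (gen (u , p N.*ₗ v))

  TensorGroup : AbelianGroup (m ⊔ n) (m ⊔ n ⊔ ℓm ⊔ ℓn ⊔ r)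
  TensorGroup = Ab⟨ M.Carrierᴹ × N.Carrierᴹ ∣ TensorRel ⟩

  private
    module T = AbelianGroup TensorGroup

    _·_ : S.Carrier → T.Carrier → T.Carrier
    p · t = extend TensorGroup (λ (u , v) → gen (p M.*ₗ u , v)) t

    ·-congʳ : ∀ p {t u} → t T.≈ u → (p · t) T.≈ (p · u)
    ·-congʳ p = extend-cong TensorGroup _ λ where
      (⊗-cong e e′)      → rel (⊗-cong (M.*ₗ-congˡ e) e′)
      (⊗-distribʳ u u′ v) → transᶠ (rel (⊗-cong (M.*ₗ-distribˡ p u u′) N.≈ᴹ-refl)) (rel (⊗-distribʳ _ _ v))
      (⊗-distribˡ u v v′) → rel (⊗-distribˡ _ v v′)
      (⊗-balanced u c v) → transᶠ (rel (⊗-cong (M.≈ᴹ-sym (M.*ₗ-*ᵣ-assoc p u c)) N.≈ᴹ-refl)) (rel (⊗-balanced _ c v))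

    ·-assoc : ∀ p p′ t → ((p S.* p′) · t) T.≈ (p · (p′ · t))
    ·-assoc p p′ (gen (u , v)) = rel (⊗-cong (M.*ₗ-assoc p p′ u) N.≈ᴹ-refl)
    ·-assoc p p′ 0ᶠ       = reflᶠ
    ·-assoc p p′ (t +ᶠ u) = +ᶠ-cong (·-assoc p p′ t) (·-assoc p p′ u)
    ·-assoc p p′ (-ᶠ t)   = -ᶠ-cong (·-assoc p p′ t)

    ·-one : ∀ t → (S.1# · t) T.≈ t
    ·-one (gen (u , v)) = rel (⊗-cong (M.*ₗ-identityˡ u) N.≈ᴹ-refl)
    ·-one 0ᶠ       = reflᶠ
    ·-one (t +ᶠ u) = +ᶠ-cong (·-one t) (·-one u)
    ·-one (-ᶠ t)   = -ᶠ-cong (·-one t)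

  opaque
    tensor-isLeftModule : IsLeftModule S T._≈_ T._∙_ T.ε T._⁻¹ _·_
    tensor-isLeftModule = isLeftModuleFrom S TensorGroup _·_
      (λ {p} {p′} {t} e e′ → transᶠ (extend-≈ TensorGroup (λ (u , v) → rel (⊗-cong (M.*ₗ-congʳ e) N.≈ᴹ-refl)) t) (·-congʳ p′ e′))
      (λ p p′ t → transᶠ (extend-≈ TensorGroup (λ (u , v) → transᶠ (rel (⊗-cong (M.*ₗ-distribʳ u p p′) N.≈ᴹ-refl)) (rel (⊗-distribʳ _ _ v))) t)
                         (extend-+ TensorGroup t))
      (λ p t u → reflᶠ)
      ·-one
      ·-assoc

  tensor : LeftModule S (m ⊔ n) (m ⊔ n ⊔ ℓm ⊔ ℓn ⊔ r)
  tensor = record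
    { Carrierᴹ = T.Carrier ; _≈ᴹ_ = T._≈_ ; _+ᴹ_ = T._∙_ ; _*ₗ_ = _·_ ; 0ᴹ = T.ε ; -ᴹ_ = T._⁻¹
    ; isLeftModule = tensor-isLeftModule
    }

  tensor-zeroˡ : ∀ v → gen (M.0ᴹ , v) T.≈ 0ᶠ
  tensor-zeroˡ v = AbelianGroupProperties.identityˡ-unique TensorGroup _ _
    (T.sym (T.trans (rel (⊗-cong (M.≈ᴹ-sym (M.+ᴹ-identityˡ M.0ᴹ)) N.≈ᴹ-refl)) (rel (⊗-distribʳ _ _ v))))

  tensor-zeroʳ : ∀ u → gen (u , N.0ᴹ) T.≈ 0ᶠ
  tensor-zeroʳ u = AbelianGroupProperties.identityˡ-unique TensorGroup _ _
    (T.sym (T.trans (rel (⊗-cong M.≈ᴹ-refl (N.≈ᴹ-sym (N.+ᴹ-identityˡ N.0ᴹ)))) (rel (⊗-distribˡ u _ _))))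

Ind : {R : Ring r ℓr} {S : Ring s ℓs} → RingHom R S → LeftModule R m ℓm → LeftModule S (s ⊔ m) (r ⊔ s ⊔ m ⊔ ℓs ⊔ ℓm)
Ind f M = tensor (viaHom f) M

module _ {R : Ring r ℓr} (M : LeftModule R m ℓm) where
  open LeftModule M
  private
    module R = Ring R

  neg-* : ∀ p u → (R.- p) *ₗ u ≈ᴹ -ᴹ (p *ₗ u)
  neg-* p u = AbelianGroupProperties.inverseˡ-unique +ᴹ-abelianGroup _ _
    (≈ᴹ-trans (≈ᴹ-sym (*ₗ-distribʳ u (R.- p) p)) (≈ᴹ-trans (*ₗ-congʳ (R.-‿inverseˡ p)) (*ₗ-zeroˡ u)))

  neg-span : {S : Pred Carrierᴹ s} → ∀ {u} → Span M S u → Span M S (-ᴹ u)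
  neg-span {u = u} q = ≈-span (≈ᴹ-trans (neg-* R.1# u) (-ᴹ‿cong (*ₗ-identityˡ u))) (*-span (R.- R.1#) q)

module _ {R : Ring r ℓr} {S : Ring s ℓs} (f : RingHom R S) where
  private
    module S = Ring S
    module f = RingHom f

  Res-fg⁻ : (M : LeftModule S m ℓm) → FinitelyGenerated (Res f M) → FinitelyGenerated M
  Res-fg⁻ M (gs , all) = gs , λ u → go (all u)
    where
    go : ∀ {u} → Span (Res f M) (_∈ gs) u → Span M (_∈ gs) u
    go (incl q) = incl q
    go 0-span = 0-span
    go (+-span q q′) = +-span (go q) (go q′)
    go (*-span p q) = *-span f.⟦ p ⟧ (go q)
    go (≈-span e q) = ≈-span e (go q)

  Ind-fg : (M : LeftModule R m ℓm) → FinitelyGenerated M → FinitelyGenerated (Ind f M)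
  Ind-fg M (gs , all) = gs′ , go
    where
    module M = LeftModule M
    module I = LeftModule (Ind f M)
    one⊗_ : M.Carrierᴹ → I.Carrierᴹ
    one⊗ u = gen (S.1# , u)
    gs′ : List I.Carrierᴹ
    gs′ = map one⊗_ gs
    Spanned : I.Carrierᴹ → Set _
    Spanned = Span (Ind f M) (_∈ gs′)
    pure : ∀ p {u} → Span M (_∈ gs) u → Spanned (gen (p , u))
    pure p {u} (incl q) = ≈-span {u = gen (p S.* S.1# , u)} (rel (⊗-cong (S.*-identityʳ p) M.≈ᴹ-refl)) (*-span p {u = one⊗ u} (incl (∈-map⁺ one⊗_ q)))
    pure p 0-span = ≈-span {u = 0ᶠ} (symᶠ (tensor-zeroʳ (viaHom f) M p)) 0-span
    pure p (+-span {u} {v} q q′) = ≈-span {u = gen (p , u) +ᶠ gen (p , v)} (symᶠ (rel (⊗-distribˡ p u v))) (+-span {u = gen (p , u)} {v = gen (p , v)} (pure p q) (pure p q′))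
    pure p (*-span c {u} q) = ≈-span {u = gen (p S.* f.⟦ c ⟧ , u)} (rel (⊗-balanced p c u)) (pure (p S.* f.⟦ c ⟧) q)
    pure p (≈-span {u} e q) = ≈-span {u = gen (p , u)} (rel (⊗-cong S.refl e)) (pure p q)
    go : ∀ t → Spanned t
    go (gen (p , u)) = pure p (all u)
    go 0ᶠ = 0-span
    go (t +ᶠ u) = +-span {u = t} {v = u} (go t) (go u)
    go (-ᶠ t) = neg-span (Ind f M) {u = t} (go t)

record Field : Set₁ where
  field
    commutativeRing : CommutativeRing 0ℓ 0ℓ
  open CommutativeRing commutativeRing public
  field
    0≉1     : ¬ (0# ≈ 1#)
    inverse : ∀ u → ¬ (u ≈ 0#) → ∃[ v ] v * u ≈ 1#

module LinearAlgebra (em : ExcludedMiddle 0ℓ) (K : Field) where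
  private
    module K = Field K

  VectorSpace : Set₁
  VectorSpace = LeftModule K.ring 0ℓ 0ℓ

  module _ (V : VectorSpace) where
    open LeftModule V
    private
      module VP = AbelianGroupProperties +ᴹ-abelianGroup
      module VS = CommutativeSemigroupProperties (AbelianGroup.commutativeSemigroup +ᴹ-abelianGroup)
      open SetoidReasoning ≈ᴹ-setoid

    combination : ∀ {d} → Vector K.Carrier d → Vector Carrierᴹ d → Carrierᴹ
    combination c v = sum +ᴹ-rawMonoid (λ i → c i *ₗ v i)

    record Basis (d : ℕ) : Set where
      field
        vectors     : Vector Carrierᴹ d
        independent : ∀ c → combination c vectors ≈ᴹ 0ᴹ → ∀ i → c i K.≈ K.0#
        spanning    : ∀ u → ∃[ c ] u ≈ᴹ combination c vectors

    private
      Combination : ∀ {d} → Vector Carrierᴹ d → Pred Carrierᴹ 0ℓ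
      Combination v u = ∃[ c ] u ≈ᴹ combination c v

      combination-+ : ∀ {d} c c′ (v : Vector Carrierᴹ d) →
                      combination (λ i → c i K.+ c′ i) v ≈ᴹ combination c v +ᴹ combination c′ v
      combination-+ {zero}  c c′ v = ≈ᴹ-sym (+ᴹ-identityˡ 0ᴹ)
      combination-+ {suc d} c c′ v = ≈ᴹ-trans
        (+ᴹ-cong (*ₗ-distribʳ (v zero) (c zero) (c′ zero)) (combination-+ (c ∘ suc) (c′ ∘ suc) (v ∘ suc)))
        (VS.interchange _ _ _ _)

      combination-* : ∀ {d} p c (v : Vector Carrierᴹ d) → combination (λ i → p K.* c i) v ≈ᴹ p *ₗ combination c v
      combination-* {zero}  p c v = ≈ᴹ-sym (*ₗ-zeroʳ p)
      combination-* {suc d} p c v = ≈ᴹ-trans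
        (+ᴹ-cong (*ₗ-assoc p (c zero) (v zero)) (combination-* p (c ∘ suc) (v ∘ suc)))
        (≈ᴹ-sym (*ₗ-distribˡ p _ _))

      split : ∀ {g gs u} → Span V (_∈ (g ∷ gs)) u → ∃[ p ] ∃[ w ] Span V (_∈ gs) w × u ≈ᴹ p *ₗ g +ᴹ w
      split {g} (incl (here ≡.refl)) = K.1# , 0ᴹ , 0-span , ≈ᴹ-trans (≈ᴹ-sym (*ₗ-identityˡ g)) (≈ᴹ-sym (+ᴹ-identityʳ _))
      split {g} {u = u} (incl (there q)) = K.0# , u , incl q , ≈ᴹ-trans (≈ᴹ-sym (+ᴹ-identityˡ u)) (+ᴹ-congʳ (≈ᴹ-sym (*ₗ-zeroˡ g)))
      split {g} 0-span = K.0# , 0ᴹ , 0-span , ≈ᴹ-trans (≈ᴹ-sym (+ᴹ-identityˡ 0ᴹ)) (+ᴹ-congʳ (≈ᴹ-sym (*ₗ-zeroˡ g)))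
      split {g} (+-span s s′) with split s | split s′
      ... | p , w , t , e | p′ , w′ , t′ , e′ = p K.+ p′ , w +ᴹ w′ , +-span t t′ ,
        ≈ᴹ-trans (+ᴹ-cong e e′) (≈ᴹ-trans (VS.interchange _ _ _ _) (+ᴹ-congʳ (≈ᴹ-sym (*ₗ-distribʳ g p p′))))
      split {g} (*-span q s) with split s
      ... | p , w , t , e = q K.* p , q *ₗ w , *-span q t ,
        ≈ᴹ-trans (*ₗ-congˡ e) (≈ᴹ-trans (*ₗ-distribˡ q _ w) (+ᴹ-congʳ (≈ᴹ-sym (*ₗ-assoc q p g))))
      split (≈-span e s) with split s
      ... | p , w , t , e′ = p , w , t , ≈ᴹ-trans (≈ᴹ-sym e) e′

      span-[] : ∀ {u} → Span V (_∈ []) u → u ≈ᴹ 0ᴹ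
      span-[] (incl ())
      span-[] 0-span = ≈ᴹ-refl
      span-[] (+-span s s′) = ≈ᴹ-trans (+ᴹ-cong (span-[] s) (span-[] s′)) (+ᴹ-identityˡ 0ᴹ)
      span-[] (*-span p s) = ≈ᴹ-trans (*ₗ-congˡ (span-[] s)) (*ₗ-zeroʳ p)
      span-[] (≈-span e s) = ≈ᴹ-trans (≈ᴹ-sym e) (span-[] s)

      solve : ∀ {p q} {g w} → q K.* p K.≈ K.1# → p *ₗ g +ᴹ w ≈ᴹ 0ᴹ → g ≈ᴹ (K.- q) *ₗ w
      solve {p} {q} {g} {w} e e′ = begin
        g                    ≈⟨ *ₗ-identityˡ g ⟨
        K.1# *ₗ g            ≈⟨ *ₗ-congʳ e ⟨
        (q K.* p) *ₗ g       ≈⟨ *ₗ-assoc q p g ⟩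
        q *ₗ (p *ₗ g)        ≈⟨ VP.inverseˡ-unique _ _ (≈ᴹ-trans (≈ᴹ-sym (*ₗ-distribˡ q _ w)) (≈ᴹ-trans (*ₗ-congˡ e′) (*ₗ-zeroʳ q))) ⟩
        -ᴹ (q *ₗ w)          ≈⟨ neg-* V q w ⟨
        (K.- q) *ₗ w         ∎

      extract : ∀ gs → ∃[ d ] Σ (Vector Carrierᴹ d) λ v →
                (∀ c → combination c v ≈ᴹ 0ᴹ → ∀ i → c i K.≈ K.0#) × (∀ {u} → Span V (_∈ gs) u → Combination v u)
      extract [] = 0 , (λ ()) , (λ _ _ ()) , λ s → (λ ()) , span-[] s
      extract (g ∷ gs) with extract gs
      ... | d , v , independent , spanning with em {P = Combination v g}
      ... | yes (c , e) = d , v , independent , λ s →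
        let (p , w , t , e′) = split s
            (c′ , e″) = spanning t
        in (λ i → p K.* c i K.+ c′ i) ,
           ≈ᴹ-trans e′ (≈ᴹ-trans (+ᴹ-cong (≈ᴹ-trans (*ₗ-congˡ e) (≈ᴹ-sym (combination-* p c v))) e″)
                                 (≈ᴹ-sym (combination-+ _ c′ v)))
      ... | no g∉ = suc d , (g ◂ v) , independent′ , λ s →
        let (p , w , t , e′) = split s
            (c′ , e″) = spanning t
        in (p ◂ c′) , ≈ᴹ-trans e′ (+ᴹ-congˡ e″)
        where
        head-zero : ∀ c → combination c (g ◂ v) ≈ᴹ 0ᴹ → c zero K.≈ K.0#
        head-zero c e with em {P = c zero K.≈ K.0#}
        ... | yes z = z
        ... | no z = let (q , e′) = K.inverse (c zero) z in
          ⊥-elim (g∉ ((λ i → (K.- q) K.* c (suc i)) , ≈ᴹ-trans (solve e′ e) (≈ᴹ-sym (combination-* (K.- q) (c ∘ suc) v))))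

        independent′ : ∀ c → combination c (g ◂ v) ≈ᴹ 0ᴹ → ∀ i → c i K.≈ K.0#
        independent′ c e zero = head-zero c e
        independent′ c e (suc i) = independent (c ∘ suc)
          (≈ᴹ-trans (≈ᴹ-sym (+ᴹ-identityˡ _))
            (≈ᴹ-trans (+ᴹ-congʳ (≈ᴹ-sym (≈ᴹ-trans (*ₗ-congʳ (head-zero c e)) (*ₗ-zeroˡ g)))) e)) i

    basis : FinitelyGenerated V → ∃ Basis
    basis (gs , all) with extract gs
    ... | d , v , independent , spanning = d , record
      { vectors = v ; independent = independent ; spanning = λ u → spanning (all u) }

    subspace-fg : FinitelyGenerated V → (U : Submodule V 0ℓ) →
                  Σ (List Carrierᴹ) λ us → All (Submodule.Member U) us × (∀ {u} → Submodule.Member U u → Span V (_∈ us) u)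
    subspace-fg (gs , all) U₀ = let (us , us∈ , sp) = go gs U₀ in us , us∈ , λ u∈ → sp u∈ (all _)
      where
      go : ∀ gs (U : Submodule V 0ℓ) → Σ (List Carrierᴹ) λ us →
           All (Submodule.Member U) us × (∀ {u} → Submodule.Member U u → Span V (_∈ gs) u → Span V (_∈ us) u)
      go [] U = [] , [] , λ u∈ s → s
      go (g ∷ gs) U = result
        where
        open Submodule U
        U′ : Submodule V 0ℓ
        U′ = record
          { Member = λ u → Member u × Span V (_∈ gs) u
          ; resp = λ e (u∈ , s) → resp e u∈ , ≈-span e s
          ; 0∈ = 0∈ , 0-span
          ; +∈ = λ (u∈ , s) (v∈ , t) → +∈ u∈ v∈ , +-span s t
          ; *∈ = λ p (u∈ , s) → *∈ p u∈ , *-span p s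
          }

        weaken : ∀ {w us u} → Span V (_∈ us) u → Span V (_∈ (w ∷ us)) u
        weaken (incl q) = incl (there q)
        weaken 0-span = 0-span
        weaken (+-span s t) = +-span (weaken s) (weaken t)
        weaken (*-span p s) = *-span p (weaken s)
        weaken (≈-span e s) = ≈-span e (weaken s)

        HasPivot : Set
        HasPivot = ∃[ w ] ∃[ p ] ∃[ t ] Member w × Span V (_∈ gs) t × (w ≈ᴹ p *ₗ g +ᴹ t) × ¬ (p K.≈ K.0#)

        result : Σ (List Carrierᴹ) λ us → All Member us × (∀ {u} → Member u → Span V (_∈ (g ∷ gs)) u → Span V (_∈ us) u)
        result with go gs U′ | em {P = HasPivot}
        ... | us , us∈ , sp | no none = us , mapAll us∈ , λ {u} u∈ s →
          let (p , w , t , e) = split s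
              s′ = lemma u∈ e t
          in sp (u∈ , s′) s′
          where
          mapAll : ∀ {us} → All (Submodule.Member U′) us → All Member us
          mapAll [] = []
          mapAll (q ∷ qs) = proj₁ q ∷ mapAll qs
          lemma : ∀ {u p w} → Member u → u ≈ᴹ p *ₗ g +ᴹ w → Span V (_∈ gs) w → Span V (_∈ gs) u
          lemma {u} {p} {w} u∈ e t with em {P = p K.≈ K.0#}
          ... | yes z = ≈-span (≈ᴹ-sym (≈ᴹ-trans e (≈ᴹ-trans (+ᴹ-congʳ (≈ᴹ-trans (*ₗ-congʳ z) (*ₗ-zeroˡ g))) (+ᴹ-identityˡ w)))) t
          ... | no z = ⊥-elim (none (u , p , w , u∈ , t , e , z))
        ... | us , us∈ , sp | yes (w , p , t , w∈ , t∈ , e , z) = w ∷ us , w∈ ∷ mapAll us∈ , pivot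
          where
          mapAll : ∀ {us} → All (Submodule.Member U′) us → All Member us
          mapAll [] = []
          mapAll (q ∷ qs) = proj₁ q ∷ mapAll qs
          pivot : ∀ {u} → Member u → Span V (_∈ (g ∷ gs)) u → Span V (_∈ (w ∷ us)) u
          pivot {u} u∈ s with split s | K.inverse p z
          ... | p′ , t′ , t′∈ , e′ | q , q*p = ≈-span restore (+-span (*-span c (incl (here ≡.refl))) (weaken (sp v∈ v∈span)))
            where
            c = p′ K.* q
            v = u +ᴹ (K.- c) *ₗ w
            v∈ : Submodule.Member U′ v
            v≈ : t′ +ᴹ (K.- c) *ₗ t ≈ᴹ v
            v∈span : Span V (_∈ gs) v
            v∈span = ≈-span v≈ (+-span t′∈ (*-span (K.- c) t∈))
            v∈ = +∈ u∈ (*∈ (K.- c) w∈) , v∈span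
            c*p : c K.* p K.≈ p′
            c*p = K.trans (K.*-assoc p′ q p) (K.trans (K.*-congˡ q*p) (K.*-identityʳ p′))
            cancel : p′ *ₗ g +ᴹ (K.- c) *ₗ (p *ₗ g) ≈ᴹ 0ᴹ
            cancel = begin
              p′ *ₗ g +ᴹ (K.- c) *ₗ (p *ₗ g)   ≈⟨ +ᴹ-congˡ (neg-* V c _) ⟩
              p′ *ₗ g +ᴹ -ᴹ (c *ₗ (p *ₗ g))    ≈⟨ +ᴹ-congˡ (-ᴹ‿cong (≈ᴹ-trans (≈ᴹ-sym (*ₗ-assoc c p g)) (*ₗ-congʳ c*p))) ⟩
              p′ *ₗ g +ᴹ -ᴹ (p′ *ₗ g)          ≈⟨ -ᴹ‿inverseʳ _ ⟩
              0ᴹ                               ∎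
            v≈ = ≈ᴹ-sym (begin
              u +ᴹ (K.- c) *ₗ w                                          ≈⟨ +ᴹ-cong e′ (*ₗ-congˡ e) ⟩
              (p′ *ₗ g +ᴹ t′) +ᴹ (K.- c) *ₗ (p *ₗ g +ᴹ t)                ≈⟨ +ᴹ-congˡ (*ₗ-distribˡ _ _ _) ⟩
              (p′ *ₗ g +ᴹ t′) +ᴹ ((K.- c) *ₗ (p *ₗ g) +ᴹ (K.- c) *ₗ t)   ≈⟨ VS.interchange _ _ _ _ ⟩
              (p′ *ₗ g +ᴹ (K.- c) *ₗ (p *ₗ g)) +ᴹ (t′ +ᴹ (K.- c) *ₗ t)   ≈⟨ +ᴹ-congʳ cancel ⟩
              0ᴹ +ᴹ (t′ +ᴹ (K.- c) *ₗ t)                                 ≈⟨ +ᴹ-identityˡ _ ⟩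
              t′ +ᴹ (K.- c) *ₗ t                                         ∎)
            restore : c *ₗ w +ᴹ v ≈ᴹ u
            restore = begin
              c *ₗ w +ᴹ (u +ᴹ (K.- c) *ₗ w)   ≈⟨ VS.x∙yz≈y∙xz _ _ _ ⟩
              u +ᴹ (c *ₗ w +ᴹ (K.- c) *ₗ w)   ≈⟨ +ᴹ-congˡ (≈ᴹ-trans (+ᴹ-congˡ (neg-* V c w)) (-ᴹ‿inverseʳ _)) ⟩
              u +ᴹ 0ᴹ                         ≈⟨ +ᴹ-identityʳ u ⟩
              u                               ∎

  dimension : (V : VectorSpace) → FinitelyGenerated V → ℕ
  dimension V fg = proj₁ (basis V fg)

-- A complete ordered field is unique up to isomorphism, so ℂ below, the pairs u + v i over one, is the field of complex numbers.

record CompleteOrderedField : Set₁ where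
  field
    commutativeRing : CommutativeRing 0ℓ 0ℓ
  open CommutativeRing commutativeRing public
  infix 4 _≤ᵣ_
  field
    0≉1          : ¬ (0# ≈ 1#)
    inverse      : ∀ u → ¬ (u ≈ 0#) → ∃[ v ] v * u ≈ 1#
    _≤ᵣ_         : Rel Carrier 0ℓ
    isTotalOrder : IsTotalOrder _≈_ _≤ᵣ_
    +-monoˡ-≤    : ∀ {u v} w → u ≤ᵣ v → u + w ≤ᵣ v + w
    *-nonneg     : ∀ {u v} → 0# ≤ᵣ u → 0# ≤ᵣ v → 0# ≤ᵣ u * v

  IsUpperBound : Pred Carrier 0ℓ → Pred Carrier 0ℓ
  IsUpperBound P u = ∀ {v} → P v → v ≤ᵣ u

  field
    supremum     : (P : Pred Carrier 0ℓ) → ∃ P → ∃ (IsUpperBound P) →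
                   ∃[ s ] IsUpperBound P s × (∀ u → IsUpperBound P u → s ≤ᵣ u)

module Complex (em : ExcludedMiddle 0ℓ) (ℝ : CompleteOrderedField) where
  open CompleteOrderedField ℝ
  private
    module O = IsTotalOrder isTotalOrder
    module P = RingProperties ring
    open SetoidReasoning setoid

    module RS = CommutativeSemigroupProperties +-commutativeSemigroup
    module AP = AbelianGroupProperties +-abelianGroup

    neg-+ : ∀ u v → - (u + v) ≈ - u + - v
    neg-+ u v = sym (AP.⁻¹-∙-comm u v)

    *-sub : ∀ w u v → w * (u + - v) ≈ w * u + - (w * v)
    *-sub w u v = trans (distribˡ w u (- v)) (+-congˡ (sym (P.-‿distribʳ-* w v)))

    sub-* : ∀ w u v → (u + - v) * w ≈ u * w + - (v * w)
    sub-* w u v = trans (distribʳ w u (- v)) (+-congˡ (sym (P.-‿distribˡ-* v w)))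

    regroup : ∀ s t u v → (s + t) + (u + v) ≈ (s + u) + (v + t)
    regroup s t u v = trans (RS.interchange s t u v) (+-congˡ (+-comm t v))

    assoc-re : ∀ a b c d e f → (a * c + - (b * d)) * e + - ((a * d + b * c) * f) ≈ a * (c * e + - (d * f)) + - (b * (c * f + d * e))
    assoc-re a b c d e f = begin
      (a * c + - (b * d)) * e + - ((a * d + b * c) * f)                       ≈⟨ +-cong (sub-* e _ _) (trans (-‿cong (distribʳ f _ _)) (neg-+ _ _)) ⟩
      ((a * c) * e + - ((b * d) * e)) + (- ((a * d) * f) + - ((b * c) * f))   ≈⟨ regroup _ _ _ _ ⟩
      ((a * c) * e + - ((a * d) * f)) + (- ((b * c) * f) + - ((b * d) * e))   ≈⟨ +-cong (+-cong (*-assoc a c e) (-‿cong (*-assoc a d f))) (+-cong (-‿cong (*-assoc b c f)) (-‿cong (*-assoc b d e))) ⟩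
      (a * (c * e) + - (a * (d * f))) + (- (b * (c * f)) + - (b * (d * e)))   ≈⟨ +-cong (*-sub a _ _) (trans (-‿cong (distribˡ b _ _)) (neg-+ _ _)) ⟨
      a * (c * e + - (d * f)) + - (b * (c * f + d * e))                       ∎

    assoc-im : ∀ a b c d e f → (a * c + - (b * d)) * f + (a * d + b * c) * e ≈ a * (c * f + d * e) + b * (c * e + - (d * f))
    assoc-im a b c d e f = begin
      (a * c + - (b * d)) * f + (a * d + b * c) * e                       ≈⟨ +-cong (sub-* f _ _) (distribʳ e _ _) ⟩
      ((a * c) * f + - ((b * d) * f)) + ((a * d) * e + (b * c) * e)       ≈⟨ regroup _ _ _ _ ⟩
      ((a * c) * f + (a * d) * e) + ((b * c) * e + - ((b * d) * f))       ≈⟨ +-cong (+-cong (*-assoc a c f) (*-assoc a d e)) (+-cong (*-assoc b c e) (-‿cong (*-assoc b d f))) ⟩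
      (a * (c * f) + a * (d * e)) + (b * (c * e) + - (b * (d * f)))       ≈⟨ +-cong (distribˡ a _ _) (*-sub b _ _) ⟨
      a * (c * f + d * e) + b * (c * e + - (d * f))                       ∎

    distrib-re : ∀ a b c d e f → a * (c + e) + - (b * (d + f)) ≈ (a * c + - (b * d)) + (a * e + - (b * f))
    distrib-re a b c d e f = trans (+-cong (distribˡ a c e) (trans (-‿cong (distribˡ b d f)) (neg-+ _ _))) (RS.interchange _ _ _ _)

    distrib-im : ∀ a b c d e f → a * (d + f) + b * (c + e) ≈ (a * d + b * c) + (a * f + b * e)
    distrib-im a b c d e f = trans (+-cong (distribˡ a d f) (distribˡ b c e)) (RS.interchange _ _ _ _)

    comm-re : ∀ a b c d → a * c + - (b * d) ≈ c * a + - (d * b)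
    comm-re a b c d = +-cong (*-comm a c) (-‿cong (*-comm b d))

    comm-im : ∀ a b c d → a * d + b * c ≈ c * b + d * a
    comm-im a b c d = trans (+-comm _ _) (+-cong (*-comm b c) (*-comm a d))

    one-re : ∀ a b → 1# * a + - (0# * b) ≈ a
    one-re a b = trans (+-cong (*-identityˡ a) (trans (-‿cong (zeroˡ b)) AP.ε⁻¹≈ε)) (+-identityʳ a)

    one-im : ∀ a b → 1# * b + 0# * a ≈ b
    one-im a b = trans (+-cong (*-identityˡ b) (zeroˡ a)) (+-identityʳ b)

    neg-middle : ∀ w u v → (w * - u) * v ≈ - (w * (u * v))
    neg-middle w u v = trans (*-congʳ (sym (P.-‿distribʳ-* w u))) (trans (sym (P.-‿distribˡ-* (w * u) v)) (-‿cong (*-assoc w u v)))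

    inv-re : ∀ w a b → (w * a) * a + - ((w * - b) * b) ≈ w * (a * a + b * b)
    inv-re w a b = trans (+-cong (*-assoc w a a) (trans (-‿cong (neg-middle w b b)) (AP.⁻¹-involutive _))) (sym (distribˡ w _ _))

    inv-im : ∀ w a b → (w * a) * b + (w * - b) * a ≈ 0#
    inv-im w a b = trans (+-cong (*-assoc w a b) (trans (neg-middle w b a) (-‿cong (*-congˡ (*-comm b a))))) (-‿inverseʳ _)

    ℂᴿ : Set
    ℂᴿ = Carrier × Carrier

    infix 4 _≈ᶜ_
    _≈ᶜ_ : Rel ℂᴿ 0ℓ
    (p , q) ≈ᶜ (p′ , q′) = p ≈ p′ × q ≈ q′

    _+ᶜ_ _*ᶜ_ : Op₂ ℂᴿ
    (p , q) +ᶜ (p′ , q′) = p + p′ , q + q′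
    (p , q) *ᶜ (p′ , q′) = p * p′ + - (q * q′) , p * q′ + q * p′

    -ᶜ_ : ℂᴿ → ℂᴿ
    -ᶜ (p , q) = - p , - q

    0ᶜ 1ᶜ : ℂᴿ
    0ᶜ = 0# , 0#
    1ᶜ = 1# , 0#

    neg-nonneg : ∀ {u} → u ≤ᵣ 0# → 0# ≤ᵣ - u
    neg-nonneg {u} l = O.≤-respˡ-≈ (-‿inverseʳ u) (O.≤-respʳ-≈ (+-identityˡ (- u)) (+-monoˡ-≤ (- u) l))

    square-nonneg : ∀ u → 0# ≤ᵣ u * u
    square-nonneg u with O.total 0# u
    ... | inj₁ l = *-nonneg l l
    ... | inj₂ l = O.≤-respʳ-≈ (trans (sym (P.-‿distribˡ-* u (- u))) (trans (-‿cong (sym (P.-‿distribʳ-* u u))) (P.-‿involutive _)))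
                     (*-nonneg (neg-nonneg l) (neg-nonneg l))

    square-zero : ∀ u → u * u ≈ 0# → u ≈ 0#
    square-zero u e with em {P = u ≈ 0#}
    ... | yes z = z
    ... | no z = let (v , i) = inverse u z in
      trans (sym (*-identityˡ u)) (trans (*-congʳ (sym i)) (trans (*-assoc v u u) (trans (*-congˡ e) (zeroʳ v))))

    sum-zero : ∀ {u v} → 0# ≤ᵣ u → 0# ≤ᵣ v → u + v ≈ 0# → u ≈ 0#
    sum-zero {u} {v} lu lv e = O.antisym
      (O.≤-respʳ-≈ (trans (+-comm v u) e) (O.≤-respˡ-≈ (+-identityˡ u) (+-monoˡ-≤ u lv))) lu

    ℂ-ring : CommutativeRing 0ℓ 0ℓ
    ℂ-ring = record
      { Carrier = ℂᴿ ; _≈_ = _≈ᶜ_ ; _+_ = _+ᶜ_ ; _*_ = _*ᶜ_ ; -_ = -ᶜ_ ; 0# = 0ᶜ ; 1# = 1ᶜ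
      ; isCommutativeRing = record
        { isRing = record
          { +-isAbelianGroup = AbelianGroup.isAbelianGroup (abelianGroup +-abelianGroup +-abelianGroup)
          ; *-cong = λ (e , e′) (f , f′) → +-cong (*-cong e f) (-‿cong (*-cong e′ f′)) , +-cong (*-cong e f′) (*-cong e′ f)
          ; *-assoc = λ (a , b) (c , d) (e , f) → assoc-re a b c d e f , assoc-im a b c d e f
          ; *-identity = oneˡ , λ u → ≈ᶜ-trans {u *ᶜ 1ᶜ} {1ᶜ *ᶜ u} {u} (*ᶜ-comm u 1ᶜ) (oneˡ u)
          ; distrib = distribˡᶜ , λ u v w → ≈ᶜ-trans {(v +ᶜ w) *ᶜ u} {u *ᶜ (v +ᶜ w)} (*ᶜ-comm (v +ᶜ w) u)
              (≈ᶜ-trans {u *ᶜ (v +ᶜ w)} {(u *ᶜ v) +ᶜ (u *ᶜ w)} (distribˡᶜ u v w)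
                (+-cong (proj₁ (*ᶜ-comm u v)) (proj₁ (*ᶜ-comm u w)) , +-cong (proj₂ (*ᶜ-comm u v)) (proj₂ (*ᶜ-comm u w))))
          }
        ; *-comm = *ᶜ-comm
        }
      }
      where
      ≈ᶜ-trans : ∀ {u v w} → u ≈ᶜ v → v ≈ᶜ w → u ≈ᶜ w
      ≈ᶜ-trans (e , e′) (f , f′) = trans e f , trans e′ f′
      *ᶜ-comm : ∀ u v → (u *ᶜ v) ≈ᶜ (v *ᶜ u)
      *ᶜ-comm (a , b) (c , d) = comm-re a b c d , comm-im a b c d
      oneˡ : ∀ u → (1ᶜ *ᶜ u) ≈ᶜ u
      oneˡ (a , b) = one-re a b , one-im a b
      distribˡᶜ : ∀ u v w → (u *ᶜ (v +ᶜ w)) ≈ᶜ ((u *ᶜ v) +ᶜ (u *ᶜ w))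
      distribˡᶜ (a , b) (c , d) (e , f) = distrib-re a b c d e f , distrib-im a b c d e f

    ℂ-inverse : ∀ u → ¬ (u ≈ᶜ 0ᶜ) → ∃[ v ] (v *ᶜ u) ≈ᶜ 1ᶜ
    ℂ-inverse (a , b) u≉0 = (w * a , w * - b) , trans (inv-re w a b) wn , inv-im w a b
      where
      n≉0 : ¬ (a * a + b * b ≈ 0#)
      n≉0 e = u≉0
        ( square-zero a (sum-zero (square-nonneg a) (square-nonneg b) e)
        , square-zero b (sum-zero (square-nonneg b) (square-nonneg a) (trans (+-comm _ _) e)))
      w = proj₁ (inverse _ n≉0)
      wn = proj₂ (inverse _ n≉0)

  ℂ : Field
  ℂ = record
    { commutativeRing = ℂ-ring
    ; 0≉1 = λ e → 0≉1 (proj₁ e)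
    ; inverse = ℂ-inverse
    }

module Algebras (em : ExcludedMiddle 0ℓ) (K : Field) where
  open LinearAlgebra em K
  private
    module K = Field K

  record Algebra : Set₁ where
    field
      ring      : Ring 0ℓ 0ℓ
      scalar    : RingHom K.ring ring
    open Ring ring public
    open RingHom scalar public using () renaming (⟦_⟧ to scalar⟦_⟧)
    field
      central   : ∀ c u → scalar⟦ c ⟧ * u ≈ u * scalar⟦ c ⟧
    regular : LeftModule ring 0ℓ 0ℓ
    regular = TensorUnit.leftModule {R = ring}
    field
      finiteDimensional : FinitelyGenerated (Res scalar regular)

    space : LeftModule ring 0ℓ 0ℓ → VectorSpace
    space = Res scalar

    space-fg : (M : LeftModule ring 0ℓ 0ℓ) → FinitelyGenerated M → FinitelyGenerated (space M)
    space-fg M (gs , all) = gs′ , λ u → go (all u)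
      where
      module M = LeftModule M
      as = FinitelyGenerated.generators finiteDimensional
      gs′ = cartesianProductWith M._*ₗ_ as gs
      generator : ∀ {g} → g ∈ gs → ∀ {p} → Span (Res scalar regular) (_∈ as) p → Span (space M) (_∈ gs′) (p M.*ₗ g)
      generator g∈ (incl q) = incl (∈-cartesianProductWith⁺ M._*ₗ_ q g∈)
      generator g∈ 0-span = ≈-span (M.≈ᴹ-sym (M.*ₗ-zeroˡ _)) 0-span
      generator g∈ (+-span q q′) = ≈-span (M.≈ᴹ-sym (M.*ₗ-distribʳ _ _ _)) (+-span (generator g∈ q) (generator g∈ q′))
      generator g∈ (*-span c q) = ≈-span (M.≈ᴹ-sym (M.*ₗ-assoc _ _ _)) (*-span c (generator g∈ q))
      generator g∈ (≈-span e q) = ≈-span (M.*ₗ-congʳ e) (generator g∈ q)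
      multiple : ∀ p {u} → Span M (_∈ gs) u → Span (space M) (_∈ gs′) (p M.*ₗ u)
      multiple p (incl q) = generator q (FinitelyGenerated.generate finiteDimensional p)
      multiple p 0-span = ≈-span (M.≈ᴹ-sym (M.*ₗ-zeroʳ p)) 0-span
      multiple p (+-span q q′) = ≈-span (M.≈ᴹ-sym (M.*ₗ-distribˡ p _ _)) (+-span (multiple p q) (multiple p q′))
      multiple p (*-span c q) = ≈-span (M.*ₗ-assoc p c _) (multiple (p * c) q)
      multiple p (≈-span e q) = ≈-span (M.*ₗ-congˡ e) (multiple p q)
      go : ∀ {u} → Span M (_∈ gs) u → Span (space M) (_∈ gs′) u
      go q = ≈-span (M.*ₗ-identityˡ _) (multiple 1# q)

    dim : FGModule ring 0ℓ 0ℓ → ℕ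
    dim M = dimension (space (module′ M)) (space-fg (module′ M) (finitelyGenerated M))

    regularᶠᵍ : FGModule ring 0ℓ 0ℓ
    regularᶠᵍ = regular ⟨fg: [ 1# ] , (λ u → ≈-span (*-identityʳ u) (*-span u (incl (here ≡.refl)))) ⟩

  open Algebra using (ring; scalar; regular; space)

  Mod : Algebra → Set₁
  Mod A = LeftModule (ring A) 0ℓ 0ℓ

  FGMod : Algebra → Set₁
  FGMod A = FGModule (ring A) 0ℓ 0ℓ

  record AlgebraHom (A B : Algebra) : Set where
    private
      module A = Algebra A
      module B = Algebra B
    field
      ringHom : RingHom A.ring B.ring
    open RingHom ringHom public
    field
      scalar-homo : ∀ c → ⟦ A.scalar⟦ c ⟧ ⟧ B.≈ B.scalar⟦ c ⟧
    IsInjective IsBijective : Set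
    IsInjective = Injective A._≈_ B._≈_ ⟦_⟧
    IsBijective = Bijective A._≈_ B._≈_ ⟦_⟧

  infix 4 _≅ᴬ_
  _≅ᴬ_ : Algebra → Algebra → Set
  A ≅ᴬ B = Σ (AlgebraHom A B) AlgebraHom.IsBijective

  base : Algebra
  base = record
    { ring = K.ring
    ; scalar = record { ringHomomorphism = record
      { ⟦_⟧ = id
      ; isRingHomomorphism = IsRingIsomorphism.isRingHomomorphism (isRingIsomorphism (Ring.rawRing K.ring) K.refl) } }
    ; central = K.*-comm
    ; finiteDimensional = [ K.1# ] , λ u → ≈-span (K.*-identityʳ u) (*-span u (incl (here ≡.refl)))
    }
    where
    open import Algebra.Morphism.Construct.Identity using (isRingIsomorphism)
    open import Algebra.Morphism.Structures using (module RingMorphisms)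
    open RingMorphisms (Ring.rawRing K.ring) (Ring.rawRing K.ring)

  infixr 7 _⊗ₖ_
  _⊗ₖ_ : VectorSpace → VectorSpace → VectorSpace
  V ⊗ₖ W = tensor (commutativeBimodule K.commutativeRing V) W

  module _ (A B : Algebra) where
    private
      module A = Algebra A
      module B = Algebra B

    module Action (M : Mod A) (N : Mod B) where
      private
        module M = LeftModule M
        module N = LeftModule N
        T = LeftModule.+ᴹ-abelianGroup (A.space M ⊗ₖ B.space N)
        Tᴬᴮ = LeftModule.+ᴹ-abelianGroup (A.space A.regular ⊗ₖ B.space B.regular)
        module T = AbelianGroup T
        module Tᴬᴮ = AbelianGroup Tᴬᴮ

      act₁ : A.Carrier → B.Carrier → T.Carrier → T.Carrier
      act₁ p q = extend T (λ (u , v) → gen (p M.*ₗ u , q N.*ₗ v))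

      act : Tᴬᴮ.Carrier → T.Carrier → T.Carrier
      act t y = extend T (λ (p , q) → act₁ p q y) t

      private
        swapᴹ : ∀ p c u → p M.*ₗ (A.scalar⟦ c ⟧ M.*ₗ u) M.≈ᴹ A.scalar⟦ c ⟧ M.*ₗ (p M.*ₗ u)
        swapᴹ p c u = M.≈ᴹ-trans (M.≈ᴹ-sym (M.*ₗ-assoc _ _ u)) (M.≈ᴹ-trans (M.*ₗ-congʳ (A.sym (A.central c p))) (M.*ₗ-assoc _ _ u))
        swapᴺ : ∀ p c u → p N.*ₗ (B.scalar⟦ c ⟧ N.*ₗ u) N.≈ᴹ B.scalar⟦ c ⟧ N.*ₗ (p N.*ₗ u)
        swapᴺ p c u = N.≈ᴹ-trans (N.≈ᴹ-sym (N.*ₗ-assoc _ _ u)) (N.≈ᴹ-trans (N.*ₗ-congʳ (B.sym (B.central c p))) (N.*ₗ-assoc _ _ u))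

      act₁-cong : ∀ p q {y z} → y T.≈ z → act₁ p q y T.≈ act₁ p q z
      act₁-cong p q = extend-cong T _ λ where
        (⊗-cong e e′)      → rel (⊗-cong (M.*ₗ-congˡ e) (N.*ₗ-congˡ e′))
        (⊗-distribʳ u u′ v) → transᶠ (rel (⊗-cong (M.*ₗ-distribˡ p u u′) N.≈ᴹ-refl)) (rel (⊗-distribʳ _ _ _))
        (⊗-distribˡ u v v′) → transᶠ (rel (⊗-cong M.≈ᴹ-refl (N.*ₗ-distribˡ q v v′))) (rel (⊗-distribˡ _ _ _))
        (⊗-balanced u c v) → transᶠ (rel (⊗-cong (swapᴹ p c u) N.≈ᴹ-refl)) (transᶠ (rel (⊗-balanced _ c _)) (rel (⊗-cong M.≈ᴹ-refl (N.≈ᴹ-sym (swapᴺ q c v)))))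

      act-congˡ : ∀ t {y z} → y T.≈ z → act t y T.≈ act t z
      act-congˡ t e = extend-≈ T (λ (p , q) → act₁-cong p q e) t

      act-congʳ : ∀ {t t′} y → t Tᴬᴮ.≈ t′ → act t y T.≈ act t′ y
      act-congʳ y = extend-cong T _ λ where
        (⊗-cong e e′)      → extend-≈ T (λ _ → rel (⊗-cong (M.*ₗ-congʳ e) (N.*ₗ-congʳ e′))) y
        (⊗-distribʳ p p′ q) → transᶠ
          (extend-≈ T (λ _ → transᶠ (rel (⊗-cong (M.*ₗ-distribʳ _ p p′) N.≈ᴹ-refl)) (rel (⊗-distribʳ _ _ _))) y)
          (extend-+ T y)
        (⊗-distribˡ p q q′) → transᶠ
          (extend-≈ T (λ _ → transᶠ (rel (⊗-cong M.≈ᴹ-refl (N.*ₗ-distribʳ _ q q′))) (rel (⊗-distribˡ _ _ _))) y)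
          (extend-+ T y)
        (⊗-balanced p c q) → extend-≈ T (λ _ → transᶠ (rel (⊗-cong (M.*ₗ-assoc _ _ _) N.≈ᴹ-refl))
          (transᶠ (rel (⊗-balanced _ c _)) (rel (⊗-cong M.≈ᴹ-refl (N.≈ᴹ-sym (N.*ₗ-assoc _ _ _)))))) y

      act-one : ∀ y → act₁ A.1# B.1# y T.≈ y
      act-one (gen (u , v)) = rel (⊗-cong (M.*ₗ-identityˡ u) (N.*ₗ-identityˡ v))
      act-one 0ᶠ = reflᶠ
      act-one (y +ᶠ z) = +ᶠ-cong (act-one y) (act-one z)
      act-one (-ᶠ y) = -ᶠ-cong (act-one y)

      act₁-assoc : ∀ p q p′ q′ y → act₁ (p A.* p′) (q B.* q′) y T.≈ act₁ p q (act₁ p′ q′ y)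
      act₁-assoc p q p′ q′ (gen (u , v)) = rel (⊗-cong (M.*ₗ-assoc p p′ u) (N.*ₗ-assoc q q′ v))
      act₁-assoc p q p′ q′ 0ᶠ = reflᶠ
      act₁-assoc p q p′ q′ (y +ᶠ z) = +ᶠ-cong (act₁-assoc p q p′ q′ y) (act₁-assoc p q p′ q′ z)
      act₁-assoc p q p′ q′ (-ᶠ y) = -ᶠ-cong (act₁-assoc p q p′ q′ y)

    private
      module AB = Action A.regular B.regular
      V = A.space A.regular ⊗ₖ B.space B.regular
      module V = LeftModule V

    module _ (M : Mod A) (N : Mod B) where
      open Action M N
      private
        T = LeftModule.+ᴹ-abelianGroup (A.space M ⊗ₖ B.space N)
        module T = AbelianGroup T

      act-assoc : ∀ t t′ y → act (AB.act t t′) y T.≈ act t (act t′ y)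
      act-assoc (gen (p , q)) t′ y = go t′
        where
        go : ∀ t′ → act (AB.act₁ p q t′) y T.≈ act₁ p q (act t′ y)
        go (gen (p′ , q′)) = act₁-assoc p q p′ q′ y
        go 0ᶠ = reflᶠ
        go (t +ᶠ u) = +ᶠ-cong (go t) (go u)
        go (-ᶠ t) = -ᶠ-cong (go t)
      act-assoc 0ᶠ t′ y = reflᶠ
      act-assoc (t +ᶠ u) t′ y = +ᶠ-cong (act-assoc t t′ y) (act-assoc u t′ y)
      act-assoc (-ᶠ t) t′ y = -ᶠ-cong (act-assoc t t′ y)

    private
      act-identityʳ : ∀ t → AB.act t (gen (A.1# , B.1#)) V.≈ᴹ t
      act-identityʳ (gen (p , q)) = rel (⊗-cong (A.*-identityʳ p) (B.*-identityʳ q))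
      act-identityʳ 0ᶠ = reflᶠ
      act-identityʳ (t +ᶠ u) = +ᶠ-cong (act-identityʳ t) (act-identityʳ u)
      act-identityʳ (-ᶠ t) = -ᶠ-cong (act-identityʳ t)

    opaque
      tensorRing-isRing : IsRing V._≈ᴹ_ V._+ᴹ_ AB.act V.-ᴹ_ V.0ᴹ (gen (A.1# , B.1#))
      tensorRing-isRing = record
        { +-isAbelianGroup = V.+ᴹ-isAbelianGroup
        ; *-cong = λ {t} {t′} {u} {u′} e e′ → V.≈ᴹ-trans (AB.act-congʳ u e) (AB.act-congˡ t′ e′)
        ; *-assoc = act-assoc A.regular B.regular
        ; *-identity = AB.act-one , act-identityʳ
        ; distrib = (λ t u v → extend-+ V.+ᴹ-abelianGroup t) , λ t u v → V.≈ᴹ-refl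
        }

    tensorRing : Ring 0ℓ 0ℓ
    tensorRing = record
      { Carrier = V.Carrierᴹ ; _≈_ = V._≈ᴹ_ ; _+_ = V._+ᴹ_ ; _*_ = AB.act ; -_ = V.-ᴹ_ ; 0# = V.0ᴹ ; 1# = gen (A.1# , B.1#)
      ; isRing = tensorRing-isRing
      }

    tensorScalar : RingHom K.ring tensorRing
    tensorScalar = record { ringHomomorphism = record
      { ⟦_⟧ = λ c → gen (A.scalar⟦ c ⟧ , B.1#)
      ; isRingHomomorphism = record
        { isSemiringHomomorphism = record
          { isNearSemiringHomomorphism = record
            { +-isMonoidHomomorphism = record
              { isMagmaHomomorphism = record
                { isRelHomomorphism = record { cong = λ e → rel (⊗-cong (φ.⟦⟧-cong e) B.refl) }
                ; homo = λ c c′ → transᶠ (rel (⊗-cong (φ.+-homo c c′) B.refl)) (rel (⊗-distribʳ _ _ _))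
                }
              ; ε-homo = zero-homo
              }
            ; *-homo = λ c c′ → rel (⊗-cong (φ.*-homo c c′) (B.sym (B.*-identityˡ B.1#)))
            }
          ; 1#-homo = rel (⊗-cong φ.1#-homo B.refl)
          }
        ; -‿homo = λ c → AbelianGroupProperties.inverseˡ-unique V.+ᴹ-abelianGroup _ _
            (transᶠ (symᶠ (rel (⊗-distribʳ _ _ _)))
              (transᶠ (rel (⊗-cong (A.trans (A.+-congʳ (φ.-‿homo c)) (A.-‿inverseˡ _)) B.refl))
                (tensor-zeroˡ (commutativeBimodule K.commutativeRing (A.space A.regular)) (B.space B.regular) B.1#)))
        }
      } }
      where
      module φ = RingHom A.scalar
      zero-homo : gen (A.scalar⟦ K.0# ⟧ , B.1#) V.≈ᴹ 0ᶠ
      zero-homo = transᶠ (rel (⊗-cong φ.0#-homo B.refl))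
        (tensor-zeroˡ (commutativeBimodule K.commutativeRing (A.space A.regular)) (B.space B.regular) B.1#)

    opaque
      ⊠-isLeftModule : (M : Mod A) (N : Mod B) → let module T = LeftModule (A.space M ⊗ₖ B.space N) in
                       IsLeftModule tensorRing T._≈ᴹ_ T._+ᴹ_ T.0ᴹ T.-ᴹ_ (Action.act M N)
      ⊠-isLeftModule M N = isLeftModuleFrom tensorRing T act
        (λ {t} {t′} {y} {y′} e e′ → transᶠ (act-congʳ y e) (act-congˡ t′ e′))
        (λ t t′ y → reflᶠ)
        (λ t y z → extend-+ T t)
        act-one
        (act-assoc M N)
        where
        open Action M N
        T : AbelianGroup 0ℓ 0ℓ
        T = LeftModule.+ᴹ-abelianGroup (A.space M ⊗ₖ B.space N)

    infixr 7 _⊠ₘ_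
    _⊠ₘ_ : Mod A → Mod B → LeftModule tensorRing 0ℓ 0ℓ
    M ⊠ₘ N = record
      { Carrierᴹ = T.Carrierᴹ ; _≈ᴹ_ = T._≈ᴹ_ ; _+ᴹ_ = T._+ᴹ_ ; _*ₗ_ = Action.act M N ; 0ᴹ = T.0ᴹ ; -ᴹ_ = T.-ᴹ_
      ; isLeftModule = ⊠-isLeftModule M N
      }
      where module T = LeftModule (A.space M ⊗ₖ B.space N)

    ⊠-space-fg : (M : Mod A) (N : Mod B) → FinitelyGenerated (A.space M) → FinitelyGenerated (B.space N) →
                 FinitelyGenerated (Res tensorScalar (M ⊠ₘ N))
    ⊠-space-fg M N (gs , allᴹ) (hs , allᴺ) = gs′ , go
      where
      module M = LeftModule M
      module N = LeftModule N
      pair : M.Carrierᴹ → N.Carrierᴹ → LeftModule.Carrierᴹ (M ⊠ₘ N)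
      pair u v = gen (u , v)
      gs′ = cartesianProductWith pair gs hs
      M∙ = commutativeBimodule K.commutativeRing (A.space M)
      pureʳ : ∀ {g v} → g ∈ gs → Span (B.space N) (_∈ hs) v → Span (Res tensorScalar (M ⊠ₘ N)) (_∈ gs′) (gen (g , v))
      pureʳ g∈ (incl q) = incl (∈-cartesianProductWith⁺ pair g∈ q)
      pureʳ g∈ 0-span = ≈-span (symᶠ (tensor-zeroʳ M∙ (B.space N) _)) 0-span
      pureʳ g∈ (+-span q q′) = ≈-span (symᶠ (rel (⊗-distribˡ _ _ _))) (+-span (pureʳ g∈ q) (pureʳ g∈ q′))
      pureʳ g∈ (*-span c q) = ≈-span (transᶠ (rel (⊗-cong M.≈ᴹ-refl (N.*ₗ-identityˡ _))) (rel (⊗-balanced _ c _))) (*-span c (pureʳ g∈ q))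
      pureʳ g∈ (≈-span e q) = ≈-span (rel (⊗-cong M.≈ᴹ-refl e)) (pureʳ g∈ q)
      pure : ∀ {u} v → Span (A.space M) (_∈ gs) u → Span (Res tensorScalar (M ⊠ₘ N)) (_∈ gs′) (gen (u , v))
      pure v (incl q) = pureʳ q (allᴺ v)
      pure v 0-span = ≈-span (symᶠ (tensor-zeroˡ M∙ (B.space N) v)) 0-span
      pure v (+-span q q′) = ≈-span (symᶠ (rel (⊗-distribʳ _ _ _))) (+-span (pure v q) (pure v q′))
      pure v (*-span c q) = ≈-span (rel (⊗-cong M.≈ᴹ-refl (N.*ₗ-identityˡ v))) (*-span c (pure v q))
      pure v (≈-span e q) = ≈-span (rel (⊗-cong e N.≈ᴹ-refl)) (pure v q)
      go : ∀ t → Span (Res tensorScalar (M ⊠ₘ N)) (_∈ gs′) t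
      go (gen (u , v)) = pure v (allᴹ u)
      go 0ᶠ = 0-span
      go (t +ᶠ u) = +-span (go t) (go u)
      go (-ᶠ t) = neg-span (Res tensorScalar (M ⊠ₘ N)) (go t)

    infixr 7 _⊗ᴬ_
    _⊗ᴬ_ : Algebra
    _⊗ᴬ_ .Algebra.ring = tensorRing
    _⊗ᴬ_ .Algebra.scalar = tensorScalar
    _⊗ᴬ_ .Algebra.central = central
      where
      central : ∀ c t → AB.act (gen (A.scalar⟦ c ⟧ , B.1#)) t V.≈ᴹ AB.act t (gen (A.scalar⟦ c ⟧ , B.1#))
      central c (gen (p , q)) = rel (⊗-cong (A.central c p) (B.trans (B.*-identityˡ q) (B.sym (B.*-identityʳ q))))
      central c 0ᶠ = reflᶠ
      central c (t +ᶠ u) = +ᶠ-cong (central c t) (central c u)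
      central c (-ᶠ t) = -ᶠ-cong (central c t)
    _⊗ᴬ_ .Algebra.finiteDimensional = transport (⊠-space-fg A.regular B.regular A.finiteDimensional B.finiteDimensional)
      where
      W = Res tensorScalar (TensorUnit.leftModule {R = tensorRing})
      transport : FinitelyGenerated (Res tensorScalar (A.regular ⊠ₘ B.regular)) → FinitelyGenerated W
      transport (gs , all) = gs , λ u → go (all u)
        where
        go : ∀ {u} → Span (Res tensorScalar (A.regular ⊠ₘ B.regular)) (_∈ gs) u → Span W (_∈ gs) u
        go (incl q) = incl q
        go 0-span = 0-span
        go (+-span q q′) = +-span (go q) (go q′)
        go (*-span p q) = *-span p (go q)
        go (≈-span e q) = ≈-span e (go q)

  infixr 7 _⊠_
  _⊠_ : {A B : Algebra} → FGMod A → FGMod B → FGMod (A ⊗ᴬ B)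
  _⊠_ {A} {B} M N = MN ⟨fg: Res-fg⁻ (tensorScalar A B) MN (⊠-space-fg A B (module′ M) (module′ N)
      (Algebra.space-fg A (module′ M) (finitelyGenerated M)) (Algebra.space-fg B (module′ N) (finitelyGenerated N))) ⟩
    where MN = _⊠ₘ_ A B (module′ M) (module′ N)

  module _ {A B : Algebra} (f : AlgebraHom A B) where
    private
      module A = Algebra A
      module B = Algebra B
      module f = AlgebraHom f

    Resᶠᵍ : FGMod B → FGMod A
    Resᶠᵍ N = Res f.ringHom (module′ N) ⟨fg: Res-fg⁻ A.scalar _ (transport (B.space-fg (module′ N) (finitelyGenerated N))) ⟩
      where
      module N = LeftModule (module′ N)
      V = A.space (Res f.ringHom (module′ N))
      transport : FinitelyGenerated (B.space (module′ N)) → FinitelyGenerated V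
      transport (gs , all) = gs , λ u → go (all u)
        where
        go : ∀ {u} → Span (B.space (module′ N)) (_∈ gs) u → Span V (_∈ gs) u
        go (incl q) = incl q
        go 0-span = 0-span
        go (+-span q q′) = +-span (go q) (go q′)
        go (*-span c q) = ≈-span (N.*ₗ-congʳ (f.scalar-homo c)) (*-span c (go q))
        go (≈-span e q) = ≈-span e (go q)

    Indᶠᵍ : FGMod A → FGMod B
    Indᶠᵍ M = Ind f.ringHom (module′ M) ⟨fg: Ind-fg f.ringHom (module′ M) (finitelyGenerated M) ⟩

  -- U / (U ∩ W); finite generation uses that subspaces of finite-dimensional spaces are finite-dimensional.

  module _ {A : Algebra} (M : FGMod A) (U W : Submodule (module′ M) 0ℓ) where
    private
      module A = Algebra A
      module M = LeftModule (module′ M)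
      module U = Submodule U
      module W = Submodule W
      module MP = AbelianGroupProperties M.+ᴹ-abelianGroup
      module MS = CommutativeSemigroupProperties (AbelianGroup.commutativeSemigroup M.+ᴹ-abelianGroup)

      infix 4 _∼_
      _∼_ : Rel M.Carrierᴹ 0ℓ
      u ∼ v = W.Member (u M.+ᴹ M.-ᴹ v)

      ∼-reflexive : ∀ {u v} → u M.≈ᴹ v → u ∼ v
      ∼-reflexive {u} {v} e = W.resp (M.≈ᴹ-sym (M.≈ᴹ-trans (M.+ᴹ-congʳ e) (M.-ᴹ‿inverseʳ v))) W.0∈

      neg∈ : ∀ (X : Submodule (module′ M) 0ℓ) {u} → Submodule.Member X u → Submodule.Member X (M.-ᴹ u)
      neg∈ X u∈ = Submodule.resp X (M.≈ᴹ-trans (neg-* (module′ M) A.1# _) (M.-ᴹ‿cong (M.*ₗ-identityˡ _))) (Submodule.*∈ X (A.- A.1#) u∈)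

      ∼-sym : ∀ {u v} → u ∼ v → v ∼ u
      ∼-sym {u} {v} w = W.resp (M.≈ᴹ-trans (M.≈ᴹ-sym (MP.⁻¹-∙-comm u (M.-ᴹ v)))
        (M.≈ᴹ-trans (M.+ᴹ-comm _ _) (M.+ᴹ-congʳ (MP.⁻¹-involutive v)))) (neg∈ W w)

      ∼-trans : ∀ {u v w} → u ∼ v → v ∼ w → u ∼ w
      ∼-trans {u} {v} {w} p q = W.resp (M.≈ᴹ-trans (M.+ᴹ-assoc _ _ _) (M.+ᴹ-congˡ
        (M.≈ᴹ-trans (M.≈ᴹ-sym (M.+ᴹ-assoc _ _ _)) (M.≈ᴹ-trans (M.+ᴹ-congʳ (M.-ᴹ‿inverseˡ v)) (M.+ᴹ-identityˡ _))))) (W.+∈ p q)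

      ∼-+ : ∀ {u u′ v v′} → u ∼ u′ → v ∼ v′ → (u M.+ᴹ v) ∼ (u′ M.+ᴹ v′)
      ∼-+ p q = W.resp (M.≈ᴹ-trans (MS.interchange _ _ _ _) (M.+ᴹ-congˡ (MP.⁻¹-∙-comm _ _))) (W.+∈ p q)

      ∼-neg : ∀ {u u′} → u ∼ u′ → (M.-ᴹ u) ∼ (M.-ᴹ u′)
      ∼-neg p = W.resp (M.≈ᴹ-sym (MP.⁻¹-∙-comm _ _)) (neg∈ W p)

      *-neg : ∀ p u → p M.*ₗ (M.-ᴹ u) M.≈ᴹ M.-ᴹ (p M.*ₗ u)
      *-neg p u = MP.inverseˡ-unique _ _ (M.≈ᴹ-trans (M.≈ᴹ-sym (M.*ₗ-distribˡ p _ _)) (M.≈ᴹ-trans (M.*ₗ-congˡ (M.-ᴹ‿inverseˡ u)) (M.*ₗ-zeroʳ p)))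

      ∼-* : ∀ p {u u′} → u ∼ u′ → (p M.*ₗ u) ∼ (p M.*ₗ u′)
      ∼-* p q = W.resp (M.≈ᴹ-trans (M.*ₗ-distribˡ p _ _) (M.+ᴹ-congˡ (*-neg p _))) (W.*∈ p q)

      group : AbelianGroup 0ℓ 0ℓ
      group = record
        { Carrier = Σ M.Carrierᴹ U.Member ; _≈_ = λ u v → proj₁ u ∼ proj₁ v
        ; _∙_ = λ (u , u∈) (v , v∈) → u M.+ᴹ v , U.+∈ u∈ v∈
        ; ε = M.0ᴹ , U.0∈
        ; _⁻¹ = λ (u , u∈) → M.-ᴹ u , neg∈ U u∈
        ; isAbelianGroup = record
          { isGroup = record
            { isMonoid = record
              { isSemigroup = record
                { isMagma = record
                  { isEquivalence = record { refl = ∼-reflexive M.≈ᴹ-refl ; sym = ∼-sym ; trans = ∼-trans }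
                  ; ∙-cong = ∼-+
                  }
                ; assoc = λ _ _ _ → ∼-reflexive (M.+ᴹ-assoc _ _ _)
                }
              ; identity = (λ _ → ∼-reflexive (M.+ᴹ-identityˡ _)) , (λ _ → ∼-reflexive (M.+ᴹ-identityʳ _))
              }
            ; inverse = (λ _ → ∼-reflexive (M.-ᴹ‿inverseˡ _)) , (λ _ → ∼-reflexive (M.-ᴹ‿inverseʳ _))
            ; ⁻¹-cong = ∼-neg
            }
          ; comm = λ _ _ → ∼-reflexive (M.+ᴹ-comm _ _)
          }
        }
      module group = AbelianGroup group

    opaque
      subquotient-isLeftModule : IsLeftModule A.ring group._≈_ group._∙_ group.ε group._⁻¹ (λ p (u , u∈) → p M.*ₗ u , U.*∈ p u∈)
      subquotient-isLeftModule = isLeftModuleFrom A.ring group (λ p (u , u∈) → p M.*ₗ u , U.*∈ p u∈)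
        (λ {p} {p′} e e′ → ∼-trans (∼-* p e′) (∼-reflexive (M.*ₗ-congʳ e)))
        (λ _ _ _ → ∼-reflexive (M.*ₗ-distribʳ _ _ _))
        (λ _ _ _ → ∼-reflexive (M.*ₗ-distribˡ _ _ _))
        (λ _ → ∼-reflexive (M.*ₗ-identityˡ _))
        (λ _ _ _ → ∼-reflexive (M.*ₗ-assoc _ _ _))

    private
      quotient : Mod A
      quotient = record
        { Carrierᴹ = group.Carrier ; _≈ᴹ_ = group._≈_ ; _+ᴹ_ = group._∙_ ; _*ₗ_ = λ p (u , u∈) → p M.*ₗ u , U.*∈ p u∈
        ; 0ᴹ = group.ε ; -ᴹ_ = group._⁻¹ ; isLeftModule = subquotient-isLeftModule }

      V = A.space (module′ M)

      Uₖ : Submodule V 0ℓ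
      Uₖ = record { Member = U.Member ; resp = U.resp ; 0∈ = U.0∈ ; +∈ = U.+∈ ; *∈ = λ c → U.*∈ A.scalar⟦ c ⟧ }

      quotient-fg : FinitelyGenerated (A.space quotient)
      quotient-fg with subspace-fg V (A.space-fg (module′ M) (finitelyGenerated M)) Uₖ
      ... | us , us∈ , sp = lift us us∈ , λ (u , u∈) → let (_ , s) = go (sp u∈) in ≈-span (∼-reflexive M.≈ᴹ-refl) s
        where
        lift : ∀ us → All U.Member us → List (Σ M.Carrierᴹ U.Member)
        lift [] [] = []
        lift (u ∷ us) (u∈ ∷ us∈) = (u , u∈) ∷ lift us us∈
        find : ∀ {us} (us∈ : All U.Member us) {u} → u ∈ us → Σ (U.Member u) λ u∈ → (u , u∈) ∈ lift us us∈
        find (u∈ ∷ _) (here ≡.refl) = u∈ , here ≡.refl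
        find (_ ∷ us∈) (there q) = let (u∈ , q′) = find us∈ q in u∈ , there q′
        go : ∀ {u} → Span V (_∈ us) u → Σ (U.Member u) λ u∈ → Span (A.space quotient) (_∈ lift us us∈) (u , u∈)
        go (incl q) = let (u∈ , q′) = find us∈ q in u∈ , incl q′
        go 0-span = U.0∈ , 0-span
        go (+-span q q′) = _ , +-span (proj₂ (go q)) (proj₂ (go q′))
        go (*-span c q) = _ , *-span c (proj₂ (go q))
        go (≈-span e q) = let (u∈ , s) = go q in U.resp e u∈ , ≈-span (∼-reflexive e) s

    subquotient : FGMod A
    subquotient = quotient ⟨fg: Res-fg⁻ A.scalar quotient quotient-fg ⟩

-- Polynomials are coefficient lists, constant term first; trailing zeros are ignored by _≈ₚ_.

module Polynomial where

  Poly : Set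
  Poly = List ℤ

  coeff : Poly → ℕ → ℤ
  coeff []      _       = 0ℤ
  coeff (c ∷ f) zero    = c
  coeff (c ∷ f) (suc i) = coeff f i

  infix 4 _≈ₚ_
  record _≈ₚ_ (f g : Poly) : Set where
    constructor ⟪_⟫
    field
      at : ∀ i → coeff f i ≡ coeff g i
  open _≈ₚ_ public

  infixl 6 _+ₚ_
  infixl 7 _*ₚ_ _·ₚ_

  _+ₚ_ : Poly → Poly → Poly
  []      +ₚ g       = g
  (c ∷ f) +ₚ []      = c ∷ f
  (c ∷ f) +ₚ (d ∷ g) = (c ℤ.+ d) ∷ (f +ₚ g)

  -ₚ_ : Poly → Poly
  -ₚ_ = map (λ c → ℤ.- c)

  _·ₚ_ : ℤ → Poly → Poly
  c ·ₚ f = map (c ℤ.*_) f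

  _*ₚ_ : Poly → Poly → Poly
  []      *ₚ g = []
  (c ∷ f) *ₚ g = (c ·ₚ g) +ₚ (0ℤ ∷ (f *ₚ g))

  const : ℤ → Poly
  const c = [ c ]

  q^_ : ℕ → Poly
  q^ i = replicate i 0ℤ ++ [ 1ℤ ]

  [_]q : ℕ → Poly
  [ k ]q = replicate k 1ℤ

  [_]q! : ℕ → Poly
  [ zero  ]q! = const 1ℤ
  [ suc n ]q! = [ suc n ]q *ₚ [ n ]q!

  at-one : Poly → ℤ
  at-one []      = 0ℤ
  at-one (c ∷ f) = c ℤ.+ at-one f

  private
    refl′ : ∀ {f} → f ≈ₚ f
    refl′ = ⟪ (λ i → ≡.refl) ⟫
    sym′ : ∀ {f g} → f ≈ₚ g → g ≈ₚ f
    sym′ e = ⟪ (λ i → ≡.sym (at e i)) ⟫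
    trans′ : ∀ {f g h} → f ≈ₚ g → g ≈ₚ h → f ≈ₚ h
    trans′ e e′ = ⟪ (λ i → ≡.trans (at e i) (at e′ i)) ⟫

    coeff-+ : ∀ f g i → coeff (f +ₚ g) i ≡ coeff f i ℤ.+ coeff g i
    coeff-+ []      g       i       = ≡.sym (ℤ.+-identityˡ _)
    coeff-+ (c ∷ f) []      i       = ≡.sym (ℤ.+-identityʳ _)
    coeff-+ (c ∷ f) (d ∷ g) zero    = ≡.refl
    coeff-+ (c ∷ f) (d ∷ g) (suc i) = coeff-+ f g i

    coeff-neg : ∀ f i → coeff (-ₚ f) i ≡ ℤ.- coeff f i
    coeff-neg []      i       = ≡.refl
    coeff-neg (c ∷ f) zero    = ≡.refl
    coeff-neg (c ∷ f) (suc i) = coeff-neg f i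

    coeff-· : ∀ c f i → coeff (c ·ₚ f) i ≡ c ℤ.* coeff f i
    coeff-· c []      i       = ≡.sym (ℤ.*-zeroʳ c)
    coeff-· c (d ∷ f) zero    = ≡.refl
    coeff-· c (d ∷ f) (suc i) = coeff-· c f i

    +-cong′ : ∀ {f f′ g g′} → f ≈ₚ f′ → g ≈ₚ g′ → f +ₚ g ≈ₚ f′ +ₚ g′
    +-cong′ {f} {f′} {g} {g′} e e′ = ⟪ (λ i → ≡.trans (coeff-+ f g i) (≡.trans (≡.cong₂ ℤ._+_ (at e i) (at e′ i)) (≡.sym (coeff-+ f′ g′ i)))) ⟫

    +-assoc′ : ∀ f g h → (f +ₚ g) +ₚ h ≈ₚ f +ₚ (g +ₚ h)
    +-assoc′ f g h = ⟪ (λ i → begin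
      coeff ((f +ₚ g) +ₚ h) i                   ≡⟨ ≡.trans (coeff-+ (f +ₚ g) h i) (≡.cong (ℤ._+ coeff h i) (coeff-+ f g i)) ⟩
      (coeff f i ℤ.+ coeff g i) ℤ.+ coeff h i   ≡⟨ ℤ.+-assoc (coeff f i) (coeff g i) (coeff h i) ⟩
      coeff f i ℤ.+ (coeff g i ℤ.+ coeff h i)   ≡⟨ ≡.trans (coeff-+ f (g +ₚ h) i) (≡.cong (λ c → coeff f i ℤ.+ c) (coeff-+ g h i)) ⟨
      coeff (f +ₚ (g +ₚ h)) i                   ∎) ⟫
      where open ≡.≡-Reasoning

    +-comm′ : ∀ f g → f +ₚ g ≈ₚ g +ₚ f
    +-comm′ f g = ⟪ (λ i → ≡.trans (coeff-+ f g i) (≡.trans (ℤ.+-comm (coeff f i) _) (≡.sym (coeff-+ g f i)))) ⟫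

    +-inverseˡ′ : ∀ f → (-ₚ f) +ₚ f ≈ₚ []
    +-inverseˡ′ f = ⟪ (λ i → ≡.trans (coeff-+ (-ₚ f) f i) (≡.trans (≡.cong (ℤ._+ coeff f i) (coeff-neg f i)) (ℤ.+-inverseˡ (coeff f i)))) ⟫

    +-identityʳ′ : ∀ f → f +ₚ [] ≈ₚ f
    +-identityʳ′ f = +-comm′ f []

    +-group : AbelianGroup 0ℓ 0ℓ
    +-group = record
      { Carrier = Poly ; _≈_ = _≈ₚ_ ; _∙_ = _+ₚ_ ; ε = [] ; _⁻¹ = -ₚ_
      ; isAbelianGroup = record
        { isGroup = record
          { isMonoid = record
            { isSemigroup = record
              { isMagma = record
                { isEquivalence = record { refl = refl′ ; sym = sym′ ; trans = trans′ }
                ; ∙-cong = +-cong′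
                }
              ; assoc = +-assoc′
              }
            ; identity = (λ f → refl′) , +-identityʳ′
            }
          ; inverse = +-inverseˡ′ , λ f → trans′ (+-comm′ f (-ₚ f)) (+-inverseˡ′ f)
          ; ⁻¹-cong = λ {f} {g} e → ⟪ (λ i → ≡.trans (coeff-neg f i) (≡.trans (≡.cong (λ c → ℤ.- c) (at e i)) (≡.sym (coeff-neg g i)))) ⟫
          }
        ; comm = +-comm′
        }
      }
    module PS = CommutativeSemigroupProperties (AbelianGroup.commutativeSemigroup +-group)
    open SetoidReasoning (AbelianGroup.setoid +-group)

    ∷-cong : ∀ {c d f g} → c ≡ d → f ≈ₚ g → c ∷ f ≈ₚ d ∷ g
    ∷-cong e e′ = ⟪ (λ { zero → e ; (suc i) → at e′ i }) ⟫

    0∷[] : 0ℤ ∷ [] ≈ₚ []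
    0∷[] = ⟪ (λ { zero → ≡.refl ; (suc i) → ≡.refl }) ⟫

    ·-cong : ∀ {c d f g} → c ≡ d → f ≈ₚ g → c ·ₚ f ≈ₚ d ·ₚ g
    ·-cong {c} {d} {f} {g} e e′ = ⟪ (λ i → ≡.trans (coeff-· c f i) (≡.trans (≡.cong₂ ℤ._*_ e (at e′ i)) (≡.sym (coeff-· d g i)))) ⟫

    ·-distribˡ : ∀ c f g → c ·ₚ (f +ₚ g) ≈ₚ c ·ₚ f +ₚ c ·ₚ g
    ·-distribˡ c f g = ⟪ (λ i → ≡.trans (≡.trans (coeff-· c (f +ₚ g) i) (≡.cong (c ℤ.*_) (coeff-+ f g i)))
      (≡.trans (ℤ.*-distribˡ-+ c _ _) (≡.sym (≡.trans (coeff-+ (c ·ₚ f) (c ·ₚ g) i) (≡.cong₂ ℤ._+_ (coeff-· c f i) (coeff-· c g i)))))) ⟫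

    ·-distribʳ : ∀ c d f → (c ℤ.+ d) ·ₚ f ≈ₚ c ·ₚ f +ₚ d ·ₚ f
    ·-distribʳ c d f = ⟪ (λ i → ≡.trans (≡.trans (coeff-· (c ℤ.+ d) f i) (ℤ.*-distribʳ-+ (coeff f i) c d))
      (≡.sym (≡.trans (coeff-+ (c ·ₚ f) (d ·ₚ f) i) (≡.cong₂ ℤ._+_ (coeff-· c f i) (coeff-· d f i))))) ⟫

    ·-assoc : ∀ c d f → (c ℤ.* d) ·ₚ f ≈ₚ c ·ₚ (d ·ₚ f)
    ·-assoc c d f = ⟪ (λ i → ≡.trans (coeff-· (c ℤ.* d) f i) (≡.trans (ℤ.*-assoc c d _)
      (≡.sym (≡.trans (coeff-· c (d ·ₚ f) i) (≡.cong (c ℤ.*_) (coeff-· d f i)))))) ⟫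

    0·≈[] : ∀ f → 0ℤ ·ₚ f ≈ₚ []
    0·≈[] f = ⟪ (λ i → ≡.trans (coeff-· 0ℤ f i) (ℤ.*-zeroˡ (coeff f i))) ⟫

    1·≈ : ∀ f → 1ℤ ·ₚ f ≈ₚ f
    1·≈ f = ⟪ (λ i → ≡.trans (coeff-· 1ℤ f i) (ℤ.*-identityˡ _)) ⟫

    *-congˡ′ : ∀ f {g g′} → g ≈ₚ g′ → f *ₚ g ≈ₚ f *ₚ g′
    *-congˡ′ []      e = refl′
    *-congˡ′ (c ∷ f) e = +-cong′ (·-cong {c} ≡.refl e) (∷-cong ≡.refl (*-congˡ′ f e))

    *-distribʳ′ : ∀ h f g → (f +ₚ g) *ₚ h ≈ₚ f *ₚ h +ₚ g *ₚ h
    *-distribʳ′ h []      g       = refl′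
    *-distribʳ′ h (c ∷ f) []      = sym′ (+-identityʳ′ _)
    *-distribʳ′ h (c ∷ f) (d ∷ g) = begin
      (c ℤ.+ d) ·ₚ h +ₚ (0ℤ ∷ (f +ₚ g) *ₚ h)                              ≈⟨ +-cong′ (·-distribʳ c d h) (∷-cong ≡.refl (*-distribʳ′ h f g)) ⟩
      (c ·ₚ h +ₚ d ·ₚ h) +ₚ ((0ℤ ∷ f *ₚ h) +ₚ (0ℤ ∷ g *ₚ h))              ≈⟨ PS.interchange (c ·ₚ h) (d ·ₚ h) (0ℤ ∷ f *ₚ h) (0ℤ ∷ g *ₚ h) ⟩
      (c ·ₚ h +ₚ (0ℤ ∷ f *ₚ h)) +ₚ (d ·ₚ h +ₚ (0ℤ ∷ g *ₚ h))              ∎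

    *-zeroʳ′ : ∀ f → f *ₚ [] ≈ₚ []
    *-zeroʳ′ []      = refl′
    *-zeroʳ′ (c ∷ f) = trans′ (∷-cong ≡.refl (*-zeroʳ′ f)) 0∷[]

    *-∷ʳ : ∀ f d g → f *ₚ (d ∷ g) ≈ₚ d ·ₚ f +ₚ (0ℤ ∷ f *ₚ g)
    *-∷ʳ []      d g = sym′ 0∷[]
    *-∷ʳ (c ∷ f) d g = ∷-cong (≡.cong (ℤ._+ 0ℤ) (ℤ.*-comm c d)) (begin
      c ·ₚ g +ₚ f *ₚ (d ∷ g)                  ≈⟨ +-cong′ (refl′ {c ·ₚ g}) (*-∷ʳ f d g) ⟩
      c ·ₚ g +ₚ (d ·ₚ f +ₚ (0ℤ ∷ f *ₚ g))     ≈⟨ PS.x∙yz≈y∙xz (c ·ₚ g) (d ·ₚ f) (0ℤ ∷ f *ₚ g) ⟩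
      d ·ₚ f +ₚ (c ·ₚ g +ₚ (0ℤ ∷ f *ₚ g))     ∎)

    *-comm′ : ∀ f g → f *ₚ g ≈ₚ g *ₚ f
    *-comm′ []      g = sym′ (*-zeroʳ′ g)
    *-comm′ (c ∷ f) g = trans′ (+-cong′ (refl′ {c ·ₚ g}) (∷-cong ≡.refl (*-comm′ f g))) (sym′ (*-∷ʳ g c f))

    ·-* : ∀ c f g → (c ·ₚ f) *ₚ g ≈ₚ c ·ₚ (f *ₚ g)
    ·-* c []      g = refl′
    ·-* c (d ∷ f) g = begin
      (c ℤ.* d) ·ₚ g +ₚ (0ℤ ∷ (c ·ₚ f) *ₚ g)      ≈⟨ +-cong′ (·-assoc c d g) (∷-cong (≡.sym (ℤ.*-zeroʳ c)) (·-* c f g)) ⟩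
      c ·ₚ (d ·ₚ g) +ₚ c ·ₚ (0ℤ ∷ f *ₚ g)         ≈⟨ ·-distribˡ c (d ·ₚ g) (0ℤ ∷ f *ₚ g) ⟨
      c ·ₚ (d ·ₚ g +ₚ (0ℤ ∷ f *ₚ g))              ∎

    *-assoc′ : ∀ f g h → (f *ₚ g) *ₚ h ≈ₚ f *ₚ (g *ₚ h)
    *-assoc′ []      g h = refl′
    *-assoc′ (c ∷ f) g h = begin
      (c ·ₚ g +ₚ (0ℤ ∷ f *ₚ g)) *ₚ h                  ≈⟨ *-distribʳ′ h (c ·ₚ g) (0ℤ ∷ f *ₚ g) ⟩
      (c ·ₚ g) *ₚ h +ₚ (0ℤ ·ₚ h +ₚ (0ℤ ∷ (f *ₚ g) *ₚ h))  ≈⟨ +-cong′ (·-* c g h) (+-cong′ (0·≈[] h) (∷-cong ≡.refl (*-assoc′ f g h))) ⟩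
      c ·ₚ (g *ₚ h) +ₚ (0ℤ ∷ f *ₚ (g *ₚ h))           ∎

    one*′ : ∀ f → const 1ℤ *ₚ f ≈ₚ f
    one*′ f = trans′ (+-cong′ (1·≈ f) 0∷[]) (+-identityʳ′ f)

  ℤ[q] : CommutativeRing 0ℓ 0ℓ
  ℤ[q] = record
    { Carrier = Poly ; _≈_ = _≈ₚ_ ; _+_ = _+ₚ_ ; _*_ = _*ₚ_ ; -_ = -ₚ_ ; 0# = [] ; 1# = const 1ℤ
    ; isCommutativeRing = record
      { isRing = record
        { +-isAbelianGroup = AbelianGroup.isAbelianGroup +-group
        ; *-cong = λ {f} {f′} {g} {g′} e e′ → trans′ (*-congˡ′ f e′)
            (trans′ (*-comm′ f g′) (trans′ (*-congˡ′ g′ e) (*-comm′ g′ f′)))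
        ; *-assoc = *-assoc′
        ; *-identity = one*′ , λ f → trans′ (*-comm′ f (const 1ℤ)) (one*′ f)
        ; distrib = (λ h f g → trans′ (*-comm′ h (f +ₚ g)) (trans′ (*-distribʳ′ h f g) (+-cong′ (*-comm′ f h) (*-comm′ g h))))
                  , *-distribʳ′
        }
      ; *-comm = *-comm′
      }
    }

  ℤ[q]-ring : Ring 0ℓ 0ℓ
  ℤ[q]-ring = CommutativeRing.ring ℤ[q]

  constants : RingHom ℤ.+-*-ring ℤ[q]-ring
  constants = record { ringHomomorphism = record
    { ⟦_⟧ = const
    ; isRingHomomorphism = record
      { isSemiringHomomorphism = record
        { isNearSemiringHomomorphism = record
          { +-isMonoidHomomorphism = record
            { isMagmaHomomorphism = record
              { isRelHomomorphism = record { cong = λ e → ∷-cong e refl′ }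
              ; homo = λ c d → refl′
              }
            ; ε-homo = 0∷[]
            }
          ; *-homo = λ c d → ∷-cong (≡.sym (ℤ.+-identityʳ _)) refl′
          }
        ; 1#-homo = refl′
        }
      ; -‿homo = λ c → refl′
      }
    } }

open Polynomial public

module _ (G : AbelianGroup a ℓ) where
  private
    module G = AbelianGroup G
    module GP = AbelianGroupProperties G
    module GS = CommutativeSemigroupProperties G.commutativeSemigroup
    module Mult = MultProperties G.monoid
    open SetoidReasoning G.setoid

  infixr 8 _×ℤ_
  _×ℤ_ : ℤ → G.Carrier → G.Carrier
  (ℤ.+ k)    ×ℤ u = k Mult.× u
  ℤ.-[1+ k ] ×ℤ u = (suc k Mult.× u) G.⁻¹

  private
    ×-∙ : ∀ k u v → k Mult.× (u G.∙ v) G.≈ (k Mult.× u) G.∙ (k Mult.× v)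
    ×-∙ zero    u v = G.sym (G.identityˡ G.ε)
    ×-∙ (suc k) u v = G.trans (G.∙-congˡ (×-∙ k u v)) (GS.interchange _ _ _ _)

    ×-ε : ∀ k → k Mult.× G.ε G.≈ G.ε
    ×-ε zero    = G.refl
    ×-ε (suc k) = G.trans (G.identityˡ _) (×-ε k)

    ×-⁻¹ : ∀ k u → k Mult.× (u G.⁻¹) G.≈ (k Mult.× u) G.⁻¹
    ×-⁻¹ zero    u = G.sym GP.ε⁻¹≈ε
    ×-⁻¹ (suc k) u = G.trans (G.∙-congˡ (×-⁻¹ k u)) (GP.⁻¹-∙-comm _ _)

    ×ℤ-cong : ∀ c {u v} → u G.≈ v → (c ×ℤ u) G.≈ (c ×ℤ v)
    ×ℤ-cong (ℤ.+ k)    e = Mult.×-congʳ k e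
    ×ℤ-cong ℤ.-[1+ k ] e = G.⁻¹-cong (Mult.×-congʳ (suc k) e)

    ×ℤ-∙ : ∀ c u v → (c ×ℤ (u G.∙ v)) G.≈ ((c ×ℤ u) G.∙ (c ×ℤ v))
    ×ℤ-∙ (ℤ.+ k)    u v = ×-∙ k u v
    ×ℤ-∙ ℤ.-[1+ k ] u v = G.trans (G.⁻¹-cong (×-∙ (suc k) u v)) (G.sym (GP.⁻¹-∙-comm _ _))

    ×ℤ-neg : ∀ c u → ((ℤ.- c) ×ℤ u) G.≈ ((c ×ℤ u) G.⁻¹)
    ×ℤ-neg (ℤ.+ zero)  u = G.sym GP.ε⁻¹≈ε
    ×ℤ-neg (ℤ.+ suc k) u = G.refl
    ×ℤ-neg ℤ.-[1+ k ]  u = G.sym (GP.⁻¹-involutive _)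

    ×ℤ-⊖ : ∀ j k u → ((j ℤ.⊖ k) ×ℤ u) G.≈ ((j Mult.× u) G.∙ ((k Mult.× u) G.⁻¹))
    ×ℤ-⊖ j       zero    u = G.sym (G.trans (G.∙-congˡ GP.ε⁻¹≈ε) (G.identityʳ _))
    ×ℤ-⊖ zero    (suc k) u = G.sym (G.identityˡ _)
    ×ℤ-⊖ (suc j) (suc k) u = begin
      ((suc j ℤ.⊖ suc k) ×ℤ u)                                     ≡⟨ ≡.cong (_×ℤ u) (ℤ.[1+m]⊖[1+n]≡m⊖n j k) ⟩
      ((j ℤ.⊖ k) ×ℤ u)                                             ≈⟨ ×ℤ-⊖ j k u ⟩
      (j Mult.× u) G.∙ ((k Mult.× u) G.⁻¹)                         ≈⟨ G.trans (G.∙-congʳ (G.inverseʳ u)) (G.identityˡ _) ⟨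
      (u G.∙ u G.⁻¹) G.∙ ((j Mult.× u) G.∙ ((k Mult.× u) G.⁻¹))    ≈⟨ GS.interchange _ _ _ _ ⟩
      (u G.∙ (j Mult.× u)) G.∙ (u G.⁻¹ G.∙ ((k Mult.× u) G.⁻¹))    ≈⟨ G.∙-congˡ (GP.⁻¹-∙-comm _ _) ⟩
      (suc j Mult.× u) G.∙ ((suc k Mult.× u) G.⁻¹)                 ∎

    ×ℤ-+ : ∀ c d u → ((c ℤ.+ d) ×ℤ u) G.≈ ((c ×ℤ u) G.∙ (d ×ℤ u))
    ×ℤ-+ (ℤ.+ j)    (ℤ.+ k)    u = Mult.×-homo-+ u j k
    ×ℤ-+ (ℤ.+ j)    ℤ.-[1+ k ] u = ×ℤ-⊖ j (suc k) u
    ×ℤ-+ ℤ.-[1+ j ] (ℤ.+ k)    u = G.trans (×ℤ-⊖ k (suc j) u) (G.comm _ _)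
    ×ℤ-+ ℤ.-[1+ j ] ℤ.-[1+ k ] u = G.trans (G.⁻¹-cong (G.trans
      (Mult.×-congˡ {u} (≡.cong suc (≡.sym (ℕ.+-suc j k)))) (Mult.×-homo-+ u (suc j) (suc k)))) (G.sym (GP.⁻¹-∙-comm _ _))

    ×ℤ-*ℕ : ∀ k d u → (((ℤ.+ k) ℤ.* d) ×ℤ u) G.≈ (k Mult.× (d ×ℤ u))
    ×ℤ-*ℕ zero    d u = G.reflexive (≡.cong (_×ℤ u) (ℤ.*-zeroˡ d))
    ×ℤ-*ℕ (suc k) d u = begin
      (((ℤ.+ suc k) ℤ.* d) ×ℤ u)                ≡⟨ ≡.cong (_×ℤ u) (ℤ.suc-* (ℤ.+ k) d) ⟩
      ((d ℤ.+ (ℤ.+ k) ℤ.* d) ×ℤ u)              ≈⟨ ×ℤ-+ d ((ℤ.+ k) ℤ.* d) u ⟩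
      (d ×ℤ u) G.∙ (((ℤ.+ k) ℤ.* d) ×ℤ u)       ≈⟨ G.∙-congˡ (×ℤ-*ℕ k d u) ⟩
      (suc k Mult.× (d ×ℤ u))                   ∎

    ×ℤ-* : ∀ c d u → ((c ℤ.* d) ×ℤ u) G.≈ (c ×ℤ (d ×ℤ u))
    ×ℤ-* (ℤ.+ k)    d u = ×ℤ-*ℕ k d u
    ×ℤ-* ℤ.-[1+ k ] d u = begin
      ((ℤ.-[1+ k ] ℤ.* d) ×ℤ u)                 ≡⟨ ≡.cong (_×ℤ u) (ℤ.neg-distribˡ-* (ℤ.+ suc k) d) ⟨
      ((ℤ.- ((ℤ.+ suc k) ℤ.* d)) ×ℤ u)          ≈⟨ ×ℤ-neg ((ℤ.+ suc k) ℤ.* d) u ⟩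
      (((ℤ.+ suc k) ℤ.* d) ×ℤ u) G.⁻¹           ≈⟨ G.⁻¹-cong (×ℤ-*ℕ (suc k) d u) ⟩
      (suc k Mult.× (d ×ℤ u)) G.⁻¹              ∎

  opaque
    ℤ-isLeftModule : IsLeftModule ℤ.+-*-ring G._≈_ G._∙_ G.ε G._⁻¹ _×ℤ_
    ℤ-isLeftModule = isLeftModuleFrom ℤ.+-*-ring G _×ℤ_
      (λ { {c} ≡.refl e → ×ℤ-cong c e }) ×ℤ-+ ×ℤ-∙ (λ u → G.identityʳ u) ×ℤ-*

  ℤ-module : LeftModule ℤ.+-*-ring a ℓ
  ℤ-module = record
    { Carrierᴹ = G.Carrier ; _≈ᴹ_ = G._≈_ ; _+ᴹ_ = G._∙_ ; _*ₗ_ = _×ℤ_ ; 0ᴹ = G.ε ; -ᴹ_ = G._⁻¹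
    ; isLeftModule = ℤ-isLeftModule
    }

-- G ⊗_ℤ ℤ[q], written as the extension of scalars ℤ[q] ⊗_ℤ G

_[q] : AbelianGroup a ℓ → LeftModule ℤ[q]-ring a (a ⊔ ℓ)
G [q] = Ind constants (ℤ-module G)

_⊗ℤ_ : AbelianGroup a ℓ → AbelianGroup a ℓ → AbelianGroup a (a ⊔ ℓ)
G ⊗ℤ G′ = LeftModule.+ᴹ-abelianGroup (tensor (commutativeBimodule ℤ.+-*-commutativeRing (ℤ-module G)) (ℤ-module G′))

module _ {R : Ring r ℓr} (M : ℕ → LeftModule R m ℓm) where
  private
    module R = Ring R
    module M i = LeftModule (M i)

  record FiniteFamily : Set (m ⊔ ℓm) where
    field
      component : ∀ i → M.Carrierᴹ i
      bound     : ℕ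
      vanishes  : ∀ {i} → bound ≤ i → M._≈ᴹ_ i (component i) (M.0ᴹ i)
  open FiniteFamily

  private
    _≈⊕_ : Rel FiniteFamily ℓm
    u ≈⊕ v = ∀ i → M._≈ᴹ_ i (component u i) (component v i)

    _+⊕_ : Op₂ FiniteFamily
    u +⊕ v = record
      { component = λ i → M._+ᴹ_ i (component u i) (component v i)
      ; bound = bound u ℕ.⊔ bound v
      ; vanishes = λ {i} l → M.≈ᴹ-trans i (M.+ᴹ-cong i (vanishes u (ℕ.≤-trans (ℕ.m≤m⊔n _ _) l)) (vanishes v (ℕ.≤-trans (ℕ.m≤n⊔m (bound u) _) l)))
                                          (M.+ᴹ-identityˡ i _)
      }

    group : AbelianGroup (m ⊔ ℓm) ℓm
    group = record
      { Carrier = FiniteFamily ; _≈_ = _≈⊕_ ; _∙_ = _+⊕_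
      ; ε = record { component = M.0ᴹ ; bound = 0 ; vanishes = λ {i} _ → M.≈ᴹ-refl i }
      ; _⁻¹ = λ u → record
          { component = λ i → M.-ᴹ_ i (component u i) ; bound = bound u
          ; vanishes = λ {i} l → M.≈ᴹ-trans i (M.-ᴹ‿cong i (vanishes u l)) (AbelianGroupProperties.ε⁻¹≈ε (M.+ᴹ-abelianGroup i)) }
      ; isAbelianGroup = record
        { isGroup = record
          { isMonoid = record
            { isSemigroup = record
              { isMagma = record
                { isEquivalence = record
                  { refl = λ i → M.≈ᴹ-refl i ; sym = λ e i → M.≈ᴹ-sym i (e i) ; trans = λ e e′ i → M.≈ᴹ-trans i (e i) (e′ i) }
                ; ∙-cong = λ e e′ i → M.+ᴹ-cong i (e i) (e′ i)
                }
              ; assoc = λ u v w i → M.+ᴹ-assoc i _ _ _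
              }
            ; identity = (λ u i → M.+ᴹ-identityˡ i _) , (λ u i → M.+ᴹ-identityʳ i _)
            }
          ; inverse = (λ u i → M.-ᴹ‿inverseˡ i _) , (λ u i → M.-ᴹ‿inverseʳ i _)
          ; ⁻¹-cong = λ e i → M.-ᴹ‿cong i (e i)
          }
        ; comm = λ u v i → M.+ᴹ-comm i _ _
        }
      }
    module group = AbelianGroup group

    _*⊕_ : R.Carrier → FiniteFamily → FiniteFamily
    p *⊕ u = record
      { component = λ i → M._*ₗ_ i p (component u i) ; bound = bound u
      ; vanishes = λ {i} l → M.≈ᴹ-trans i (M.*ₗ-congˡ i (vanishes u l)) (M.*ₗ-zeroʳ i p) }

  opaque
    ⨁-isLeftModule : IsLeftModule R _≈⊕_ _+⊕_ group.ε group._⁻¹ _*⊕_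
    ⨁-isLeftModule = isLeftModuleFrom R group _*⊕_
      (λ e e′ i → M.*ₗ-cong i e (e′ i))
      (λ p p′ u i → M.*ₗ-distribʳ i _ p p′)
      (λ p u v i → M.*ₗ-distribˡ i p _ _)
      (λ u i → M.*ₗ-identityˡ i _)
      (λ p p′ u i → M.*ₗ-assoc i p p′ _)

  ⨁ : LeftModule R (m ⊔ ℓm) ℓm
  ⨁ = record
    { Carrierᴹ = FiniteFamily ; _≈ᴹ_ = _≈⊕_ ; _+ᴹ_ = _+⊕_ ; _*ₗ_ = _*⊕_ ; 0ᴹ = group.ε ; -ᴹ_ = group._⁻¹
    ; isLeftModule = ⨁-isLeftModule }

  ι : ∀ n → M.Carrierᴹ n → FiniteFamily
  ι n u = record { component = at-index ; bound = suc n ; vanishes = vanish _ }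
    where
    at-index : ∀ i → M.Carrierᴹ i
    at-index i with n ℕ.≟ i
    ... | yes ≡.refl = u
    ... | no _       = M.0ᴹ i
    vanish : ∀ i → suc n ≤ i → M._≈ᴹ_ i (at-index i) (M.0ᴹ i)
    vanish i l with n ℕ.≟ i
    ... | yes ≡.refl = ⊥-elim (ℕ.1+n≰n l)
    ... | no _       = M.≈ᴹ-refl i

open FiniteFamily public

-- Gives meaning to u = Σ_{i≥0} f i when all but finitely many terms vanish.

record IsSumOf (G : AbelianGroup a ℓ) (f : ℕ → AbelianGroup.Carrier G) (u : AbelianGroup.Carrier G) : Set ℓ where
  open AbelianGroup G
  field
    terms      : ℕ
    restVanish : ∀ {i} → terms ≤ i → f i ≈ ε
    partialSum : u ≈ sum rawMonoid {terms} (λ i → f (toℕ i))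

-- H lists the homogeneous components H_n; ℋ is the graded module itself.

module QTwistedHopf (H : ℕ → LeftModule ℤ[q]-ring m ℓm) where

  ℋ : LeftModule ℤ[q]-ring (m ⊔ ℓm) ℓm
  ℋ = ⨁ H

  _⊗_ : LeftModule ℤ[q]-ring a ℓ₁ → LeftModule ℤ[q]-ring b ℓ₂ → LeftModule ℤ[q]-ring (a ⊔ b) (a ⊔ b ⊔ ℓ₁ ⊔ ℓ₂)
  V ⊗ W = tensor (commutativeBimodule ℤ[q] V) W

  private
    module H n = LeftModule (H n)
    module ℋ = LeftModule ℋ
    module ℋℋ = LeftModule (ℋ ⊗ ℋ)
    module ℋℋℋ = LeftModule (ℋ ⊗ (ℋ ⊗ ℋ))
    1ₚ : Poly
    1ₚ = const 1ℤ
    ℤ[q]-self : LeftModule ℤ[q]-ring 0ℓ 0ℓ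
    ℤ[q]-self = TensorUnit.leftModule {R = ℤ[q]-ring}

  record IsGradedProduct (_∗_ : Op₂ ℋ.Carrierᴹ) : Set (m ⊔ ℓm) where
    field
      ∗-cong     : ∀ {u u′ v v′} → u ℋ.≈ᴹ u′ → v ℋ.≈ᴹ v′ → (u ∗ v) ℋ.≈ᴹ (u′ ∗ v′)
      ∗-distribˡ : ∀ u v w → (u ∗ (v ℋ.+ᴹ w)) ℋ.≈ᴹ ((u ∗ v) ℋ.+ᴹ (u ∗ w))
      ∗-distribʳ : ∀ u v w → ((v ℋ.+ᴹ w) ∗ u) ℋ.≈ᴹ ((v ∗ u) ℋ.+ᴹ (w ∗ u))
      ∗-scalarˡ  : ∀ p u v → ((p ℋ.*ₗ u) ∗ v) ℋ.≈ᴹ (p ℋ.*ₗ (u ∗ v))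
      ∗-scalarʳ  : ∀ p u v → (u ∗ (p ℋ.*ₗ v)) ℋ.≈ᴹ (p ℋ.*ₗ (u ∗ v))
      ∗-graded   : ∀ k l (u : H.Carrierᴹ k) (v : H.Carrierᴹ l) →
                   Σ (H.Carrierᴹ (k ℕ.+ l)) λ w → (ι H k u ∗ ι H l v) ℋ.≈ᴹ ι H (k ℕ.+ l) w

  -- The maps out of tensor products below are given by additive extension of their values on pure tensors, with well-definedness
  -- on classes left implicit: all of these formulas are ℤ[q]-balanced when _∗_ is bilinear.

  -- (a ⊗ b) ·_q (a′ ⊗ b′) = Σ_{i,j} q^(i j) a a′_j ⊗ b_i b′, where b = Σ_i b_i and a′ = Σ_j a′_j
  -- are the decompositions into homogeneous components
  twistedProduct : Op₂ ℋ.Carrierᴹ → Op₂ ℋℋ.Carrierᴹ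
  twistedProduct _∗_ t t′ =
    extend ℋℋ.+ᴹ-abelianGroup (λ (a , b) →
      extend ℋℋ.+ᴹ-abelianGroup (λ (a′ , b′) →
        sum ℋℋ.+ᴹ-rawMonoid {bound b} (λ i →
          sum ℋℋ.+ᴹ-rawMonoid {bound a′} (λ j →
            (q^ (toℕ i ℕ.* toℕ j)) ℋℋ.*ₗ
            gen (a ∗ ι H (toℕ j) (component a′ (toℕ j)) , ι H (toℕ i) (component b (toℕ i)) ∗ b′)))) t′) t

  -- Σ_{k+l=n} H_k ⊗ H_l inside ℋ ⊗ ℋ
  TensorDegree : ℕ → Pred ℋℋ.Carrierᴹ (m ⊔ ℓm)
  TensorDegree n = Span (ℋ ⊗ ℋ) λ t →
    ∃[ k ] ∃[ l ] k ℕ.+ l ≡ n × Σ (H.Carrierᴹ k) λ u → Σ (H.Carrierᴹ l) λ v → t ≡ gen (ι H k u , ι H l v)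

  record IsQTwistedHopfAlgebra (_∗_ : Op₂ ℋ.Carrierᴹ) (Δ : LeftModuleHom ℋ (ℋ ⊗ ℋ)) : Set (m ⊔ ℓm) where
    private
      module Δ = LeftModuleHom Δ
      _·q_ : Op₂ ℋℋ.Carrierᴹ
      _·q_ = twistedProduct _∗_
    field
      isGradedProduct : IsGradedProduct _∗_
      ∗-assoc         : ∀ u v w → ((u ∗ v) ∗ w) ℋ.≈ᴹ (u ∗ (v ∗ w))
      one             : H.Carrierᴹ 0
    𝟙 : ℋ.Carrierᴹ
    𝟙 = ι H 0 one
    field
      ∗-identityˡ : ∀ u → (𝟙 ∗ u) ℋ.≈ᴹ u
      ∗-identityʳ : ∀ u → (u ∗ 𝟙) ℋ.≈ᴹ u

      connected-surjective : ∀ u → ∃[ p ] H._≈ᴹ_ 0 u (H._*ₗ_ 0 p one)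
      connected-injective  : ∀ p → H._≈ᴹ_ 0 (H._*ₗ_ 0 p one) (H.0ᴹ 0) → p ≈ₚ []

      Δ-graded : ∀ n (u : H.Carrierᴹ n) → TensorDegree n (Δ.⟦ ι H n u ⟧)
      Δ-coassoc : ∀ u →
        extend ℋℋℋ.+ᴹ-abelianGroup (λ (a , b) →
          extend ℋℋℋ.+ᴹ-abelianGroup (λ (a₁ , a₂) → gen (a₁ , gen (a₂ , b))) Δ.⟦ a ⟧) Δ.⟦ u ⟧
        ℋℋℋ.≈ᴹ
        extend ℋℋℋ.+ᴹ-abelianGroup (λ (a , b) → gen (a , Δ.⟦ b ⟧)) Δ.⟦ u ⟧

      counit : LeftModuleHom ℋ ℤ[q]-self
    module ε = LeftModuleHom counit
    field
      ε-graded : ∀ n (u : H.Carrierᴹ (suc n)) → ε.⟦ ι H (suc n) u ⟧ ≈ₚ []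
      ε-left   : ∀ u → extend ℋ.+ᴹ-abelianGroup (λ (a , b) → ε.⟦ a ⟧ ℋ.*ₗ b) Δ.⟦ u ⟧ ℋ.≈ᴹ u
      ε-right  : ∀ u → extend ℋ.+ᴹ-abelianGroup (λ (a , b) → ε.⟦ b ⟧ ℋ.*ₗ a) Δ.⟦ u ⟧ ℋ.≈ᴹ u

      Δ-∗ : ∀ u v → Δ.⟦ u ∗ v ⟧ ℋℋ.≈ᴹ (Δ.⟦ u ⟧ ·q Δ.⟦ v ⟧)
      Δ-𝟙 : Δ.⟦ 𝟙 ⟧ ℋℋ.≈ᴹ gen (𝟙 , 𝟙)
      ε-∗ : ∀ u v → ε.⟦ u ∗ v ⟧ ≈ₚ (ε.⟦ u ⟧ *ₚ ε.⟦ v ⟧)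
      ε-𝟙 : ε.⟦ 𝟙 ⟧ ≈ₚ 1ₚ

      antipode : LeftModuleHom ℋ ℋ
    module S = LeftModuleHom antipode
    field
      S-graded : ∀ n (u : H.Carrierᴹ n) → Σ (H.Carrierᴹ n) λ v → S.⟦ ι H n u ⟧ ℋ.≈ᴹ ι H n v
      S-left   : ∀ u → extend ℋ.+ᴹ-abelianGroup (λ (a , b) → S.⟦ a ⟧ ∗ b) Δ.⟦ u ⟧ ℋ.≈ᴹ (ε.⟦ u ⟧ ℋ.*ₗ 𝟙)
      S-right  : ∀ u → extend ℋ.+ᴹ-abelianGroup (λ (a , b) → a ∗ S.⟦ b ⟧) Δ.⟦ u ⟧ ℋ.≈ᴹ (ε.⟦ u ⟧ ℋ.*ₗ 𝟙)

    _^∗_ : ℋ.Carrierᴹ → ℕ → ℋ.Carrierᴹ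
    u ^∗ zero  = 𝟙
    u ^∗ suc n = u ∗ (u ^∗ n)

module Towers (em : ExcludedMiddle 0ℓ) (K : Field) where
  open Algebras em K public
  open Algebra using (regular; dim)

  record IsShortExact {R : Ring 0ℓ 0ℓ} (M′ M M″ : FGModule R 0ℓ 0ℓ) : Set where
    private
      module M′ = FGModule M′
      module M = FGModule M
      module M″ = FGModule M″
    field
      f : LeftModuleHom M′.module′ M.module′
      g : LeftModuleHom M.module′ M″.module′
    module f = LeftModuleHom f
    module g = LeftModuleHom g
    field
      f-injective  : f.IsInjective
      g-surjective : g.IsSurjective
      image⊆kernel : ∀ u → g.⟦ f.⟦ u ⟧ ⟧ M″.≈ᴹ M″.0ᴹ
      kernel⊆image : ∀ v → g.⟦ v ⟧ M″.≈ᴹ M″.0ᴹ → ∃[ u ] f.⟦ u ⟧ M.≈ᴹ v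

  data ExactRel {R : Ring 0ℓ 0ℓ} : Rel (FreeAb (FGModule R 0ℓ 0ℓ)) (lsuc 0ℓ) where
    exact : ∀ {M′ M M″ : FGModule R 0ℓ 0ℓ} → IsShortExact M′ M M″ → ExactRel (gen M) (gen M′ +ᶠ gen M″)

  G₀ : Algebra → AbelianGroup (lsuc 0ℓ) (lsuc 0ℓ)
  G₀ A = Ab⟨ FGMod A ∣ ExactRel ⟩

  -- [M] ⊗ [N] ↦ [M ⊠ N]. Over ℂ this induces an isomorphism G₀(A) ⊗_ℤ G₀(B) ≅ G₀(A ⊗ B), through which the class
  -- [Res N] of an A ⊗ B-module is an element of G₀(A) ⊗_ℤ G₀(B).
  exterior : (A B : Algebra) → AbelianGroup.Carrier (G₀ A ⊗ℤ G₀ B) → AbelianGroup.Carrier (G₀ (A ⊗ᴬ B))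
  exterior A B = extend (G₀ (A ⊗ᴬ B)) λ (x , y) →
    extend (G₀ (A ⊗ᴬ B)) (λ M → extend (G₀ (A ⊗ᴬ B)) (λ N → gen (_⊠_ {A} {B} M N)) y) x

  record Tower : Set₁ where
    field
      A   : ℕ → Algebra
      ρ   : ∀ k l → AlgebraHom (A k ⊗ᴬ A l) (A (k ℕ.+ l))
    private
      module A n = Algebra (A n)
    _∙_ : ∀ {k l} → A.Carrier k → A.Carrier l → A.Carrier (k ℕ.+ l)
    u ∙ v = AlgebraHom.⟦_⟧ (ρ _ _) (gen (u , v))
    field
      ∙-assoc : ∀ k l n (u : A.Carrier k) (v : A.Carrier l) (w : A.Carrier n) →
                A._≈_ (k ℕ.+ (l ℕ.+ n)) (≡.subst A.Carrier (ℕ.+-assoc k l n) ((u ∙ v) ∙ w)) (u ∙ (v ∙ w))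
      A₀≅base : A 0 ≅ᴬ base
      ρ-injective  : ∀ k l → AlgebraHom.IsInjective (ρ k l)
      projectiveˡ  : ∀ k l → IsProjectiveˡ (Res (AlgebraHom.ringHom (ρ k l)) (A.regular (k ℕ.+ l)))
      projectiveʳ  : ∀ k l → IsProjectiveʳ (Bimodule.rightModule (viaHom (AlgebraHom.ringHom (ρ k l))))

    induced : ∀ k l → FGMod (A k) → FGMod (A l) → FGMod (A (k ℕ.+ l))
    induced k l M N = Indᶠᵍ (ρ k l) (M ⊠ N)

    restricted : ∀ {n} k l → k ℕ.+ l ≡ n → FGMod (A n) → FGMod (A k ⊗ᴬ A l)
    restricted k l p N = Resᶠᵍ (ρ k l) (≡.subst (λ i → FGMod (A i)) (≡.sym p) N)

    Gq : ℕ → LeftModule ℤ[q]-ring (lsuc 0ℓ) (lsuc 0ℓ)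
    Gq n = G₀ (A n) [q]

    open QTwistedHopf Gq public

    private
      module ℋ = LeftModule ℋ
      module ℋℋ = LeftModule (ℋ ⊗ ℋ)

    q^_∙[_]_ : ℕ → ∀ n → AbelianGroup.Carrier (G₀ (A n)) → ℋ.Carrierᴹ
    q^ i ∙[ n ] x = ι Gq n (gen (q^ i , x))

    classOf : ∀ n → FGMod (A n) → ℋ.Carrierᴹ
    classOf n M = q^ 0 ∙[ n ] gen M

    specialize : ∀ n → LeftModule.Carrierᴹ (Gq n) → AbelianGroup.Carrier (G₀ (A n))
    specialize n = extend (G₀ (A n)) (λ (p , x) → _×ℤ_ (G₀ (A n)) (at-one p) x)

    -- By biadditivity it is enough to compare the two products on classes of modules, where [M][N] = [Ind M ⊗ N];
    -- the product of classes of degrees k and l lies in degree k + l.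
    Quantizes : Op₂ ℋ.Carrierᴹ → Set₁
    Quantizes _∗_ = ∀ k l (M : FGMod (A k)) (N : FGMod (A l)) →
      AbelianGroup._≈_ (G₀ (A (k ℕ.+ l)))
        (specialize (k ℕ.+ l) (component (classOf k M ∗ classOf l N) (k ℕ.+ l)))
        (gen (induced k l M N))

    embed : ∀ k l → AbelianGroup.Carrier (G₀ (A k) ⊗ℤ G₀ (A l)) → ℋℋ.Carrierᴹ
    embed k l = extend ℋℋ.+ᴹ-abelianGroup λ (x , y) → gen (q^ 0 ∙[ k ] x , q^ 0 ∙[ l ] y)

    -- Δ [N] = Σ_{k+l=n} [Res N], with k = toℕ i and l = n ∸ toℕ i
    ExtendsCoproduct : LeftModuleHom ℋ (ℋ ⊗ ℋ) → Set₁
    ExtendsCoproduct Δ = ∀ n (N : FGMod (A n)) →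
      Σ ((i : Fin (suc n)) → AbelianGroup.Carrier (G₀ (A (toℕ i)) ⊗ℤ G₀ (A (n ∸ toℕ i)))) λ x →
        (∀ i → AbelianGroup._≈_ (G₀ (A (toℕ i) ⊗ᴬ A (n ∸ toℕ i)))
                 (exterior (A (toℕ i)) (A (n ∸ toℕ i)) (x i))
                 (gen (restricted (toℕ i) (n ∸ toℕ i) (ℕ.m+[n∸m]≡n (toℕ≤pred[n] i)) N))) ×
        LeftModuleHom.⟦_⟧ Δ (classOf n N) ℋℋ.≈ᴹ sum ℋℋ.+ᴹ-rawMonoid (λ i → embed (toℕ i) (n ∸ toℕ i) (x i))

  record FilteredTower : Set₁ where
    field
      tower : Tower
    open Tower tower public
    field
      filtration : ∀ n → ℕ → Submodule (regular (A n)) 0ℓ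
      all        : ∀ n u → Submodule.Member (filtration n 0) u
      decreasing : ∀ n i {u} → Submodule.Member (filtration n (suc i)) u → Submodule.Member (filtration n i) u

    layer : ∀ n → ℕ → FGMod (A n)
    layer n i = subquotient {A n} (Algebra.regularᶠᵍ (A n)) (filtration n i) (filtration n (suc i))

    -- u = [A_n]_q, that is, u = Σ_i q^i [A_n^(i) / A_n^(i+1)]
    IsGradedClass : ∀ n → LeftModule.Carrierᴹ ℋ → Set₁
    IsGradedClass n = IsSumOf (LeftModule.+ᴹ-abelianGroup ℋ) (λ i → q^ i ∙[ n ] gen (layer n i))

  module _ {R : Ring 0ℓ 0ℓ} where

    record IsSimple (M : LeftModule R 0ℓ 0ℓ) : Set₁ where
      open LeftModule M
      field
        nonzero      : ∃[ u ] ¬ (u ≈ᴹ 0ᴹ)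
        noSubmodules : (U : Submodule M 0ℓ) →
                       (∀ u → Submodule.Member U u → u ≈ᴹ 0ᴹ) ⊎ (∀ u → Submodule.Member U u)

    record IsListOfSimples {t : ℕ} (S : Fin t → FGModule R 0ℓ 0ℓ) : Set₁ where
      field
        simple     : ∀ i → IsSimple (module′ (S i))
        distinct   : ∀ i j → module′ (S i) ≅ᴹ module′ (S j) → i ≡ j
        exhaustive : (M : LeftModule R 0ℓ 0ℓ) → IsSimple M → ∃[ i ] M ≅ᴹ module′ (S i)

    record ProjectiveCover (P M : FGModule R 0ℓ 0ℓ) : Set₁ where
      private
        module P = FGModule P
        module M = FGModule M
      field
        projective : IsProjectiveˡ P.module′
        cover      : LeftModuleHom P.module′ M.module′
      module cover = LeftModuleHom cover
      field
        surjective  : cover.IsSurjective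
        superfluous : (U : Submodule P.module′ 0ℓ) →
                      (∀ u → ∃[ v ] ∃[ w ] Submodule.Member U v × (cover.⟦ w ⟧ M.≈ᴹ M.0ᴹ) × (u P.≈ᴹ v P.+ᴹ w)) →
                      ∀ u → Submodule.Member U u

  betaClass : (A : Algebra) {t : ℕ} (S P : Fin t → FGMod A) → AbelianGroup.Carrier (G₀ A)
  betaClass A S P = sum (AbelianGroup.rawMonoid (G₀ A)) (λ i → MultProperties._×_ (AbelianGroup.monoid (G₀ A)) (dim A (P i)) (gen (S i)))

{-# OPTIONS --safe #-}
module Submission where

-- Let δₙ : G(A)_q → ℤ[q] be the dimension of the component of degree n. Restriction preserves dimensions, so ∂ = (δ₁ ⊗ id) ∘ Δ
-- satisfies δₙ ∘ ∂ = δₙ₊₁. As Δ is multiplicative for the twisted product, ∂ is a skew derivation, ∂(u ∗ v) = ∂u ∗ v + σu ∗ ∂v with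
-- σ = qⁱ in degree i, and ∂β = b 1 for b = Σ dim Pᵢ dim Sᵢ. Hence ∂(βⁿ⁺¹) = b [n+1] βⁿ, and δₙ(βⁿ) = bⁿ [n]!, while (Q3) identifies
-- δₙ(βⁿ) with the graded dimension of Aₙ.
-- It remains to see that b = r. For each basis vector x of each simple Sᵢ, a map Pᵢ → A₁ through the left ideal N of elements that
-- kill the previous vectors lifts the cover Pᵢ → Sᵢ along N → N x; the images of all these maps span A₁ modulo elements killing every
-- simple module, hence span A₁, so r ≤ b. Conversely the case n = 1 of (Q3) exhibits b as the dimension of a quotient of A₁, or 0.

open import Defs
open import Level using (Level; 0ℓ; _⊔_) renaming (suc to lsuc)
open import Algebra.Bundles using (AbelianGroup; CommutativeMonoid; CommutativeRing; Ring)
open import Algebra.Core using (Op₂)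
open import Algebra.Definitions.RawMonoid using (sum)
open import Algebra.Module.Bundles using (LeftModule)
import Algebra.Module.Construct.TensorUnit as TensorUnit
open import Algebra.Module.Morphism.Structures using (module LeftModuleMorphisms)
import Algebra.Properties.AbelianGroup as AbelianGroupProperties
import Algebra.Properties.CommutativeMonoid.Sum as MonoidSum
import Algebra.Properties.CommutativeSemigroup as CommutativeSemigroupProperties
import Algebra.Properties.Monoid.Mult as MultProperties
import Algebra.Properties.Ring as RingProperties
import Algebra.Properties.Semiring.Sum as SemiringSum
open import Axiom.ExcludedMiddle using (ExcludedMiddle)
open import Data.Empty using (⊥-elim)
open import Data.Fin.Base using (Fin; zero; suc; toℕ; fromℕ<; join; punchIn; splitAt; combine; remQuot; _↑ˡ_; _↑ʳ_)
open import Data.Fin.Properties using (combine-remQuot; join-splitAt; punchInᵢ≢i; remQuot-combine; splitAt-↑ˡ; splitAt-↑ʳ; toℕ-fromℕ<; toℕ-injective; toℕ<n; toℕ≤pred[n])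
open import Data.Integer.Base as ℤ using (ℤ; 0ℤ; 1ℤ; +_)
import Data.Integer.Properties as ℤ
open import Data.List.Base as List using (List; []; _∷_)
open import Data.List.Properties using (map-++)
open import Data.List.Relation.Unary.All using (All; []; _∷_)
import Data.List.Relation.Unary.All.Properties as All
open import Data.Nat.Base as ℕ using (ℕ; zero; suc; _^_; _∸_; _≤_; _<_; z≤n; s≤s)
open import Data.Nat.ListAction using () renaming (sum to sumᴸ)
open import Data.Nat.ListAction.Properties using (sum-++)
import Data.Nat.Properties as ℕ
open import Data.Product.Base using (Σ; ∃-syntax; _×_; _,_; proj₁; proj₂)
open import Data.Sum.Base using (_⊎_; inj₁; inj₂; [_,_]′)
open import Data.Unit.Base using (⊤; tt)
open import Data.Vec.Functional using (Vector; insertAt) renaming (_∷_ to _◂_; _++_ to _⧺_)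
open import Data.Vec.Functional.Properties using (insertAt-lookup; insertAt-punchIn)
open import Function.Base using (_∘_; id)
open import Relation.Binary.PropositionalEquality as ≡ using (_≡_; _≢_)
import Relation.Binary.Reasoning.Setoid as SetoidReasoning
open import Relation.Nullary.Decidable.Core using (Dec; yes; no)
open import Relation.Nullary.Negation.Core using (¬_)
open import Relation.Unary using (Pred)

-- The weights of the twisted product dictate the form of ∂. In (a ⊗ b) ·q (a′ ⊗ b′) the factor a a′
-- is seen by δ₁ only in degree 1, so a′ contributes in degree 0 or 1 and the weight q^(deg b deg
-- a′) becomes 1 or q^(deg b). These are the two terms of the Leibniz rule, and the second weight is
-- σ. Contracting with δ₀ instead returns the argument, because in a connected algebra δ₀ must
-- coincide with the counit. The components of Δ [N] are given only through their images under
-- `exterior`. Dimension is multiplicative along `exterior`, so δₖ ⊗ δₗ can still be evaluated on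
-- them; this is how information about restriction enters. The two halves of b = r have different
-- sources. The bound r ≤ b counts generators of A₁. For b ≤ r, the dimension of β is a constant
-- polynomial, so b can be compared with the constant coefficient of the graded dimension alone.

private
  variable
    a m n p r x ℓ ℓ₁ ℓm ℓn ℓr : Level
  module ℤ[q] = CommutativeRing ℤ[q]

-- Homomorphisms of modules

module _ {R : Ring r ℓr} {M : LeftModule R m ℓm} {N : LeftModule R n ℓn} where
  private
    module M = LeftModule M
    module N = LeftModule N

  -- In a group, f 0 + f 0 = f 0 forces f 0 = 0, and then negatives are preserved too, so additivity
  -- and linearity suffice.
  mkHom : (f : M.Carrierᴹ → N.Carrierᴹ) → (∀ {u v} → u M.≈ᴹ v → f u N.≈ᴹ f v) →
          (∀ u v → f (u M.+ᴹ v) N.≈ᴹ f u N.+ᴹ f v) → (∀ p u → f (p M.*ₗ u) N.≈ᴹ p N.*ₗ f u) → LeftModuleHom M N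
  mkHom f cong +-homo *-homo = record { ⟦_⟧ = f ; isHom = record
    { +ᴹ-isGroupHomomorphism = record
      { isMonoidHomomorphism = record
        { isMagmaHomomorphism = record { isRelHomomorphism = record { cong = cong } ; homo = +-homo }
        ; ε-homo = zero-homo
        }
      ; ⁻¹-homo = λ u → NP.inverseˡ-unique _ _
          (N.≈ᴹ-trans (N.≈ᴹ-sym (+-homo _ _)) (N.≈ᴹ-trans (cong (M.-ᴹ‿inverseˡ u)) zero-homo))
      }
    ; *ₗ-homo = *-homo
    } }
    where
    module NP = AbelianGroupProperties N.+ᴹ-abelianGroup
    zero-homo : f M.0ᴹ N.≈ᴹ N.0ᴹ
    zero-homo = NP.identityˡ-unique _ _ (N.≈ᴹ-trans (N.≈ᴹ-sym (+-homo _ _)) (cong (M.+ᴹ-identityˡ M.0ᴹ)))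

  module Hom (h : LeftModuleHom M N) where
    open LeftModuleHom h public
    open LeftModuleMorphisms.IsLeftModuleHomomorphism isHom public using (⟦⟧-cong; +ᴹ-homo; 0ᴹ-homo; -ᴹ-homo; *ₗ-homo)

    sum-homo : ∀ {k} (v : Vector M.Carrierᴹ k) → ⟦ sum M.+ᴹ-rawMonoid v ⟧ N.≈ᴹ sum N.+ᴹ-rawMonoid (⟦_⟧ ∘ v)
    sum-homo {zero}  v = 0ᴹ-homo
    sum-homo {suc k} v = N.≈ᴹ-trans (+ᴹ-homo _ _) (N.+ᴹ-congˡ (sum-homo (v ∘ suc)))

module _ {R : Ring r ℓr} {M : LeftModule R a ℓ₁} {N : LeftModule R m ℓm} {P : LeftModule R n ℓn} where
  infixr 9 _⊙_
  _⊙_ : LeftModuleHom N P → LeftModuleHom M N → LeftModuleHom M P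
  g ⊙ f = mkHom (g.⟦_⟧ ∘ f.⟦_⟧) (g.⟦⟧-cong ∘ f.⟦⟧-cong)
    (λ u v → LeftModule.≈ᴹ-trans P (g.⟦⟧-cong (f.+ᴹ-homo u v)) (g.+ᴹ-homo _ _))
    (λ p u → LeftModule.≈ᴹ-trans P (g.⟦⟧-cong (f.*ₗ-homo p u)) (g.*ₗ-homo p _))
    where
    module f = Hom f
    module g = Hom g

-- Bases and dimension

module Combinations (em : ExcludedMiddle 0ℓ) (K : Field) where
  open LinearAlgebra em K public
  private
    module K = Field K
    module KP = RingProperties K.ring
  open SemiringSum K.semiring using (sum-cong-≋; sum-remove; ∑-distrib-+; *-distribʳ-sum; sum-replicate-zero)
    renaming (sum to sumᴷ)

  -- Gaussian elimination by induction on the number of columns. A zero first column is dropped;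
  -- otherwise a pivot row clears the first column of all other rows, and a relation among the
  -- reduced rows is completed by a coefficient for the pivot row.
  row-relation : ∀ {m n} → n < m → (C : Fin m → Fin n → K.Carrier) →
                 Σ (Vector K.Carrier m) λ c → (∃[ i ] ¬ (c i K.≈ K.0#)) × (∀ j → sumᴷ (λ i → c i K.* C i j) K.≈ K.0#)
  row-relation {suc m} {zero}  _         C = (λ _ → K.1#) , (zero , λ e → K.0≉1 (K.sym e)) , λ ()
  row-relation {suc m} {suc n} (s≤s n<m) C with em {P = ∃[ p ] ¬ (C p zero K.≈ K.0#)}
  ... | no none =
    let (c , nonzero , e) = row-relation (ℕ.m<n⇒m<1+n n<m) (λ i j → C i (suc j)) in
    c , nonzero , λ where
      zero    → K.trans (sum-cong-≋ {suc m} (λ i → K.trans (K.*-congˡ (column-zero i)) (K.zeroʳ (c i)))) (sum-replicate-zero (suc m))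
      (suc j) → e j
    where
    column-zero : ∀ i → C i zero K.≈ K.0#
    column-zero i with em {P = C i zero K.≈ K.0#}
    ... | yes z = z
    ... | no z = ⊥-elim (none (i , z))
  ... | yes (p , z) =
    -- Reducing row i subtracts `w i` times the pivot row, so a relation `c` of the reduced rows
    -- uses the pivot row with total coefficient -Σ `c i` `w i`.
    insertAt c p (K.- s) ,
    (punchIn p i , λ e′ → nonzero (K.trans (K.reflexive (≡.sym (insertAt-punchIn c p _ i))) e′)) ,
    λ { zero → relation zero (K.trans (sum-cong-≋ pivot-column) (sum-replicate-zero m))
      ; (suc j) → relation (suc j) (e j) }
    where
    open SetoidReasoning K.setoid
    q   = proj₁ (K.inverse (C p zero) z)
    q*p = proj₂ (K.inverse (C p zero) z)
    w : Fin m → K.Carrier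
    w i = C (punchIn p i) zero K.* q
    reduced : Fin m → Fin (suc n) → K.Carrier
    reduced i j = C (punchIn p i) j K.+ K.- (w i K.* C p j)
    previous = row-relation n<m (λ i j → reduced i (suc j))
    c = proj₁ previous
    i = proj₁ (proj₁ (proj₂ previous))
    nonzero = proj₂ (proj₁ (proj₂ previous))
    e = proj₂ (proj₂ previous)
    s = sumᴷ (λ i → c i K.* w i)
    pivot-column : ∀ i → c i K.* reduced i zero K.≈ K.0#
    pivot-column i = K.trans (K.*-congˡ (K.trans (K.+-congˡ (K.-‿cong (K.trans (K.*-assoc _ q _) (K.trans (K.*-congˡ q*p) (K.*-identityʳ _)))))
      (K.-‿inverseʳ _))) (K.zeroʳ _)
    expand : ∀ j i → c i K.* C (punchIn p i) j K.≈ c i K.* reduced i j K.+ (c i K.* w i) K.* C p j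
    expand j i = begin
      c i K.* C (punchIn p i) j                                            ≈⟨ K.*-congˡ (K.trans (K.+-assoc _ _ _) (K.trans (K.+-congˡ (K.-‿inverseˡ _)) (K.+-identityʳ _))) ⟨
      c i K.* (reduced i j K.+ w i K.* C p j)                              ≈⟨ K.distribˡ _ _ _ ⟩
      c i K.* reduced i j K.+ c i K.* (w i K.* C p j)                      ≈⟨ K.+-congˡ (K.*-assoc _ _ _) ⟨
      c i K.* reduced i j K.+ (c i K.* w i) K.* C p j                      ∎
    relation : ∀ j → sumᴷ (λ i → c i K.* reduced i j) K.≈ K.0# →
               sumᴷ (λ i → insertAt c p (K.- s) i K.* C i j) K.≈ K.0#
    relation j e = begin
      sumᴷ (λ i → insertAt c p (K.- s) i K.* C i j)
        ≈⟨ sum-remove {i = p} (λ i → insertAt c p (K.- s) i K.* C i j) ⟩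
      insertAt c p (K.- s) p K.* C p j K.+ sumᴷ (λ i → insertAt c p (K.- s) (punchIn p i) K.* C (punchIn p i) j)
        ≈⟨ K.+-cong (K.*-congʳ (K.reflexive (insertAt-lookup c p _)))
                    (sum-cong-≋ (λ i → K.*-congʳ (K.reflexive (insertAt-punchIn c p _ i)))) ⟩
      K.- s K.* C p j K.+ sumᴷ (λ i → c i K.* C (punchIn p i) j)
        ≈⟨ K.+-congˡ (K.trans (sum-cong-≋ (expand j)) (∑-distrib-+ (λ i → c i K.* reduced i j) _)) ⟩
      K.- s K.* C p j K.+ (sumᴷ (λ i → c i K.* reduced i j) K.+ sumᴷ (λ i → (c i K.* w i) K.* C p j))
        ≈⟨ K.+-cong (K.sym (KP.-‿distribˡ-* s _)) (K.trans (K.+-cong e (K.sym (*-distribʳ-sum (C p j) (λ i → c i K.* w i)))) (K.+-identityˡ _)) ⟩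
      K.- (s K.* C p j) K.+ s K.* C p j
        ≈⟨ K.-‿inverseˡ _ ⟩
      K.0# ∎

  module _ (V : VectorSpace) where
    open LeftModule V
    private
      module VS = MonoidSum +ᴹ-commutativeMonoid

    Independent : ∀ {d} → Vector Carrierᴹ d → Set
    Independent v = ∀ c → combination V c v ≈ᴹ 0ᴹ → ∀ i → c i K.≈ K.0#

    combination-cong : ∀ {d} {c c′ : Vector K.Carrier d} {v v′ : Vector Carrierᴹ d} → (∀ i → c i K.≈ c′ i) → (∀ i → v i ≈ᴹ v′ i) →
                       combination V c v ≈ᴹ combination V c′ v′
    combination-cong e e′ = VS.sum-cong-≋ (λ i → *ₗ-cong (e i) (e′ i))

    combination-+ : ∀ {d} c c′ (v : Vector Carrierᴹ d) →
                    combination V (λ i → c i K.+ c′ i) v ≈ᴹ combination V c v +ᴹ combination V c′ v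
    combination-+ c c′ v = ≈ᴹ-trans (VS.sum-cong-≋ (λ i → *ₗ-distribʳ (v i) (c i) (c′ i))) (VS.∑-distrib-+ (λ i → c i *ₗ v i) _)

    combination-zero : ∀ {d} {c : Vector K.Carrier d} (v : Vector Carrierᴹ d) → (∀ i → c i K.≈ K.0#) → combination V c v ≈ᴹ 0ᴹ
    combination-zero {d} v e = ≈ᴹ-trans (VS.sum-cong-≋ (λ i → ≈ᴹ-trans (*ₗ-congʳ (e i)) (*ₗ-zeroˡ (v i)))) (VS.sum-replicate-zero d)

    combination-* : ∀ {d} p c (v : Vector Carrierᴹ d) → combination V (λ i → p K.* c i) v ≈ᴹ p *ₗ combination V c v
    combination-* {zero}  p c v = ≈ᴹ-sym (*ₗ-zeroʳ p)
    combination-* {suc d} p c v = ≈ᴹ-trans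
      (+ᴹ-cong (*ₗ-assoc p (c zero) (v zero)) (combination-* p (c ∘ suc) (v ∘ suc)))
      (≈ᴹ-sym (*ₗ-distribˡ p _ _))

    combination-combination : ∀ {d e} c (C : Fin d → Vector K.Carrier e) (w : Vector Carrierᴹ e) →
                              combination V c (λ i → combination V (C i) w) ≈ᴹ combination V (λ j → sumᴷ (λ i → c i K.* C i j)) w
    combination-combination {zero}  c C w = ≈ᴹ-sym (combination-zero w (λ _ → K.refl))
    combination-combination {suc d} c C w = ≈ᴹ-trans
      (+ᴹ-cong (≈ᴹ-sym (combination-* _ _ w)) (combination-combination (c ∘ suc) (C ∘ suc) w))
      (≈ᴹ-sym (combination-+ _ _ w))

    combination-⧺ : ∀ {d e} c (v : Vector Carrierᴹ d) (w : Vector Carrierᴹ e) →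
                    combination V c (v ⧺ w) ≈ᴹ combination V (λ i → c (i ↑ˡ e)) v +ᴹ combination V (λ i → c (d ↑ʳ i)) w
    combination-⧺ {zero}  c v w = ≈ᴹ-sym (+ᴹ-identityˡ _)
    combination-⧺ {suc d} {e} c v w = ≈ᴹ-trans
      (+ᴹ-congˡ (≈ᴹ-trans (VS.sum-cong-≋ tail) (combination-⧺ (c ∘ suc) (v ∘ suc) w))) (≈ᴹ-sym (+ᴹ-assoc _ _ _))
      where
      tail : ∀ i → c (suc i) *ₗ (v ⧺ w) (suc i) ≈ᴹ c (suc i) *ₗ ((v ∘ suc) ⧺ w) i
      tail i with splitAt d i
      ... | inj₁ _ = ≈ᴹ-refl
      ... | inj₂ _ = ≈ᴹ-refl

    combination-⧺-⧺ : ∀ {d e} c c′ (v : Vector Carrierᴹ d) (w : Vector Carrierᴹ e) →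
                      combination V (c ⧺ c′) (v ⧺ w) ≈ᴹ combination V c v +ᴹ combination V c′ w
    combination-⧺-⧺ {d} {e} c c′ v w = ≈ᴹ-trans (combination-⧺ _ v w) (+ᴹ-cong
      (combination-cong (λ i → K.reflexive (≡.cong [ c , c′ ]′ (splitAt-↑ˡ d i e))) (λ _ → ≈ᴹ-refl))
      (combination-cong (λ i → K.reflexive (≡.cong [ c , c′ ]′ (splitAt-↑ʳ d e i))) (λ _ → ≈ᴹ-refl)))

    -- If d > e, the d coordinate rows of length e satisfy a nontrivial relation, which `v`
    -- inherits. Invariance of dimension and all dimension inequalities below rest on this.
    independent-bounded : ∀ {d e} (v : Vector Carrierᴹ d) (w : Vector Carrierᴹ e) → Independent v →
                          (∀ i → ∃[ c ] v i ≈ᴹ combination V c w) → d ≤ e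
    independent-bounded {d} {e} v w independent span with d ℕ.≤? e
    ... | yes d≤e = d≤e
    ... | no d≰e =
      let C = proj₁ ∘ span
          (c , (i , nonzero) , relation) = row-relation (ℕ.≰⇒> d≰e) C
      in ⊥-elim (nonzero (independent c (≈ᴹ-trans
           (≈ᴹ-trans (combination-cong (λ _ → K.refl) (proj₂ ∘ span)) (combination-combination c C w))
           (combination-zero w relation)) i))

    independent-≤ : ∀ {d e} (v : Vector Carrierᴹ d) → Independent v → Basis V e → d ≤ e
    independent-≤ v independent B = independent-bounded v (Basis.vectors B) independent (λ i → Basis.spanning B (v i))

    basis-≤ : ∀ {d e} → Basis V d → (w : Vector Carrierᴹ e) → (∀ u → ∃[ c ] u ≈ᴹ combination V c w) → d ≤ e
    basis-≤ B w span = independent-bounded (Basis.vectors B) w (Basis.independent B) (λ i → span _)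

    basis-unique : ∀ {d e} → Basis V d → Basis V e → d ≡ e
    basis-unique B B′ = ℕ.≤-antisym (basis-≤ B (Basis.vectors B′) (Basis.spanning B′)) (basis-≤ B′ (Basis.vectors B) (Basis.spanning B))

    dimension-unique : ∀ {d} (fg : FinitelyGenerated V) → Basis V d → dimension V fg ≡ d
    dimension-unique fg = basis-unique (proj₂ (basis V fg))

  module _ {V W : VectorSpace} (h : LeftModuleHom V W) where
    private
      module V = LeftModule V
      module W = LeftModule W
      module h = Hom h

    combination-homo : ∀ {d} c (v : Vector V.Carrierᴹ d) → h.⟦ combination V c v ⟧ W.≈ᴹ combination W c (h.⟦_⟧ ∘ v)
    combination-homo c v = W.≈ᴹ-trans (h.sum-homo (λ i → c i V.*ₗ v i)) (MonoidSum.sum-cong-≋ W.+ᴹ-commutativeMonoid (λ i → h.*ₗ-homo (c i) (v i)))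

    basis-image : ∀ {d} → h.IsInjective → (∀ w → ∃[ u ] h.⟦ u ⟧ W.≈ᴹ w) → Basis V d → Basis W d
    basis-image injective surjective B = record
      { vectors = h.⟦_⟧ ∘ B.vectors
      ; independent = λ c e → B.independent c (injective (W.≈ᴹ-trans (combination-homo c B.vectors) (W.≈ᴹ-trans e (W.≈ᴹ-sym h.0ᴹ-homo))))
      ; spanning = λ w → let (u , e) = surjective w ; (c , e′) = B.spanning u in
          c , W.≈ᴹ-trans (W.≈ᴹ-sym e) (W.≈ᴹ-trans (h.⟦⟧-cong e′) (combination-homo c B.vectors))
      }
      where module B = Basis B

    surjection-≤ : ∀ {d e} → (∀ w → ∃[ u ] h.⟦ u ⟧ W.≈ᴹ w) → Basis V d → Basis W e → e ≤ d
    surjection-≤ surjective B B′ = basis-≤ W B′ (h.⟦_⟧ ∘ Basis.vectors B) λ w →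
      let (u , e) = surjective w ; (c , e′) = Basis.spanning B u in
      c , W.≈ᴹ-trans (W.≈ᴹ-sym e) (W.≈ᴹ-trans (h.⟦⟧-cong e′) (combination-homo c (Basis.vectors B)))

  module _ {V′ V V″ : VectorSpace} (f : LeftModuleHom V′ V) (g : LeftModuleHom V V″) where
    private
      module V′ = LeftModule V′
      module V = LeftModule V
      module V″ = LeftModule V″
      module f = Hom f
      module g = Hom g

    -- The basis consists of the image of a basis of V′ and chosen preimages of a basis of V″. For
    -- independence, g annihilates the first half, so the second half has zero coefficients, and
    -- then injectivity of f handles the first. For spanning, lift the coordinates of g v and
    -- correct by an element of the kernel.
    basis-extension : f.IsInjective → (∀ w → ∃[ v ] g.⟦ v ⟧ V″.≈ᴹ w) → (∀ u → g.⟦ f.⟦ u ⟧ ⟧ V″.≈ᴹ V″.0ᴹ) →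
                      (∀ v → g.⟦ v ⟧ V″.≈ᴹ V″.0ᴹ → ∃[ u ] f.⟦ u ⟧ V.≈ᴹ v) →
                      ∀ {d e} → Basis V′ d → Basis V″ e → Basis V (d ℕ.+ e)
    basis-extension injective surjective image⊆kernel kernel⊆image {d} {e} B′ B″ = record
      { vectors = family
      ; independent = independent
      ; spanning = spanning
      }
      where
      module B′ = Basis B′
      module B″ = Basis B″
      left : Vector V.Carrierᴹ d
      left = f.⟦_⟧ ∘ B′.vectors
      right : Vector V.Carrierᴹ e
      right = proj₁ ∘ surjective ∘ B″.vectors
      family = left ⧺ right

      g-left : ∀ c → g.⟦ combination V c left ⟧ V″.≈ᴹ V″.0ᴹ
      g-left c = V″.≈ᴹ-trans (g.⟦⟧-cong (V.≈ᴹ-sym (combination-homo f c B′.vectors))) (image⊆kernel _)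

      g-right : ∀ c → g.⟦ combination V c right ⟧ V″.≈ᴹ combination V″ c B″.vectors
      g-right c = V″.≈ᴹ-trans (combination-homo g c right) (combination-cong V″ (λ _ → K.refl) (proj₂ ∘ surjective ∘ B″.vectors))

      independent : Independent V family
      independent c e₀ = λ i → K.trans (K.reflexive (≡.cong c (≡.sym (join-split i)))) (both (splitAt d i))
        where
        join-split : ∀ i → join d e (splitAt d i) ≡ i
        join-split = join-splitAt d e
        e₁ : combination V (λ i → c (i ↑ˡ e)) left V.+ᴹ combination V (λ i → c (d ↑ʳ i)) right V.≈ᴹ V.0ᴹ
        e₁ = V.≈ᴹ-trans (V.≈ᴹ-sym (combination-⧺ V c left right)) e₀
        right-zero : ∀ i → c (d ↑ʳ i) K.≈ K.0#
        right-zero = B″.independent _ (V″.≈ᴹ-trans (V″.≈ᴹ-sym (g-right _)) (V″.≈ᴹ-trans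
          (V″.≈ᴹ-trans (V″.≈ᴹ-sym (V″.+ᴹ-identityˡ _)) (V″.≈ᴹ-trans (V″.+ᴹ-congʳ (V″.≈ᴹ-sym (g-left _))) (V″.≈ᴹ-sym (g.+ᴹ-homo _ _))))
          (V″.≈ᴹ-trans (g.⟦⟧-cong e₁) g.0ᴹ-homo)))
        left-zero : ∀ i → c (i ↑ˡ e) K.≈ K.0#
        left-zero = B′.independent _ (injective (V.≈ᴹ-trans (combination-homo f _ B′.vectors) (V.≈ᴹ-trans
          (V.≈ᴹ-trans (V.≈ᴹ-sym (V.+ᴹ-identityʳ _)) (V.≈ᴹ-trans (V.+ᴹ-congˡ (V.≈ᴹ-sym (combination-zero V right right-zero))) e₁))
          (V.≈ᴹ-sym f.0ᴹ-homo))))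
        both : ∀ s → c (join d e s) K.≈ K.0#
        both (inj₁ i) = left-zero i
        both (inj₂ i) = right-zero i

      spanning : ∀ v → ∃[ c ] v V.≈ᴹ combination V c family
      spanning v = c₁ ⧺ c₂ , V.≈ᴹ-sym (V.≈ᴹ-trans (combination-⧺-⧺ V c₁ c₂ left right) (V.≈ᴹ-trans
          (V.+ᴹ-congʳ (V.≈ᴹ-trans (V.≈ᴹ-sym (combination-homo f c₁ B′.vectors)) (V.≈ᴹ-trans (f.⟦⟧-cong (V′.≈ᴹ-sym e₁)) e₀)))
          (V.≈ᴹ-trans (V.+ᴹ-assoc _ _ _) (V.≈ᴹ-trans (V.+ᴹ-congˡ (V.-ᴹ‿inverseˡ _)) (V.+ᴹ-identityʳ v)))))
        where
        c₂ = proj₁ (B″.spanning g.⟦ v ⟧)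
        rest = v V.+ᴹ V.-ᴹ (combination V c₂ right)
        in-kernel : g.⟦ rest ⟧ V″.≈ᴹ V″.0ᴹ
        in-kernel = V″.≈ᴹ-trans (g.+ᴹ-homo _ _) (V″.≈ᴹ-trans
          (V″.+ᴹ-cong (V″.≈ᴹ-trans (proj₂ (B″.spanning g.⟦ v ⟧)) (V″.≈ᴹ-sym (g-right c₂))) (g.-ᴹ-homo _))
          (V″.-ᴹ‿inverseʳ _))
        u = proj₁ (kernel⊆image rest in-kernel)
        e₀ = proj₂ (kernel⊆image rest in-kernel)
        c₁ = proj₁ (B′.spanning u)
        e₁ = proj₂ (B′.spanning u)

-- Finite sums and contraction of tensors

module _ (M : CommutativeMonoid a ℓ) where
  open CommutativeMonoid M
  open MonoidSum M using (sum-cong-≋; sum-replicate-zero; sum-remove)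

  sum-zero : ∀ {k} {f : Vector Carrier k} → (∀ i → f i ≈ ε) → sum rawMonoid f ≈ ε
  sum-zero {k} e = trans (sum-cong-≋ e) (sum-replicate-zero k)

  sum-single : ∀ {k} (f : Vector Carrier k) i → (∀ j → j ≢ i → f j ≈ ε) → sum rawMonoid f ≈ f i
  sum-single {suc k} f i e = trans (sum-remove {i = i} f)
    (trans (∙-congˡ (sum-zero (λ j → e (punchIn i j) (punchInᵢ≢i i j)))) (identityʳ _))

  sum-↑ : ∀ m {n} (g : Vector Carrier (m ℕ.+ n)) →
          sum rawMonoid g ≈ sum rawMonoid (λ i → g (i ↑ˡ n)) ∙ sum rawMonoid (λ i → g (m ↑ʳ i))
  sum-↑ zero    g = sym (identityˡ _)
  sum-↑ (suc m) g = trans (∙-congˡ (sum-↑ m (g ∘ suc))) (sym (assoc _ _ _))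

  sum-combine : ∀ m {n} (g : Vector Carrier (m ℕ.* n)) →
                sum rawMonoid g ≈ sum rawMonoid {m} (λ i → sum rawMonoid {n} (λ j → g (combine i j)))
  sum-combine zero    g = refl
  sum-combine (suc m) {n} g = trans (sum-↑ n g) (∙-congˡ (sum-combine m (λ i → g (n ↑ʳ i))))

module _ {R : Ring r ℓr} (M : LeftModule R m ℓm) where
  open LeftModule M

  *-neg : ∀ p u → p *ₗ (-ᴹ u) ≈ᴹ -ᴹ (p *ₗ u)
  *-neg p u = AbelianGroupProperties.inverseˡ-unique +ᴹ-abelianGroup _ _
    (≈ᴹ-trans (≈ᴹ-sym (*ₗ-distribˡ p _ _)) (≈ᴹ-trans (*ₗ-congˡ (-ᴹ‿inverseˡ u)) (*ₗ-zeroʳ p)))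

module _ {R : Ring r ℓr} {S : Ring a ℓ} (f : RingHom R S) {M : LeftModule S m ℓm} {N : LeftModule S n ℓn} where
  Res-hom : LeftModuleHom M N → LeftModuleHom (Res f M) (Res f N)
  Res-hom h = mkHom h.⟦_⟧ h.⟦⟧-cong h.+ᴹ-homo (λ p → h.*ₗ-homo _)
    where module h = Hom h

module _ (K : CommutativeRing r ℓr) where
  private
    module K = CommutativeRing K

  self : LeftModule K.ring r ℓr
  self = TensorUnit.leftModule {R = K.ring}

  module _ {V : LeftModule K.ring m ℓm} {W : LeftModule K.ring n ℓn} (φ : LeftModuleHom V self) where
    private
      module V = LeftModule V
      module W = LeftModule W
      module φ = Hom φ
      T = tensor (commutativeBimodule K V) W
      module T = LeftModule T

      value : V.Carrierᴹ × W.Carrierᴹ → W.Carrierᴹ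
      value (u , v) = φ.⟦ u ⟧ W.*ₗ v

      respects : ∀ {t u} → TensorRel (commutativeBimodule K V) W t u →
                 extend W.+ᴹ-abelianGroup value t W.≈ᴹ extend W.+ᴹ-abelianGroup value u
      respects (⊗-cong e e′)       = W.*ₗ-cong (φ.⟦⟧-cong e) e′
      respects (⊗-distribʳ u u′ v) = W.≈ᴹ-trans (W.*ₗ-congʳ (φ.+ᴹ-homo u u′)) (W.*ₗ-distribʳ v _ _)
      respects (⊗-distribˡ u v v′) = W.*ₗ-distribˡ _ v v′
      respects (⊗-balanced u p v)  = W.≈ᴹ-trans (W.*ₗ-congʳ (K.trans (φ.*ₗ-homo p u) (K.*-comm p _))) (W.*ₗ-assoc _ p v)

      scalar : ∀ p t → extend W.+ᴹ-abelianGroup value (p T.*ₗ t) W.≈ᴹ p W.*ₗ extend W.+ᴹ-abelianGroup value t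
      scalar p (gen (u , v)) = W.≈ᴹ-trans (W.*ₗ-congʳ (φ.*ₗ-homo p u)) (W.*ₗ-assoc p _ v)
      scalar p 0ᶠ       = W.≈ᴹ-sym (W.*ₗ-zeroʳ p)
      scalar p (t +ᶠ u) = W.≈ᴹ-trans (W.+ᴹ-cong (scalar p t) (scalar p u)) (W.≈ᴹ-sym (W.*ₗ-distribˡ p _ _))
      scalar p (-ᶠ t)   = W.≈ᴹ-trans (W.-ᴹ‿cong (scalar p t)) (W.≈ᴹ-sym (*-neg W p _))

    -- This is φ ⊗ id followed by K ⊗ W ≅ W. With a coordinate function as φ it separates the basis
    -- tensors of a tensor product; with the dimension in degree 1 it defines ∂.
    contract : LeftModuleHom T W
    contract = mkHom (extend W.+ᴹ-abelianGroup value) (extend-cong W.+ᴹ-abelianGroup value respects) (λ _ _ → W.≈ᴹ-refl) scalar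

-- Dimensions of tensor products and dimension on Grothendieck groups

module Dimensions (em : ExcludedMiddle 0ℓ) (K : Field) where
  open Combinations em K
  open Towers em K using (_⊗ₖ_; Algebra; AlgebraHom; FGMod; _⊗ᴬ_; _⊠_; Resᶠᵍ; IsShortExact; G₀; ExactRel; exact; exterior)
  open FGModule using (module′; finitelyGenerated)
  private
    module K = Field K

  module _ {V : VectorSpace} {d} (B : Basis V d) where
    open LeftModule V
    open Basis B
    private
      module VA = AbelianGroupProperties +ᴹ-abelianGroup
      module KA = AbelianGroupProperties K.+-abelianGroup

    coordinates : Carrierᴹ → Vector K.Carrier d
    coordinates u = proj₁ (spanning u)

    combination-injective : ∀ c c′ → combination V c vectors ≈ᴹ combination V c′ vectors → ∀ i → c i K.≈ c′ i
    combination-injective c c′ e i = K.trans (KA.inverseˡ-unique _ _ (independent difference difference-zero i)) (KA.⁻¹-involutive _)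
      where
      difference = λ i → c i K.+ K.- c′ i
      negated : combination V (λ i → K.- c′ i) vectors ≈ᴹ -ᴹ (combination V c′ vectors)
      negated = VA.inverseˡ-unique _ _ (≈ᴹ-trans (≈ᴹ-sym (combination-+ V (λ i → K.- c′ i) c′ vectors))
        (combination-zero V vectors (λ i → K.-‿inverseˡ (c′ i))))
      difference-zero : combination V difference vectors ≈ᴹ 0ᴹ
      difference-zero = ≈ᴹ-trans (combination-+ V c (λ i → K.- c′ i) vectors)
        (≈ᴹ-trans (+ᴹ-cong e negated) (-ᴹ‿inverseʳ _))

    coordinates-unique : ∀ {u} c → u ≈ᴹ combination V c vectors → ∀ i → coordinates u i K.≈ c i
    coordinates-unique {u} c e = combination-injective _ c (≈ᴹ-trans (≈ᴹ-sym (proj₂ (spanning u))) e)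

    coordinates-cong : ∀ {u v} → u ≈ᴹ v → ∀ i → coordinates u i K.≈ coordinates v i
    coordinates-cong {v = v} e = coordinates-unique (coordinates v) (≈ᴹ-trans e (proj₂ (spanning v)))

    coordinates-+ : ∀ u v i → coordinates (u +ᴹ v) i K.≈ coordinates u i K.+ coordinates v i
    coordinates-+ u v = coordinates-unique (λ i → coordinates u i K.+ coordinates v i)
      (≈ᴹ-trans (+ᴹ-cong (proj₂ (spanning u)) (proj₂ (spanning v))) (≈ᴹ-sym (combination-+ V _ _ vectors)))

    coordinates-* : ∀ p u i → coordinates (p *ₗ u) i K.≈ p K.* coordinates u i
    coordinates-* p u = coordinates-unique (λ i → p K.* coordinates u i)
      (≈ᴹ-trans (*ₗ-congˡ (proj₂ (spanning u))) (≈ᴹ-sym (combination-* V p _ vectors)))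

    coordinate : Fin d → LeftModuleHom V (self K.commutativeRing)
    coordinate i = mkHom (λ u → coordinates u i) (λ e → coordinates-cong e i) (λ u v → coordinates-+ u v i) (λ p u → coordinates-* p u i)

  module _ {V W : VectorSpace} {d e} (B : Basis V d) (C : Basis W e) where
    private
      module V = LeftModule V
      module W = LeftModule W
      module T = LeftModule (V ⊗ₖ W)
      module B = Basis B
      module C = Basis C
      module TS = MonoidSum T.+ᴹ-commutativeMonoid

      family : Vector T.Carrierᴹ (d ℕ.* e)
      family k = let (i , j) = remQuot e k in gen (B.vectors i , C.vectors j)

      rightHom : ∀ u → LeftModuleHom W (V ⊗ₖ W)
      rightHom u = mkHom (λ v → gen (u , v)) (λ e → rel (⊗-cong V.≈ᴹ-refl e)) (λ v v′ → rel (⊗-distribˡ u v v′))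
        (λ p v → symᶠ (rel (⊗-balanced u p v)))

      leftHom : ∀ v → LeftModuleHom V (V ⊗ₖ W)
      leftHom v = mkHom (λ u → gen (u , v)) (λ e → rel (⊗-cong e W.≈ᴹ-refl)) (λ u u′ → rel (⊗-distribʳ u u′ v))
        (λ p v → reflᶠ)

      -- Collecting the terms with the same second factor leaves one tensor per basis vector of W,
      -- the form on which contracting the first factor is immediate.
      combination-family : ∀ c → combination (V ⊗ₖ W) c family T.≈ᴹ
                           sum T.+ᴹ-rawMonoid {e} (λ j → gen (combination V (λ i → c (combine i j)) B.vectors , C.vectors j))
      combination-family c = begin
        combination (V ⊗ₖ W) c family
          ≈⟨ sum-combine T.+ᴹ-commutativeMonoid d (λ k → c k T.*ₗ family k) ⟩
        sum T.+ᴹ-rawMonoid {d} (λ i → sum T.+ᴹ-rawMonoid {e} λ j → c (combine i j) T.*ₗ family (combine i j))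
          ≈⟨ TS.∑-comm {d} {e} (λ i j → c (combine i j) T.*ₗ family (combine i j)) ⟩
        sum T.+ᴹ-rawMonoid {e} (λ j → sum T.+ᴹ-rawMonoid {d} λ i → c (combine i j) T.*ₗ family (combine i j))
          ≈⟨ TS.sum-cong-≋ (λ j → TS.sum-cong-≋ λ i →
               T.≈ᴹ-reflexive (≡.cong (λ ij → c (combine i j) T.*ₗ gen (B.vectors (proj₁ ij) , C.vectors (proj₂ ij))) (remQuot-combine i j))) ⟩
        sum T.+ᴹ-rawMonoid {e} (λ j → combination (V ⊗ₖ W) (λ i → c (combine i j)) (λ i → gen (B.vectors i , C.vectors j)))
          ≈⟨ TS.sum-cong-≋ (λ j → combination-homo (leftHom (C.vectors j)) (λ i → c (combine i j)) B.vectors) ⟨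
        sum T.+ᴹ-rawMonoid {e} (λ j → gen (combination V (λ i → c (combine i j)) B.vectors , C.vectors j)) ∎
        where open SetoidReasoning T.≈ᴹ-setoid

    -- Contraction by the i-th coordinate of V turns a vanishing combination into a relation among
    -- the basis vectors of W whose coefficients form the i-th row; hence every entry is zero.
    basis-⊗ : Basis (V ⊗ₖ W) (d ℕ.* e)
    basis-⊗ = record { vectors = family ; independent = independent ; spanning = spanning }
      where
      independent : Independent (V ⊗ₖ W) family
      independent c e₀ k = K.trans (K.reflexive (≡.cong c (≡.sym (combine-remQuot {d} e k)))) (entry (remQuot e k))
        where
        columns : Fin e → V.Carrierᴹ
        columns j = combination V (λ i → c (combine i j)) B.vectors
        zero-columns : ∀ i j → coordinates B (columns j) i K.≈ K.0#
        zero-columns i = C.independent (λ j → coordinates B (columns j) i)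
          (W.≈ᴹ-trans (W.≈ᴹ-sym (h.sum-homo (λ j → gen (columns j , C.vectors j))))
            (W.≈ᴹ-trans (h.⟦⟧-cong (T.≈ᴹ-trans (T.≈ᴹ-sym (combination-family c)) e₀)) h.0ᴹ-homo))
          where module h = Hom (contract K.commutativeRing {V = V} {W = W} (coordinate B i))
        entry : ((i , j) : Fin d × Fin e) → c (combine i j) K.≈ K.0#
        entry (i , j) = K.trans (K.sym (coordinates-unique B (λ i → c (combine i j)) V.≈ᴹ-refl i)) (zero-columns i j)

      spanning : ∀ t → ∃[ c ] t T.≈ᴹ combination (V ⊗ₖ W) c family
      spanning (gen (u , v)) = c , T.≈ᴹ-sym (begin
        combination (V ⊗ₖ W) c family
          ≈⟨ combination-family c ⟩
        sum T.+ᴹ-rawMonoid (λ j → gen (combination V (λ i → c (combine i j)) B.vectors , C.vectors j))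
          ≈⟨ TS.sum-cong-≋ column ⟩
        sum T.+ᴹ-rawMonoid (λ j → coordinates C v j T.*ₗ gen (u , C.vectors j))
          ≈⟨ combination-homo (rightHom u) (coordinates C v) C.vectors ⟨
        gen (u , combination W (coordinates C v) C.vectors)
          ≈⟨ rel (⊗-cong V.≈ᴹ-refl (W.≈ᴹ-sym (proj₂ (C.spanning v)))) ⟩
        gen (u , v) ∎)
        where
        open SetoidReasoning T.≈ᴹ-setoid
        c : Vector K.Carrier (d ℕ.* e)
        c k = let (i , j) = remQuot e k in coordinates C v j K.* coordinates B u i
        column : ∀ j → gen (combination V (λ i → c (combine i j)) B.vectors , C.vectors j) T.≈ᴹ coordinates C v j T.*ₗ gen (u , C.vectors j)
        column j = rel (⊗-cong (V.≈ᴹ-trans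
            (combination-cong V (λ i → K.reflexive (≡.cong (λ (i , j) → coordinates C v j K.* coordinates B u i) (remQuot-combine i j))) (λ _ → V.≈ᴹ-refl))
            (V.≈ᴹ-trans (combination-* V _ (coordinates B u) B.vectors) (V.*ₗ-congˡ (V.≈ᴹ-sym (proj₂ (B.spanning u)))))) W.≈ᴹ-refl)
      spanning 0ᶠ = (λ _ → K.0#) , T.≈ᴹ-sym (combination-zero (V ⊗ₖ W) family (λ _ → K.refl))
      spanning (t +ᶠ u) = let (c , e) = spanning t ; (c′ , e′) = spanning u in
        (λ k → c k K.+ c′ k) , T.≈ᴹ-trans (T.+ᴹ-cong e e′) (T.≈ᴹ-sym (combination-+ (V ⊗ₖ W) c c′ family))
      spanning (-ᶠ t) = let (c , e) = spanning t in
        (λ k → K.- K.1# K.* c k) , T.≈ᴹ-trans (T.-ᴹ‿cong e) (T.≈ᴹ-trans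
          (T.≈ᴹ-sym (T.≈ᴹ-trans (neg-* (V ⊗ₖ W) K.1# (combination (V ⊗ₖ W) c family)) (T.-ᴹ‿cong (T.*ₗ-identityˡ (combination (V ⊗ₖ W) c family)))))
          (T.≈ᴹ-sym (combination-* (V ⊗ₖ W) (K.- K.1#) c family)))

  module _ (A : Algebra) where
    private
      module A = Algebra A

    dim-basis : (M : FGMod A) → Basis (A.space (module′ M)) (A.dim M)
    dim-basis M = proj₂ (basis (A.space (module′ M)) (A.space-fg (module′ M) (finitelyGenerated M)))

    dim-unique : ∀ {d} (M : FGMod A) → Basis (A.space (module′ M)) d → A.dim M ≡ d
    dim-unique M = dimension-unique (A.space (module′ M)) (A.space-fg (module′ M) (finitelyGenerated M))

    dim-exact : {M′ M M″ : FGMod A} → IsShortExact M′ M M″ → A.dim M ≡ A.dim M′ ℕ.+ A.dim M″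
    dim-exact {M′} {M} {M″} ex = dim-unique M (basis-extension (Res-hom A.scalar f) (Res-hom A.scalar g)
      f-injective (λ w → proj₁ (g-surjective w) , proj₂ (g-surjective w) (LeftModule.≈ᴹ-refl (module′ M)))
      image⊆kernel kernel⊆image (dim-basis M′) (dim-basis M″))
      where open IsShortExact ex

    dim-surjection : {M N : FGMod A} (h : LeftModuleHom (module′ M) (module′ N)) →
                     (∀ w → ∃[ u ] LeftModule._≈ᴹ_ (module′ N) (LeftModuleHom.⟦_⟧ h u) w) → A.dim N ≤ A.dim M
    dim-surjection {M} {N} h surjective = surjection-≤ (Res-hom A.scalar h) surjective (dim-basis M) (dim-basis N)

    dim₀ : FreeAb (FGMod A) → ℤ
    dim₀ = extend ℤ.+-0-abelianGroup (λ M → ℤ.+ A.dim M)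

    dim₀-cong : ∀ {x y} → AbelianGroup._≈_ (G₀ A) x y → dim₀ x ≡ dim₀ y
    dim₀-cong = extend-cong ℤ.+-0-abelianGroup _ λ { (exact ex) → ≡.cong ℤ.+_ (dim-exact ex) }

    dim₀-× : ∀ k x → dim₀ (MultProperties._×_ (AbelianGroup.monoid (G₀ A)) k x) ≡ ℤ.+ k ℤ.* dim₀ x
    dim₀-× zero    x = ≡.sym (ℤ.*-zeroˡ (dim₀ x))
    dim₀-× (suc k) x = ≡.trans (≡.cong (λ z → dim₀ x ℤ.+ z) (dim₀-× k x)) (≡.sym (ℤ.suc-* (ℤ.+ k) (dim₀ x)))

    dim₀-×ℤ : ∀ c x → dim₀ (_×ℤ_ (G₀ A) c x) ≡ c ℤ.* dim₀ x
    dim₀-×ℤ (ℤ.+ k)    x = dim₀-× k x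
    dim₀-×ℤ ℤ.-[1+ k ] x = ≡.trans (≡.cong ℤ.-_ (dim₀-× (suc k) x)) (ℤ.neg-distribˡ-* (ℤ.+ suc k) (dim₀ x))

  module _ {A B : Algebra} where
    private
      module A = Algebra A
      module B = Algebra B
      module AB = Algebra (A ⊗ᴬ B)

    dim-⊠ : (M : FGMod A) (N : FGMod B) → AB.dim (M ⊠ N) ≡ A.dim M ℕ.* B.dim N
    dim-⊠ M N = dim-unique (A ⊗ᴬ B) (M ⊠ N)
      (basis-image identity id (λ w → w , reflᶠ) (basis-⊗ (dim-basis A M) (dim-basis B N)))
      where
      V = A.space (module′ M) ⊗ₖ B.space (module′ N)
      module V = LeftModule V
      module MN = LeftModule (AB.space (module′ (M ⊠ N)))
      -- Scalars act on `M ⊠ N` through c ⊗ 1, giving c u ⊗ 1 v, so the two vector space structures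
      -- on the same group agree only after 1 v = v.
      scalar : ∀ p t → (p V.*ₗ t) V.≈ᴹ (p MN.*ₗ t)
      scalar p (gen (u , v)) = rel (⊗-cong (LeftModule.≈ᴹ-refl (module′ M)) (LeftModule.≈ᴹ-sym (module′ N) (LeftModule.*ₗ-identityˡ (module′ N) v)))
      scalar p 0ᶠ       = reflᶠ
      scalar p (t +ᶠ u) = +ᶠ-cong (scalar p t) (scalar p u)
      scalar p (-ᶠ t)   = -ᶠ-cong (scalar p t)
      identity : LeftModuleHom V (AB.space (module′ (M ⊠ N)))
      identity = mkHom id id (λ u v → reflᶠ) scalar

    dim-Res : (f : AlgebraHom A B) (N : FGMod B) → A.dim (Resᶠᵍ f N) ≡ B.dim N
    dim-Res f N = dim-unique A (Resᶠᵍ f N) (basis-image identity id (λ w → w , N.≈ᴹ-refl) (dim-basis B N))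
      where
      module N = LeftModule (module′ N)
      identity : LeftModuleHom (B.space (module′ N)) (A.space (module′ (Resᶠᵍ f N)))
      identity = mkHom id id (λ u v → N.≈ᴹ-refl) (λ p u → N.*ₗ-congʳ (B.sym (AlgebraHom.scalar-homo f p)))

    -- Lets the dimension of a restricted module be computed from a preimage of its class in G₀(A) ⊗
    -- G₀(B), whichever preimage the coproduct supplies.
    dim₀-exterior : ∀ t → dim₀ (A ⊗ᴬ B) (exterior A B t) ≡ extend ℤ.+-0-abelianGroup (λ (x , y) → dim₀ A x ℤ.* dim₀ B y) t
    dim₀-exterior (gen (x , y)) = left x
      where
      right : ∀ M y → dim₀ (A ⊗ᴬ B) (extend (G₀ (A ⊗ᴬ B)) (λ N → gen (M ⊠ N)) y) ≡ ℤ.+ A.dim M ℤ.* dim₀ B y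
      right M (gen N)  = ≡.trans (≡.cong ℤ.+_ (dim-⊠ M N)) (ℤ.pos-* (A.dim M) (B.dim N))
      right M 0ᶠ       = ≡.sym (ℤ.*-zeroʳ (ℤ.+ A.dim M))
      right M (y +ᶠ z) = ≡.trans (≡.cong₂ ℤ._+_ (right M y) (right M z)) (≡.sym (ℤ.*-distribˡ-+ (ℤ.+ A.dim M) _ _))
      right M (-ᶠ y)   = ≡.trans (≡.cong ℤ.-_ (right M y)) (ℤ.neg-distribʳ-* (ℤ.+ A.dim M) _)
      left : ∀ x → dim₀ (A ⊗ᴬ B) (exterior A B (gen (x , y))) ≡ dim₀ A x ℤ.* dim₀ B y
      left (gen M)  = right M y
      left 0ᶠ       = ≡.sym (ℤ.*-zeroˡ (dim₀ B y))
      left (x +ᶠ z) = ≡.trans (≡.cong₂ ℤ._+_ (left x) (left z)) (≡.sym (ℤ.*-distribʳ-+ (dim₀ B y) (dim₀ A x) _))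
      left (-ᶠ x)   = ≡.trans (≡.cong ℤ.-_ (left x)) (ℤ.neg-distribˡ-* (dim₀ A x) _)
    dim₀-exterior 0ᶠ       = ≡.refl
    dim₀-exterior (t +ᶠ u) = ≡.cong₂ ℤ._+_ (dim₀-exterior t) (dim₀-exterior u)
    dim₀-exterior (-ᶠ t)   = ≡.cong ℤ.-_ (dim₀-exterior t)

-- Simple modules and projective covers

module SimpleModules (em : ∀ ℓ → ExcludedMiddle ℓ) (K : Field) (𝔸 : Towers.Algebra (em 0ℓ) K) where
  open Combinations (em 0ℓ) K
  open Dimensions (em 0ℓ) K
  open Towers (em 0ℓ) K using (Algebra; FGMod; Mod; subquotient; IsSimple; IsListOfSimples; ProjectiveCover)
  open FGModule using (module′; finitelyGenerated)
  open Submodule using (Member)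
  private
    module K = Field K
    module A = Algebra 𝔸
    module AA = AbelianGroupProperties A.+-abelianGroup
    module AS = CommutativeSemigroupProperties (CommutativeMonoid.commutativeSemigroup A.+-commutativeMonoid)
    V = A.space A.regular
    module V = LeftModule V

  LeftIdeal : Set₁
  LeftIdeal = Submodule A.regular 0ℓ

  infix 4 _⊆_
  _⊆_ : LeftIdeal → LeftIdeal → Set
  U ⊆ W = ∀ {u} → Member U u → Member W u

  Proper : LeftIdeal → Set
  Proper W = ¬ Member W A.1#

  Maximal : LeftIdeal → Set₁
  Maximal W = (X : LeftIdeal) → W ⊆ X → Proper X → X ⊆ W

  full zeroIdeal : LeftIdeal
  full = record { Member = λ _ → ⊤ ; resp = λ _ _ → tt ; 0∈ = tt ; +∈ = λ _ _ → tt ; *∈ = λ _ _ → tt }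
  zeroIdeal = record
    { Member = λ u → u A.≈ A.0#
    ; resp = λ e z → A.trans (A.sym e) z
    ; 0∈ = A.refl
    ; +∈ = λ z z′ → A.trans (A.+-cong z z′) (A.+-identityˡ A.0#)
    ; *∈ = λ p z → A.trans (A.*-congˡ z) (A.zeroʳ p)
    }

  module _ (W : LeftIdeal) where
    private
      module W = Submodule W

    neg∈ : ∀ {u} → W.Member u → W.Member (A.- u)
    neg∈ {u} u∈ = W.resp (V.≈ᴹ-trans (neg-* A.regular A.1# u) (A.-‿cong (A.*-identityˡ u))) (W.*∈ (A.- A.1#) u∈)

    combination∈ : ∀ {d} c (v : Vector A.Carrier d) → (∀ i → W.Member (v i)) → W.Member (combination V c v)
    combination∈ {zero}  c v v∈ = W.0∈
    combination∈ {suc d} c v v∈ = W.+∈ (W.*∈ _ (v∈ zero)) (combination∈ (c ∘ suc) (v ∘ suc) (v∈ ∘ suc))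

    -- A relation with nonzero coefficient at `x` could be solved for `x`, which would put it into
    -- W. Each strict enlargement of a left ideal thus lengthens an independent family.
    independent-◂ : ∀ {d x} (v : Vector A.Carrier d) → Independent V v → (∀ i → W.Member (v i)) → ¬ W.Member x →
                    Independent V (x ◂ v)
    independent-◂ {x = x} v independent v∈ x∉ c e = λ where
        zero    → head-zero
        (suc i) → independent (c ∘ suc) (V.≈ᴹ-trans (V.≈ᴹ-sym (V.+ᴹ-identityˡ _))
          (V.≈ᴹ-trans (V.+ᴹ-congʳ (V.≈ᴹ-sym (V.≈ᴹ-trans (V.*ₗ-congʳ head-zero) (V.*ₗ-zeroˡ x)))) e)) i
      where
      multiple∈ : W.Member (c zero V.*ₗ x)
      multiple∈ = W.resp (A.sym (AA.inverseˡ-unique _ _ e)) (neg∈ (combination∈ (c ∘ suc) v v∈))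
      head-zero : c zero K.≈ K.0#
      head-zero with em 0ℓ {P = c zero K.≈ K.0#}
      ... | yes z = z
      ... | no z = let (q , q*c) = K.inverse (c zero) z in
        ⊥-elim (x∉ (W.resp (V.≈ᴹ-trans (V.≈ᴹ-sym (V.*ₗ-assoc q (c zero) x)) (V.≈ᴹ-trans (V.*ₗ-congʳ q*c) (V.*ₗ-identityˡ x)))
          (W.*∈ A.scalar⟦ q ⟧ multiple∈)))

  maximal-above : (W : LeftIdeal) → Proper W → Σ LeftIdeal λ W′ → W ⊆ W′ × Proper W′ × Maximal W′
  maximal-above W proper = go (A.dim A.regularᶠᵍ) W proper (λ ()) (λ _ _ ()) (λ ()) (ℕ.m≤m+n _ 0)
    where
    -- The independent family inside W grows with every enlargement of W, so the search ends after dim A steps.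
    go : ∀ fuel {k} (W : LeftIdeal) → Proper W → (v : Vector A.Carrier k) → Independent V v → (∀ i → Member W (v i)) →
         A.dim A.regularᶠᵍ ≤ fuel ℕ.+ k → Σ LeftIdeal λ W′ → W ⊆ W′ × Proper W′ × Maximal W′
    go fuel {k} W proper v independent v∈ bound
      with em (lsuc 0ℓ) {P = Σ LeftIdeal λ X → W ⊆ X × Proper X × ∃[ x ] Member X x × ¬ Member W x}
    ... | no none = W , id , proper , maximal
      where
      maximal : Maximal W
      maximal X W⊆X properX {u} u∈ with em 0ℓ {P = Member W u}
      ... | yes u∈W = u∈W
      ... | no u∉W = ⊥-elim (none (X , W⊆X , properX , u , u∈ , u∉W))
    go zero {k} W proper v independent v∈ bound | yes (X , W⊆X , properX , x , x∈ , x∉) =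
      ⊥-elim (ℕ.<⇒≱ (independent-≤ V (x ◂ v) (independent-◂ W v independent v∈ x∉) (dim-basis 𝔸 A.regularᶠᵍ)) bound)
    go (suc fuel) {k} W proper v independent v∈ bound | yes (X , W⊆X , properX , x , x∈ , x∉) =
      let (W′ , X⊆W′ , rest) = go fuel X properX (x ◂ v) (independent-◂ W v independent v∈ x∉)
                                  (λ { zero → x∈ ; (suc i) → W⊆X (v∈ i) })
                                  (≡.subst (A.dim A.regularᶠᵍ ≤_) (≡.sym (ℕ.+-suc fuel k)) bound)
      in W′ , X⊆W′ ∘ W⊆X , rest

  quotient : LeftIdeal → FGMod 𝔸
  quotient W = subquotient {𝔸} A.regularᶠᵍ full W

  module _ (W : LeftIdeal) where
    private
      module W = Submodule W
      module Q = LeftModule (module′ (quotient W))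

    ∈⇒≈0 : ∀ {u} → W.Member u → (u , tt) Q.≈ᴹ Q.0ᴹ
    ∈⇒≈0 u∈ = W.resp (A.sym (A.trans (A.+-congˡ AA.ε⁻¹≈ε) (A.+-identityʳ _))) u∈

    ≈0⇒∈ : ∀ {u} → (u , tt) Q.≈ᴹ Q.0ᴹ → W.Member u
    ≈0⇒∈ e = W.resp (A.trans (A.+-congˡ AA.ε⁻¹≈ε) (A.+-identityʳ _)) e

    quotient-cong : ∀ {u v} → u A.≈ v → (u , tt) Q.≈ᴹ (v , tt)
    quotient-cong e = W.resp (A.sym (A.trans (A.+-congʳ e) (A.-‿inverseʳ _))) W.0∈

    -- A submodule is everything as soon as it contains the class of 1. Otherwise its preimage is a
    -- proper left ideal above W, hence contained in W by maximality, and the submodule is zero.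
    quotient-simple : Proper W → Maximal W → IsSimple (module′ (quotient W))
    quotient-simple proper maximal = record
      { nonzero = (A.1# , tt) , proper ∘ ≈0⇒∈
      ; noSubmodules = dichotomy
      }
      where
      dichotomy : (X : Submodule (module′ (quotient W)) 0ℓ) → (∀ u → Member X u → u Q.≈ᴹ Q.0ᴹ) ⊎ (∀ u → Member X u)
      dichotomy X with em 0ℓ {P = Member X (A.1# , tt)}
      ... | yes 1∈ = inj₂ λ (u , _) → X.resp (quotient-cong (A.*-identityʳ u)) (X.*∈ u 1∈)
        where module X = Submodule X
      ... | no 1∉ = inj₁ λ (u , _) u∈ → ∈⇒≈0 (maximal preimage (λ w∈ → X.resp (Q.≈ᴹ-sym (∈⇒≈0 w∈)) X.0∈) 1∉ u∈)
        where
        module X = Submodule X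
        preimage : LeftIdeal
        preimage = record
          { Member = λ u → X.Member (u , tt) ; resp = λ e → X.resp (quotient-cong e)
          ; 0∈ = X.0∈ ; +∈ = X.+∈ ; *∈ = λ p → X.*∈ p }

  Kills : LeftIdeal → Mod 𝔸 → Set
  Kills N M = ∀ {n} → Member N n → ∀ x → LeftModule._≈ᴹ_ M (LeftModule._*ₗ_ M n x) (LeftModule.0ᴹ M)

  Kills-≅ : ∀ {N} {M M′ : Mod 𝔸} → M ≅ᴹ M′ → Kills N M′ → Kills N M
  Kills-≅ {M = M} {M′} (h , injective , _) kills n∈ x =
    injective (M′.≈ᴹ-trans (h.*ₗ-homo _ x) (M′.≈ᴹ-trans (kills n∈ _) (M′.≈ᴹ-sym h.0ᴹ-homo)))
    where
    module h = Hom h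
    module M′ = LeftModule M′

  -- If U were proper, it would lie in a maximal left ideal W. N kills the class of 1 in the simple
  -- module A/W, so N ⊆ W too, and A = U + N ⊆ W is a contradiction. N behaves as a left ideal
  -- inside the Jacobson radical.
  nakayama : (U N : LeftIdeal) → (∀ a → ∃[ u ] ∃[ n ] Member U u × Member N n × a A.≈ u A.+ n) →
             ((M : Mod 𝔸) → IsSimple M → Kills N M) → ∀ a → Member U a
  nakayama U N sum≡A kills with em 0ℓ {P = Member U A.1#}
  ... | yes 1∈ = λ a → Submodule.resp U (A.*-identityʳ a) (Submodule.*∈ U a 1∈)
  ... | no proper =
    let (W , U⊆W , properW , maximal) = maximal-above U proper
        (u , n , u∈ , n∈ , e) = sum≡A A.1#
        n∈W = ≈0⇒∈ W (LeftModule.≈ᴹ-trans (module′ (quotient W)) (quotient-cong W (A.sym (A.*-identityʳ n)))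
                (kills (module′ (quotient W)) (quotient-simple W properW maximal) n∈ (A.1# , tt)))
    in ⊥-elim (properW (Submodule.resp W (A.sym e) (Submodule.+∈ W (U⊆W u∈) n∈W)))

  module _ {S P : FGMod 𝔸} (simple : IsSimple (module′ S)) (covering : ProjectiveCover P S) where
    private
      module S = LeftModule (module′ S)
      module P = LeftModule (module′ P)
    open IsSimple simple
    open ProjectiveCover covering using (projective; cover; surjective)

    -- By simplicity N x is either 0, where the zero map serves, or all of S. In the second case
    -- projectivity lifts the cover P → S along n ↦ n x; choosing p over n x makes n - h p kill x.
    lift-cover : (N : LeftIdeal) (x : S.Carrierᴹ) →
                 Σ (LeftModuleHom (module′ P) A.regular) λ h → let open LeftModuleHom h in
                   (∀ p → Member N ⟦ p ⟧) × (∀ {n} → Member N n → ∃[ p ] (n A.+ A.- ⟦ p ⟧) S.*ₗ x S.≈ᴹ S.0ᴹ)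
    lift-cover N x with em 0ℓ {P = ∃[ n ] Member N n × ¬ (n S.*ₗ x S.≈ᴹ S.0ᴹ)}
    ... | no none = mkHom (λ _ → A.0#) (λ _ → A.refl) (λ _ _ → A.sym (A.+-identityˡ _)) (λ p _ → A.sym (A.zeroʳ p)) ,
        (λ _ → N.0∈) , λ {n} n∈ → P.0ᴹ , S.≈ᴹ-trans (S.*ₗ-congʳ (A.trans (A.+-congˡ AA.ε⁻¹≈ε) (A.+-identityʳ n))) (killed n∈)
      where
      module N = Submodule N
      killed : ∀ {n} → Member N n → n S.*ₗ x S.≈ᴹ S.0ᴹ
      killed {n} n∈ with em 0ℓ {P = n S.*ₗ x S.≈ᴹ S.0ᴹ}
      ... | yes z = z
      ... | no z = ⊥-elim (none (n , n∈ , z))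
    ... | yes (n₀ , n₀∈ , nonzero) = mkHom (proj₁ ∘ lifted.⟦_⟧) (≈ᴺ⇒≈ ∘ lifted.⟦⟧-cong)
          (λ u v → ≈ᴺ⇒≈ (lifted.+ᴹ-homo u v)) (λ p u → ≈ᴺ⇒≈ (lifted.*ₗ-homo p u)) ,
        proj₂ ∘ lifted.⟦_⟧ , λ {n} n∈ → let (p , e) = surjective (n S.*ₗ x) in p , (begin
          (n A.+ A.- proj₁ lifted.⟦ p ⟧) S.*ₗ x                        ≈⟨ S.*ₗ-distribʳ x n _ ⟩
          n S.*ₗ x S.+ᴹ (A.- proj₁ lifted.⟦ p ⟧) S.*ₗ x                ≈⟨ S.+ᴹ-congˡ (neg-* (module′ S) _ x) ⟩
          n S.*ₗ x S.+ᴹ S.-ᴹ (proj₁ lifted.⟦ p ⟧ S.*ₗ x)               ≈⟨ S.+ᴹ-congˡ (S.-ᴹ‿cong (S.≈ᴹ-trans (lifts p) (e P.≈ᴹ-refl))) ⟩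
          n S.*ₗ x S.+ᴹ S.-ᴹ (n S.*ₗ x)                                ≈⟨ S.-ᴹ‿inverseʳ _ ⟩
          S.0ᴹ                                                         ∎)
      where
      open SetoidReasoning S.≈ᴹ-setoid
      module N = Submodule N
      -- N as a module in its own right, encoded as N / 0; its equality therefore says that a
      -- difference vanishes, which `≈ᴺ⇒≈` undoes.
      N-module : Mod 𝔸
      N-module = module′ (subquotient {𝔸} A.regularᶠᵍ N zeroIdeal)
      ≈ᴺ⇒≈ : ∀ {a b} → a A.+ A.- b A.≈ A.0# → a A.≈ b
      ≈ᴺ⇒≈ e = A.trans (AA.inverseˡ-unique _ _ e) (AA.⁻¹-involutive _)
      evaluate : LeftModuleHom N-module (module′ S)
      evaluate = mkHom (λ (n , _) → n S.*ₗ x) (λ e → S.*ₗ-congʳ (≈ᴺ⇒≈ e)) (λ (n , _) (n′ , _) → S.*ₗ-distribʳ x n n′)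
        (λ p (n , _) → S.*ₗ-assoc p n x)
      image : Submodule (module′ S) 0ℓ
      image = record
        { Member = λ y → ∃[ n ] N.Member n × n S.*ₗ x S.≈ᴹ y
        ; resp = λ e (n , n∈ , e′) → n , n∈ , S.≈ᴹ-trans e′ e
        ; 0∈ = A.0# , N.0∈ , S.*ₗ-zeroˡ x
        ; +∈ = λ (n , n∈ , e) (n′ , n′∈ , e′) → n A.+ n′ , N.+∈ n∈ n′∈ , S.≈ᴹ-trans (S.*ₗ-distribʳ x n n′) (S.+ᴹ-cong e e′)
        ; *∈ = λ p (n , n∈ , e) → p A.* n , N.*∈ p n∈ , S.≈ᴹ-trans (S.*ₗ-assoc p n x) (S.*ₗ-congˡ e)
        }
      evaluate-surjective : LeftModuleHom.IsSurjective evaluate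
      evaluate-surjective y with noSubmodules image
      ... | inj₁ all-zero = ⊥-elim (nonzero (all-zero _ (n₀ , n₀∈ , S.≈ᴹ-refl)))
      ... | inj₂ everything = let (n , n∈ , e) = everything y in
        (n , n∈) , λ e′ → S.≈ᴹ-trans (S.*ₗ-congʳ (≈ᴺ⇒≈ e′)) e
      lifting = projective N-module (module′ S) evaluate evaluate-surjective cover
      module lifted = Hom (proj₁ lifting)
      lifts = proj₂ lifting

  module _ {t} (S P : Fin t → FGMod 𝔸) (simples : IsListOfSimples S) (covers : ∀ i → ProjectiveCover (P i) (S i)) where
    open IsListOfSimples simples
    private
      module S i = LeftModule (module′ (S i))
      Element : Set
      Element = Σ (Fin t) S.Carrierᴹ

      weight : List Element → ℕ
      weight xs = sumᴸ (List.map (A.dim ∘ P ∘ proj₁) xs)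

      Annihilates : A.Carrier → Element → Set
      Annihilates n (i , x) = S._≈ᴹ_ i (S._*ₗ_ i n x) (S.0ᴹ i)

      -- The invariant of the construction: A = U + N, where N annihilates the vectors treated so
      -- far and U is spanned by images of projective covers. The length of `family` carries the
      -- bound on dim U.
      record Approximation (xs : List Element) : Set₁ where
        field
          U N      : LeftIdeal
          U+N      : ∀ a → ∃[ u ] ∃[ n ] Member U u × Member N n × a A.≈ u A.+ n
          family   : Vector A.Carrier (weight xs)
          spanning : ∀ {u} → Member U u → ∃[ c ] u A.≈ combination V c family
          kills    : ∀ {n} → Member N n → All (Annihilates n) xs

      approximation : ∀ xs → Approximation xs
      approximation [] = record
        { U = zeroIdeal ; N = full ; U+N = λ a → A.0# , a , A.refl , tt , A.sym (A.+-identityˡ a)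
        ; family = λ () ; spanning = λ e → (λ ()) , e ; kills = λ _ → [] }
      approximation ((i , x) ∷ xs) = record
        { U = U′ ; N = N′ ; U+N = U′+N′ ; family = (h.⟦_⟧ ∘ Basis.vectors (dim-basis 𝔸 (P i))) ⧺ family
        ; spanning = spanning′ ; kills = λ (n∈ , e) → e ∷ kills n∈ }
        where
        open Approximation (approximation xs)
        module Pᵢ = LeftModule (module′ (P i))
        lifting = lift-cover (simple i) (covers i) N x
        h = proj₁ lifting
        module h = Hom h
        U′ N′ : LeftIdeal
        U′ = record
          { Member = λ a → ∃[ u ] ∃[ p ] Member U u × a A.≈ u A.+ h.⟦ p ⟧
          ; resp = λ e (u , p , u∈ , e′) → u , p , u∈ , A.trans (A.sym e) e′
          ; 0∈ = A.0# , Pᵢ.0ᴹ , Submodule.0∈ U , A.sym (A.trans (A.+-identityˡ _) h.0ᴹ-homo)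
          ; +∈ = λ (u , p , u∈ , e) (v , q , v∈ , e′) → u A.+ v , p Pᵢ.+ᴹ q , Submodule.+∈ U u∈ v∈ ,
              A.trans (A.+-cong e e′) (A.trans (AS.interchange _ _ _ _) (A.+-congˡ (A.sym (h.+ᴹ-homo p q))))
          ; *∈ = λ a (u , p , u∈ , e) → a A.* u , a Pᵢ.*ₗ p , Submodule.*∈ U a u∈ ,
              A.trans (A.*-congˡ e) (A.trans (A.distribˡ a _ _) (A.+-congˡ (A.sym (h.*ₗ-homo a p))))
          }
        N′ = record
          { Member = λ n → Member N n × Annihilates n (i , x)
          ; resp = λ e (n∈ , z) → Submodule.resp N e n∈ , S.≈ᴹ-trans i (S.*ₗ-congʳ i (A.sym e)) z
          ; 0∈ = Submodule.0∈ N , S.*ₗ-zeroˡ i x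
          ; +∈ = λ {u} {v} (u∈ , z) (v∈ , z′) → Submodule.+∈ N u∈ v∈ ,
              S.≈ᴹ-trans i (S.*ₗ-distribʳ i x u v) (S.≈ᴹ-trans i (S.+ᴹ-cong i z z′) (S.+ᴹ-identityˡ i _))
          ; *∈ = λ p {u} (u∈ , z) → Submodule.*∈ N p u∈ ,
              S.≈ᴹ-trans i (S.*ₗ-assoc i p u x) (S.≈ᴹ-trans i (S.*ₗ-congˡ i z) (S.*ₗ-zeroʳ i p))
          }
        -- Writing a = u + n, the element h p moves from the second summand to the first, where p is
        -- chosen so that n - h p kills x.
        U′+N′ : ∀ a → ∃[ u ] ∃[ n ] Member U′ u × Member N′ n × a A.≈ u A.+ n
        U′+N′ a =
          let (u , n , u∈ , n∈ , e) = U+N a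
              (p , z) = proj₂ (proj₂ lifting) n∈
          in u A.+ h.⟦ p ⟧ , n A.+ A.- h.⟦ p ⟧ , (u , p , u∈ , A.refl) ,
             (Submodule.+∈ N n∈ (neg∈ N (proj₁ (proj₂ lifting) p)) , z) ,
             A.trans e (A.trans (A.+-congˡ (A.sym (A.trans (A.+-comm _ _) (A.trans (A.+-assoc _ _ _)
               (A.trans (A.+-congˡ (A.-‿inverseˡ _)) (A.+-identityʳ n)))))) (A.sym (A.+-assoc _ _ _)))
        spanning′ : ∀ {a} → Member U′ a → ∃[ c ] a A.≈ combination V c ((h.⟦_⟧ ∘ Basis.vectors (dim-basis 𝔸 (P i))) ⧺ family)
        spanning′ (u , p , u∈ , e) =
          let (c , e′) = spanning u∈
              (c₁ , e₁) = Basis.spanning (dim-basis 𝔸 (P i)) p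
          in c₁ ⧺ c , A.trans e (A.trans (A.+-comm u _) (A.trans
               (A.+-cong (A.trans (h.⟦⟧-cong e₁) (combination-homo (Res-hom A.scalar h) c₁ (Basis.vectors (dim-basis 𝔸 (P i))))) e′)
               (A.sym (combination-⧺-⧺ V c₁ c _ family))))

      -- Treating every basis vector of each simple module costs one copy of `P i` per vector, so
      -- each i contributes dim `S i` times dim `P i`.
      elements : List Element
      elements = List.concat (List.tabulate λ i → List.tabulate λ j → i , Basis.vectors (dim-basis 𝔸 (S i)) j)

      weight-concat : ∀ {k} (f : Fin k → List Element) → weight (List.concat (List.tabulate f)) ≡ sum ℕ.+-0-rawMonoid (weight ∘ f)
      weight-concat {zero}  f = ≡.refl
      weight-concat {suc k} f = ≡.trans (≡.cong sumᴸ (map-++ _ (f zero) _))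
        (≡.trans (sum-++ (List.map _ (f zero)) _) (≡.cong (weight (f zero) ℕ.+_) (weight-concat (f ∘ suc))))

      weight-tabulate : ∀ {k} i (x : Fin k → S.Carrierᴹ i) → weight (List.tabulate λ j → i , x j) ≡ k ℕ.* A.dim (P i)
      weight-tabulate {zero}  i x = ≡.refl
      weight-tabulate {suc k} i x = ≡.cong (A.dim (P i) ℕ.+_) (weight-tabulate i (x ∘ suc))

    -- After all `elements` are treated, N kills a basis of each `S i`, hence every simple module up
    -- to isomorphism. Then `nakayama` gives U = A, and U is spanned by as many vectors as the
    -- right-hand side counts.
    dim-regular-≤ : A.dim A.regularᶠᵍ ≤ sum ℕ.+-0-rawMonoid (λ i → A.dim (S i) ℕ.* A.dim (P i))
    dim-regular-≤ = ≡.subst (A.dim A.regularᶠᵍ ≤_) count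
        (basis-≤ V (dim-basis 𝔸 A.regularᶠᵍ) family (λ u → spanning (nakayama U N U+N kills-simple u)))
      where
      open Approximation (approximation elements)
      count : weight elements ≡ sum ℕ.+-0-rawMonoid (λ i → A.dim (S i) ℕ.* A.dim (P i))
      count = ≡.trans (weight-concat {t} _) (MonoidSum.sum-cong-≗ ℕ.+-0-commutativeMonoid (λ i → weight-tabulate i (Basis.vectors (dim-basis 𝔸 (S i)))))
      kills-S : ∀ i → Kills N (module′ (S i))
      kills-S i {n} n∈ x =
        let (c , e) = Basis.spanning (dim-basis 𝔸 (S i)) x in
        S.≈ᴹ-trans i (S.*ₗ-congˡ i e) (S.≈ᴹ-trans i (combination-homo multiply c vectors)
          (sum-zero (S.+ᴹ-commutativeMonoid i) (λ j → S.≈ᴹ-trans i (S.*ₗ-congˡ i (killed j)) (S.*ₗ-zeroʳ i _))))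
        where
        vectors = Basis.vectors (dim-basis 𝔸 (S i))
        killed : ∀ j → S._≈ᴹ_ i (S._*ₗ_ i n (vectors j)) (S.0ᴹ i)
        killed = All.tabulate⁻ (All.tabulate⁻ (All.concat⁻ (kills n∈)) i)
        -- Multiplication by `n` is linear over the field because scalars are central, so killing a
        -- basis means killing the whole module.
        multiply : LeftModuleHom (A.space (module′ (S i))) (A.space (module′ (S i)))
        multiply = mkHom (S._*ₗ_ i n) (S.*ₗ-congˡ i) (S.*ₗ-distribˡ i n)
          (λ c x → S.≈ᴹ-trans i (S.≈ᴹ-sym i (S.*ₗ-assoc i n _ x)) (S.≈ᴹ-trans i (S.*ₗ-congʳ i (A.sym (A.central c n))) (S.*ₗ-assoc i _ n x)))
      kills-simple : (M : Mod 𝔸) → IsSimple M → Kills N M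
      kills-simple M isSimple = let (i , iso) = exhaustive M isSimple in Kills-≅ {N} iso (kills-S i)

-- Additive extensions and direct sums of graded components

module _ {R : Ring r ℓr} {M : LeftModule R m ℓm} {N : LeftModule R n ℓn} (h : LeftModuleHom M N) where
  private
    module N = LeftModule N
    module h = Hom h

  extend-homo : {X : Set x} (f : X → LeftModule.Carrierᴹ M) (t : FreeAb X) →
                h.⟦ extend (LeftModule.+ᴹ-abelianGroup M) f t ⟧ N.≈ᴹ extend N.+ᴹ-abelianGroup (h.⟦_⟧ ∘ f) t
  extend-homo f (gen y)  = N.≈ᴹ-refl
  extend-homo f 0ᶠ       = h.0ᴹ-homo
  extend-homo f (t +ᶠ u) = N.≈ᴹ-trans (h.+ᴹ-homo _ _) (N.+ᴹ-cong (extend-homo f t) (extend-homo f u))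
  extend-homo f (-ᶠ t)   = N.≈ᴹ-trans (h.-ᴹ-homo _) (N.-ᴹ‿cong (extend-homo f t))

module _ {R : Ring r ℓr} (M : ℕ → LeftModule R m ℓm) where
  private
    module M i = LeftModule (M i)
    module ⊕ = LeftModule (⨁ M)

  component-ι : ∀ n u → component (ι M n u) n ≡ u
  component-ι n u with n ℕ.≟ n
  ... | yes ≡.refl = ≡.refl
  ... | no n≢n     = ⊥-elim (n≢n ≡.refl)

  component-ι-≢ : ∀ {n i} u → n ≢ i → component (ι M n u) i ≡ M.0ᴹ i
  component-ι-≢ {n} {i} u n≢i with n ℕ.≟ i
  ... | yes n≡i = ⊥-elim (n≢i n≡i)
  ... | no _    = ≡.refl

  componentHom : ∀ n → LeftModuleHom (⨁ M) (M n)
  componentHom n = mkHom (λ u → component u n) (λ e → e n) (λ _ _ → M.≈ᴹ-refl n) (λ _ _ → M.≈ᴹ-refl n)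

  ι-hom : ∀ n → LeftModuleHom (M n) (⨁ M)
  ι-hom n = mkHom (ι M n) cong +-homo *-homo
    where
    cong : ∀ {u v} → M._≈ᴹ_ n u v → ι M n u ⊕.≈ᴹ ι M n v
    cong e i with n ℕ.≟ i
    ... | yes ≡.refl = e
    ... | no _       = M.≈ᴹ-refl i
    +-homo : ∀ u v → ι M n (M._+ᴹ_ n u v) ⊕.≈ᴹ ι M n u ⊕.+ᴹ ι M n v
    +-homo u v i with n ℕ.≟ i
    ... | yes ≡.refl = M.≈ᴹ-refl i
    ... | no _       = M.≈ᴹ-sym i (M.+ᴹ-identityˡ i _)
    *-homo : ∀ p u → ι M n (M._*ₗ_ n p u) ⊕.≈ᴹ p ⊕.*ₗ ι M n u
    *-homo p u i with n ℕ.≟ i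
    ... | yes ≡.refl = M.≈ᴹ-refl i
    ... | no _       = M.≈ᴹ-sym i (M.*ₗ-zeroʳ i p)

  -- In degree k only the summand of index k contributes. If k is at or beyond the bound there is no
  -- such summand, and the component of u vanishes as well.
  decompose : ∀ u → u ⊕.≈ᴹ sum ⊕.+ᴹ-rawMonoid {bound u} (λ i → ι M (toℕ i) (component u (toℕ i)))
  decompose u k = M.≈ᴹ-sym k (M.≈ᴹ-trans k (Hom.sum-homo (componentHom k) summands) single)
    where
    summands : Vector ⊕.Carrierᴹ (bound u)
    summands i = ι M (toℕ i) (component u (toℕ i))
    other : ∀ i → toℕ i ≢ k → M._≈ᴹ_ k (component (summands i) k) (M.0ᴹ k)
    other i i≢k = M.≈ᴹ-reflexive k (component-ι-≢ _ i≢k)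
    single : M._≈ᴹ_ k (sum (M.+ᴹ-rawMonoid k) (λ i → component (summands i) k)) (component u k)
    single with k ℕ.<? bound u
    ... | yes l = M.≈ᴹ-trans k
      (sum-single (M.+ᴹ-commutativeMonoid k) _ (fromℕ< l) λ j j≢ → other j λ e → j≢ (toℕ-injective (≡.trans e (≡.sym (toℕ-fromℕ< l)))))
      (M.≈ᴹ-reflexive k (≡.trans (≡.cong (λ i → component (ι M i (component u i)) k) (toℕ-fromℕ< l)) (component-ι k _)))
    ... | no ≥ = M.≈ᴹ-trans k
      (sum-zero (M.+ᴹ-commutativeMonoid k) (λ i → other i λ e → ≥ (≡.subst (_< bound u) e (toℕ<n i))))
      (M.≈ᴹ-sym k (vanishes u (ℕ.≮⇒≥ ≥)))

  ⨁-induction : (P : Pred ⊕.Carrierᴹ p) → (∀ {u v} → u ⊕.≈ᴹ v → P u → P v) → P ⊕.0ᴹ →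
                (∀ {u v} → P u → P v → P (u ⊕.+ᴹ v)) → (∀ n u → P (ι M n u)) → ∀ u → P u
  ⨁-induction P resp zero-case plus base u = resp (⊕.≈ᴹ-sym {u} {sum ⊕.+ᴹ-rawMonoid summands} (decompose u)) (sums summands λ i → base _ _)
    where
    summands : Vector ⊕.Carrierᴹ (bound u)
    summands i = ι M (toℕ i) (component u (toℕ i))
    sums : ∀ {k} (f : Vector ⊕.Carrierᴹ k) → (∀ i → P (f i)) → P (sum ⊕.+ᴹ-rawMonoid f)
    sums {zero}  f q = zero-case
    sums {suc k} f q = plus (q zero) (sums (f ∘ suc) (q ∘ suc))

module _ (M : ℕ → LeftModule ℤ[q]-ring m ℓm) where
  private
    module M i = LeftModule (M i)
    module ⊕ = LeftModule (⨁ M)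

  -- For k = 1 this is σ. General k is needed because the weights q^(i j) of the twisted product,
  -- for fixed i, sum over j to the twist by i of the element a′.
  ⨁-twist : ℕ → LeftModuleHom (⨁ M) (⨁ M)
  ⨁-twist k = mkHom
    (λ u → record
      { component = λ i → M._*ₗ_ i (q^ (k ℕ.* i)) (component u i) ; bound = bound u
      ; vanishes = λ {i} l → M.≈ᴹ-trans i (M.*ₗ-congˡ i (vanishes u l)) (M.*ₗ-zeroʳ i _) })
    (λ e i → M.*ₗ-congˡ i (e i))
    (λ u v i → M.*ₗ-distribˡ i _ _ _)
    (λ p u i → M.≈ᴹ-trans i (M.≈ᴹ-sym i (M.*ₗ-assoc i _ p _))
      (M.≈ᴹ-trans i (M.*ₗ-congʳ i (ℤ[q].*-comm (q^ (k ℕ.* i)) p)) (M.*ₗ-assoc i p _ _)))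

  ⨁-decompose-twist : ∀ k u → LeftModuleHom.⟦_⟧ (⨁-twist k) u ⊕.≈ᴹ
    sum ⊕.+ᴹ-rawMonoid {bound u} (λ i → (q^ (k ℕ.* toℕ i)) ⊕.*ₗ ι M (toℕ i) (component u (toℕ i)))
  ⨁-decompose-twist k u i = M.≈ᴹ-trans i (decompose M twisted i)
    (MonoidSum.sum-cong-≋ ⊕.+ᴹ-commutativeMonoid {bound u} (λ j → Hom.*ₗ-homo (ι-hom M (toℕ j)) _ (component u (toℕ j))) i)
    where twisted = LeftModuleHom.⟦_⟧ (⨁-twist k) u

  ⨁-twist-ι : ∀ k n u → LeftModuleHom.⟦_⟧ (⨁-twist k) (ι M n u) ⊕.≈ᴹ (q^ (k ℕ.* n)) ⊕.*ₗ ι M n u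
  ⨁-twist-ι k n u i with n ℕ.≟ i
  ... | yes ≡.refl = M.≈ᴹ-refl i
  ... | no _       = M.≈ᴹ-trans i (M.*ₗ-zeroʳ i _) (M.≈ᴹ-sym i (M.*ₗ-zeroʳ i _))


-- Polynomial identities for q-numbers

0·ₚ : ∀ f → 0ℤ ·ₚ f ≈ₚ []
0·ₚ f = ⟪ zero-coeff f ⟫
  where
  zero-coeff : ∀ f i → coeff (0ℤ ·ₚ f) i ≡ 0ℤ
  zero-coeff []      i       = ≡.refl
  zero-coeff (c ∷ f) zero    = ℤ.*-zeroˡ c
  zero-coeff (c ∷ f) (suc i) = zero-coeff f i

∷-cong : ∀ {c f g} → f ≈ₚ g → c ∷ f ≈ₚ c ∷ g
∷-cong e = ⟪ (λ { zero → ≡.refl ; (suc i) → at e i }) ⟫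

·ₚ-const : ∀ c f → c ·ₚ f ≈ₚ const c *ₚ f
·ₚ-const c f = ℤ[q].sym (ℤ[q].trans (ℤ[q].+-congˡ {x = c ·ₚ f} (RingHom.0#-homo constants)) (ℤ[q].+-identityʳ _))

q*ₚ : ∀ f → (q^ 1) *ₚ f ≈ₚ 0ℤ ∷ f
q*ₚ f = ℤ[q].+-cong (0·ₚ f) (∷-cong (ℤ[q].*-identityˡ f))

-- The recursion that the Leibniz rule for ∂ produces on powers of β.
[suc]q : ∀ n → [ suc n ]q ≈ₚ const 1ℤ +ₚ (q^ 1) *ₚ [ n ]q
[suc]q n = ℤ[q].+-congˡ {x = const 1ℤ} (ℤ[q].sym (q*ₚ [ n ]q))

-- Skew derivations

-- Equality in ⨁ unfolds to a function type that does not determine the elements compared, so the computation with ∂ is done over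
-- an abstract module H; piece u i stands for the component of u of degree i, inside H.
record ConnectedGradedAlgebra (R : CommutativeRing r ℓr) (Hₙ : ℕ → LeftModule (CommutativeRing.ring R) m ℓm)
                              (H : LeftModule (CommutativeRing.ring R) a ℓ) : Set (r ⊔ ℓr ⊔ m ⊔ ℓm ⊔ a ⊔ ℓ ⊔ lsuc ℓr) where
  private
    module R = CommutativeRing R
    module Hₙ n = LeftModule (Hₙ n)
    module H = LeftModule H
  infixl 7 _∗_
  field
    ιHom      : ∀ n → LeftModuleHom (Hₙ n) H
    induction : (P : H.Carrierᴹ → Set ℓr) → (∀ {u v} → u H.≈ᴹ v → P u → P v) → P H.0ᴹ →
                (∀ {u v} → P u → P v → P (u H.+ᴹ v)) → (∀ n x → P (LeftModuleHom.⟦_⟧ (ιHom n) x)) → ∀ u → P u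
    length    : H.Carrierᴹ → ℕ
    piece     : H.Carrierᴹ → ℕ → H.Carrierᴹ
    pieces    : ∀ u → u H.≈ᴹ sum H.+ᴹ-rawMonoid {length u} (λ i → piece u (toℕ i))

    qpow         : ℕ → R.Carrier
    qpow-0       : qpow 0 R.≈ R.1#
    twist        : ℕ → LeftModuleHom H H
    twist-pieces : ∀ k u → LeftModuleHom.⟦_⟧ (twist k) u H.≈ᴹ
                   sum H.+ᴹ-rawMonoid {length u} (λ i → qpow (k ℕ.* toℕ i) H.*ₗ piece u (toℕ i))
    twist-ι      : ∀ k n x → LeftModuleHom.⟦_⟧ (twist k) (LeftModuleHom.⟦_⟧ (ιHom n) x) H.≈ᴹ
                   qpow (k ℕ.* n) H.*ₗ LeftModuleHom.⟦_⟧ (ιHom n) x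

    _∗_        : Op₂ H.Carrierᴹ
    ∗-cong     : ∀ {u u′ v v′} → u H.≈ᴹ u′ → v H.≈ᴹ v′ → (u ∗ v) H.≈ᴹ (u′ ∗ v′)
    ∗-distribˡ : ∀ u v w → (u ∗ (v H.+ᴹ w)) H.≈ᴹ ((u ∗ v) H.+ᴹ (u ∗ w))
    ∗-distribʳ : ∀ u v w → ((v H.+ᴹ w) ∗ u) H.≈ᴹ ((v ∗ u) H.+ᴹ (w ∗ u))
    ∗-scalarˡ  : ∀ p u v → ((p H.*ₗ u) ∗ v) H.≈ᴹ (p H.*ₗ (u ∗ v))
    ∗-scalarʳ  : ∀ p u v → (u ∗ (p H.*ₗ v)) H.≈ᴹ (p H.*ₗ (u ∗ v))
    ∗-graded   : ∀ k l u v → ∃[ w ] (LeftModuleHom.⟦_⟧ (ιHom k) u ∗ LeftModuleHom.⟦_⟧ (ιHom l) v) H.≈ᴹ LeftModuleHom.⟦_⟧ (ιHom (k ℕ.+ l)) w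
    one        : Hₙ.Carrierᴹ 0
    identityˡ  : ∀ u → (LeftModuleHom.⟦_⟧ (ιHom 0) one ∗ u) H.≈ᴹ u
    identityʳ  : ∀ u → (u ∗ LeftModuleHom.⟦_⟧ (ιHom 0) one) H.≈ᴹ u
    connected  : ∀ x → ∃[ p ] Hₙ._≈ᴹ_ 0 x (Hₙ._*ₗ_ 0 p one)

    δHom    : ℕ → LeftModuleHom H (self R)
    δ-ι-≢   : ∀ {n i} x → n ≢ i → LeftModuleHom.⟦_⟧ (δHom i) (LeftModuleHom.⟦_⟧ (ιHom n) x) R.≈ R.0#
    δ-twist : ∀ k i u → LeftModuleHom.⟦_⟧ (δHom i) (LeftModuleHom.⟦_⟧ (twist k) u) R.≈ qpow (k ℕ.* i) R.* LeftModuleHom.⟦_⟧ (δHom i) u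
    δ-one   : LeftModuleHom.⟦_⟧ (δHom 0) (LeftModuleHom.⟦_⟧ (ιHom 0) one) R.≈ R.1#

module Derivation {R : CommutativeRing r ℓr} {Hₙ : ℕ → LeftModule (CommutativeRing.ring R) m ℓm}
                  {H : LeftModule (CommutativeRing.ring R) a ℓ} (G : ConnectedGradedAlgebra R Hₙ H) where
  open ConnectedGradedAlgebra G
  private
    module R = CommutativeRing R
    module H = LeftModule H
    module HS = MonoidSum H.+ᴹ-commutativeMonoid
    module RC = CommutativeSemigroupProperties (CommutativeRing.*-commutativeSemigroup R)
    HH : LeftModule R.ring _ _
    HH = tensor (commutativeBimodule R H) H
    module HH = LeftModule HH
    module ι n = Hom (ιHom n)
    module δ n = Hom (δHom n)
    module twist k = Hom (twist k)

  𝟙 : H.Carrierᴹ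
  𝟙 = ι.⟦_⟧ 0 one

  private
    ιᴴ : ∀ n → LeftModule.Carrierᴹ (Hₙ n) → H.Carrierᴹ
    ιᴴ n = ι.⟦_⟧ n
    δ : ℕ → H.Carrierᴹ → R.Carrier
    δ n = δ.⟦_⟧ n

    _∗ʰ : H.Carrierᴹ → LeftModuleHom H H
    u ∗ʰ = mkHom (u ∗_) (∗-cong H.≈ᴹ-refl) (∗-distribˡ u) (λ p v → ∗-scalarʳ p u v)

    ∗ʰ_ : H.Carrierᴹ → LeftModuleHom H H
    ∗ʰ v = mkHom (_∗ v) (λ e → ∗-cong e H.≈ᴹ-refl) (∗-distribʳ v) (λ p u → ∗-scalarˡ p u v)

  -- Connectedness makes a degree 0 element some multiple of 𝟙; since δ₀ is 1 on 𝟙, it reads off the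
  -- coefficient.
  scalar-part : ∀ x → ιᴴ 0 x H.≈ᴹ δ 0 (ιᴴ 0 x) H.*ₗ 𝟙
  scalar-part x = H.≈ᴹ-trans multiple (H.*ₗ-congʳ (R.sym value))
    where
    c = proj₁ (connected x)
    multiple : ιᴴ 0 x H.≈ᴹ c H.*ₗ 𝟙
    multiple = H.≈ᴹ-trans (ι.⟦⟧-cong 0 (proj₂ (connected x))) (ι.*ₗ-homo 0 c one)
    value : δ 0 (ιᴴ 0 x) R.≈ c
    value = R.trans (δ.⟦⟧-cong 0 multiple) (R.trans (δ.*ₗ-homo 0 c 𝟙) (R.trans (R.*-congˡ δ-one) (R.*-identityʳ c)))

  -- Degree 1 of a product receives only the bidegrees (1, 0) and (0, 1), where one factor is a
  -- multiple of 𝟙. Bilinearity, the grading and the unit therefore determine the value.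
  δ₁-∗ : ∀ u v → δ 1 (u ∗ v) R.≈ δ 1 u R.* δ 0 v R.+ δ 0 u R.* δ 1 v
  δ₁-∗ = λ u v → induction (λ u → δ 1 (u ∗ v) R.≈ δ 1 u R.* δ 0 v R.+ δ 0 u R.* δ 1 v)
      (λ e q → R.trans (δ.⟦⟧-cong 1 (∗-cong (H.≈ᴹ-sym e) H.≈ᴹ-refl)) (R.trans q
        (R.+-cong (R.*-congʳ (δ.⟦⟧-cong 1 e)) (R.*-congʳ (δ.⟦⟧-cong 0 e)))))
      (R.trans (R.trans (δ.⟦⟧-cong 1 (Hom.0ᴹ-homo (∗ʰ v))) (δ.0ᴹ-homo 1))
        (R.sym (both-zero (R.trans (R.*-congʳ (δ.0ᴹ-homo 1)) (R.zeroˡ _)) (R.trans (R.*-congʳ (δ.0ᴹ-homo 0)) (R.zeroˡ _)))))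
      (λ {u} {u′} q q′ → begin
        δ 1 ((u H.+ᴹ u′) ∗ v)                                         ≈⟨ R.trans (δ.⟦⟧-cong 1 (∗-distribʳ v u u′)) (δ.+ᴹ-homo 1 _ _) ⟩
        δ 1 (u ∗ v) R.+ δ 1 (u′ ∗ v)                                  ≈⟨ R.+-cong q q′ ⟩
        (δ 1 u R.* δ 0 v R.+ δ 0 u R.* δ 1 v) R.+ (δ 1 u′ R.* δ 0 v R.+ δ 0 u′ R.* δ 1 v)
                                                                      ≈⟨ RA.interchange _ _ _ _ ⟩
        (δ 1 u R.* δ 0 v R.+ δ 1 u′ R.* δ 0 v) R.+ (δ 0 u R.* δ 1 v R.+ δ 0 u′ R.* δ 1 v)
                                                                      ≈⟨ R.+-cong (R.distribʳ _ _ _) (R.distribʳ _ _ _) ⟨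
        (δ 1 u R.+ δ 1 u′) R.* δ 0 v R.+ (δ 0 u R.+ δ 0 u′) R.* δ 1 v ≈⟨ R.+-cong (R.*-congʳ (δ.+ᴹ-homo 1 u u′)) (R.*-congʳ (δ.+ᴹ-homo 0 u u′)) ⟨
        δ 1 (u H.+ᴹ u′) R.* δ 0 v R.+ δ 0 (u H.+ᴹ u′) R.* δ 1 v       ∎)
      (λ { zero x → degree-zeroˡ x v ; (suc k) x → positive-degree k x v })
      u
    where
    open SetoidReasoning R.setoid
    module RA = CommutativeSemigroupProperties (CommutativeMonoid.commutativeSemigroup R.+-commutativeMonoid)

    both-zero : ∀ {s t} → s R.≈ R.0# → t R.≈ R.0# → s R.+ t R.≈ R.0#
    both-zero e e′ = R.trans (R.+-cong e e′) (R.+-identityˡ R.0#)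

    degree-zeroˡ : ∀ x v → δ 1 (ιᴴ 0 x ∗ v) R.≈ δ 1 (ιᴴ 0 x) R.* δ 0 v R.+ δ 0 (ιᴴ 0 x) R.* δ 1 v
    degree-zeroˡ x v = begin
      δ 1 (ιᴴ 0 x ∗ v)                                       ≈⟨ δ.⟦⟧-cong 1 (∗-cong (scalar-part x) H.≈ᴹ-refl) ⟩
      δ 1 ((δ 0 (ιᴴ 0 x) H.*ₗ 𝟙) ∗ v)                        ≈⟨ δ.⟦⟧-cong 1 (H.≈ᴹ-trans (∗-scalarˡ _ 𝟙 v) (H.*ₗ-congˡ (identityˡ v))) ⟩
      δ 1 (δ 0 (ιᴴ 0 x) H.*ₗ v)                              ≈⟨ δ.*ₗ-homo 1 _ v ⟩
      δ 0 (ιᴴ 0 x) R.* δ 1 v                                 ≈⟨ R.+-identityˡ _ ⟨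
      R.0# R.+ δ 0 (ιᴴ 0 x) R.* δ 1 v                        ≈⟨ R.+-congʳ (R.trans (R.*-congʳ (δ-ι-≢ x λ ())) (R.zeroˡ _)) ⟨
      δ 1 (ιᴴ 0 x) R.* δ 0 v R.+ δ 0 (ιᴴ 0 x) R.* δ 1 v       ∎

    positive-degree : ∀ k x v → δ 1 (ιᴴ (suc k) x ∗ v) R.≈ δ 1 (ιᴴ (suc k) x) R.* δ 0 v R.+ δ 0 (ιᴴ (suc k) x) R.* δ 1 v
    positive-degree k x v = R.trans (first-term v) (R.sym (R.trans (R.+-congˡ (R.trans (R.*-congʳ (δ-ι-≢ x λ ())) (R.zeroˡ _))) (R.+-identityʳ _)))
      where
      u = ιᴴ (suc k) x
      first-term : ∀ v → δ 1 (u ∗ v) R.≈ δ 1 u R.* δ 0 v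
      first-term = induction (λ v → δ 1 (u ∗ v) R.≈ δ 1 u R.* δ 0 v)
        (λ e q → R.trans (δ.⟦⟧-cong 1 (∗-cong H.≈ᴹ-refl (H.≈ᴹ-sym e))) (R.trans q (R.*-congˡ (δ.⟦⟧-cong 0 e))))
        (R.trans (R.trans (δ.⟦⟧-cong 1 (Hom.0ᴹ-homo (u ∗ʰ))) (δ.0ᴹ-homo 1)) (R.sym (R.trans (R.*-congˡ (δ.0ᴹ-homo 0)) (R.zeroʳ _))))
        (λ {v} {v′} q q′ → R.trans (R.trans (δ.⟦⟧-cong 1 (∗-distribˡ u v v′)) (δ.+ᴹ-homo 1 _ _))
          (R.trans (R.+-cong q q′) (R.trans (R.sym (R.distribˡ _ _ _)) (R.*-congˡ (R.sym (δ.+ᴹ-homo 0 v v′))))))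
        λ where
          zero y → begin
            δ 1 (u ∗ ιᴴ 0 y)                  ≈⟨ δ.⟦⟧-cong 1 (∗-cong H.≈ᴹ-refl (scalar-part y)) ⟩
            δ 1 (u ∗ (δ 0 (ιᴴ 0 y) H.*ₗ 𝟙))   ≈⟨ δ.⟦⟧-cong 1 (H.≈ᴹ-trans (∗-scalarʳ _ u 𝟙) (H.*ₗ-congˡ (identityʳ u))) ⟩
            δ 1 (δ 0 (ιᴴ 0 y) H.*ₗ u)         ≈⟨ δ.*ₗ-homo 1 _ u ⟩
            δ 0 (ιᴴ 0 y) R.* δ 1 u            ≈⟨ R.*-comm _ _ ⟩
            δ 1 u R.* δ 0 (ιᴴ 0 y)            ∎
          -- Both factors have positive degree, so the product lives in degree at least 2 and both
          -- sides vanish.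
          (suc l) y →
            let (w , e) = ∗-graded (suc k) (suc l) x y in
            R.trans (R.trans (δ.⟦⟧-cong 1 e) (δ-ι-≢ w λ e → ℕ.0≢1+n (≡.trans (≡.sym (ℕ.suc-injective e)) (ℕ.+-suc k l))))
              (R.sym (R.trans (R.*-congˡ (δ-ι-≢ y λ ())) (R.zeroʳ _)))

  -- The product twistedProduct, with the homogeneous components written as pieces.
  twistedProduct′ : Op₂ HH.Carrierᴹ
  twistedProduct′ t t′ =
    extend HH.+ᴹ-abelianGroup (λ (a , b) →
      extend HH.+ᴹ-abelianGroup (λ (a′ , b′) →
        sum HH.+ᴹ-rawMonoid {length b} (λ i →
          sum HH.+ᴹ-rawMonoid {length a′} (λ j →
            qpow (toℕ i ℕ.* toℕ j) HH.*ₗ gen (a ∗ piece a′ (toℕ j) , piece b (toℕ i) ∗ b′)))) t′) t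

  contractBy : ℕ → LeftModuleHom HH H
  contractBy k = contract R (δHom k)

  private
    module C k = Hom (contractBy k)
    C : ℕ → HH.Carrierᴹ → H.Carrierᴹ
    C k = C.⟦_⟧ k
    σ : H.Carrierᴹ → H.Carrierᴹ
    σ = twist.⟦_⟧ 1

  -- Fix the degree i of b: the sum over j is a times the twist of a′ by i. Applying `δ₁-∗` gives δ₁
  -- a δ₀ a′ + qⁱ δ₀ a δ₁ a′. Summing over i then recovers b from the first term and σ b from the
  -- second, where qⁱ weights each piece of b.
  contract-twistedProduct : ∀ t t′ → C 1 (twistedProduct′ t t′) H.≈ᴹ (C 1 t ∗ C 0 t′) H.+ᴹ (σ (C 0 t) ∗ C 1 t′)
  contract-twistedProduct t t′ = begin
    C 1 (twistedProduct′ t t′)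
      ≈⟨ extend-homo (contractBy 1) _ t ⟩
    extend H.+ᴹ-abelianGroup _ t
      ≈⟨ extend-≈ H.+ᴹ-abelianGroup (λ (a , b) → left a b) t ⟩
    extend H.+ᴹ-abelianGroup (λ (a , b) → ((δ 1 a H.*ₗ b) ∗ C 0 t′) H.+ᴹ (σ (δ 0 a H.*ₗ b) ∗ C 1 t′)) t
      ≈⟨ extend-+ H.+ᴹ-abelianGroup t ⟩
    extend H.+ᴹ-abelianGroup (λ (a , b) → (δ 1 a H.*ₗ b) ∗ C 0 t′) t H.+ᴹ extend H.+ᴹ-abelianGroup (λ (a , b) → σ (δ 0 a H.*ₗ b) ∗ C 1 t′) t
      ≈⟨ H.+ᴹ-cong (extend-homo (∗ʰ C 0 t′) _ t)
           (H.≈ᴹ-trans (∗-cong (extend-homo (twist 1) _ t) H.≈ᴹ-refl) (extend-homo (∗ʰ C 1 t′) _ t)) ⟨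
    (C 1 t ∗ C 0 t′) H.+ᴹ (σ (C 0 t) ∗ C 1 t′) ∎
    where
    open SetoidReasoning H.≈ᴹ-setoid
    term : H.Carrierᴹ → H.Carrierᴹ → H.Carrierᴹ × H.Carrierᴹ → HH.Carrierᴹ
    term a b (a′ , b′) = sum HH.+ᴹ-rawMonoid {length b} (λ i →
          sum HH.+ᴹ-rawMonoid {length a′} (λ j →
            qpow (toℕ i ℕ.* toℕ j) HH.*ₗ gen (a ∗ piece a′ (toℕ j) , piece b (toℕ i) ∗ b′)))

    inner : ∀ a a′ i y → C 1 (sum HH.+ᴹ-rawMonoid {length a′} (λ j → qpow (i ℕ.* toℕ j) HH.*ₗ gen (a ∗ piece a′ (toℕ j) , y)))
                         H.≈ᴹ (δ 1 a R.* δ 0 a′ R.+ qpow i R.* (δ 0 a R.* δ 1 a′)) H.*ₗ y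
    inner a a′ i y = begin
      C 1 (sum HH.+ᴹ-rawMonoid {length a′} (λ j → qpow (i ℕ.* toℕ j) HH.*ₗ gen (a ∗ piece a′ (toℕ j) , y)))
        ≈⟨ Hom.sum-homo (contractBy 1) {length a′} _ ⟩
      sum H.+ᴹ-rawMonoid {length a′} (λ j → δ 1 (qpow (i ℕ.* toℕ j) H.*ₗ (a ∗ piece a′ (toℕ j))) H.*ₗ y)
        ≈⟨ HS.sum-cong-≋ {length a′} (λ j → H.*ₗ-congʳ (δ.⟦⟧-cong 1 (∗-scalarʳ (qpow (i ℕ.* toℕ j)) a (piece a′ (toℕ j))))) ⟨
      sum H.+ᴹ-rawMonoid {length a′} (λ j → δ 1 (a ∗ (qpow (i ℕ.* toℕ j) H.*ₗ piece a′ (toℕ j))) H.*ₗ y)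
        ≈⟨ Hom.sum-homo functional {length a′} (λ j → qpow (i ℕ.* toℕ j) H.*ₗ piece a′ (toℕ j)) ⟨
      δ 1 (a ∗ sum H.+ᴹ-rawMonoid {length a′} (λ j → qpow (i ℕ.* toℕ j) H.*ₗ piece a′ (toℕ j))) H.*ₗ y
        ≈⟨ H.*ₗ-congʳ (δ.⟦⟧-cong 1 (∗-cong H.≈ᴹ-refl (twist-pieces i a′))) ⟨
      δ 1 (a ∗ twist.⟦_⟧ i a′) H.*ₗ y
        -- The twist by i multiplies degree 0 by q^(i·0) = 1 and degree 1 by q^(i·1) = qⁱ.
        ≈⟨ H.*ₗ-congʳ (R.trans (δ₁-∗ a _) (R.+-cong
             (R.*-congˡ (R.trans (δ-twist i 0 a′) (R.trans (R.*-congʳ (R.trans (R.reflexive (≡.cong qpow (ℕ.*-zeroʳ i))) qpow-0)) (R.*-identityˡ _))))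
             (R.trans (R.*-congˡ (R.trans (δ-twist i 1 a′) (R.*-congʳ (R.reflexive (≡.cong qpow (ℕ.*-identityʳ i)))))) (RC.x∙yz≈y∙xz _ _ _)))) ⟩
      (δ 1 a R.* δ 0 a′ R.+ qpow i R.* (δ 0 a R.* δ 1 a′)) H.*ₗ y ∎
      where
      functional : LeftModuleHom H H
      functional = mkHom (λ u → δ 1 (a ∗ u) H.*ₗ y) (λ e → H.*ₗ-congʳ (δ.⟦⟧-cong 1 (∗-cong H.≈ᴹ-refl e)))
        (λ u v → H.≈ᴹ-trans (H.*ₗ-congʳ (R.trans (δ.⟦⟧-cong 1 (∗-distribˡ a u v)) (δ.+ᴹ-homo 1 _ _))) (H.*ₗ-distribʳ y _ _))
        (λ p u → H.≈ᴹ-trans (H.*ₗ-congʳ (R.trans (δ.⟦⟧-cong 1 (∗-scalarʳ p a u)) (δ.*ₗ-homo 1 p _))) (H.*ₗ-assoc p _ y))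

    pointwise : ∀ a b a′ b′ → C 1 (term a b (a′ , b′)) H.≈ᴹ
                ((δ 1 a H.*ₗ b) ∗ (δ 0 a′ H.*ₗ b′)) H.+ᴹ (σ (δ 0 a H.*ₗ b) ∗ (δ 1 a′ H.*ₗ b′))
    pointwise a b a′ b′ = begin
      C 1 (term a b (a′ , b′))
        ≈⟨ Hom.sum-homo (contractBy 1) {length b} _ ⟩
      sum H.+ᴹ-rawMonoid {length b} (λ i → C 1 (sum HH.+ᴹ-rawMonoid {length a′} (λ j →
            qpow (toℕ i ℕ.* toℕ j) HH.*ₗ gen (a ∗ piece a′ (toℕ j) , piece b (toℕ i) ∗ b′))))
        ≈⟨ HS.sum-cong-≋ {length b} (λ i → inner a a′ (toℕ i) (piece b (toℕ i) ∗ b′)) ⟩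
      sum H.+ᴹ-rawMonoid {length b} (λ i → (s R.+ qpow (toℕ i) R.* s′) H.*ₗ (piece b (toℕ i) ∗ b′))
        ≈⟨ HS.sum-cong-≋ {length b} (λ i → H.≈ᴹ-trans (H.*ₗ-distribʳ _ s _) (H.+ᴹ-congˡ (regroup (toℕ i)))) ⟩
      sum H.+ᴹ-rawMonoid {length b} (λ i → s H.*ₗ (piece b (toℕ i) ∗ b′) H.+ᴹ s′ H.*ₗ ((qpow (1 ℕ.* toℕ i) H.*ₗ piece b (toℕ i)) ∗ b′))
        ≈⟨ HS.∑-distrib-+ {length b} (λ i → s H.*ₗ (piece b (toℕ i) ∗ b′)) _ ⟩
      sum H.+ᴹ-rawMonoid {length b} (λ i → s H.*ₗ (piece b (toℕ i) ∗ b′)) H.+ᴹ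
      sum H.+ᴹ-rawMonoid {length b} (λ i → s′ H.*ₗ ((qpow (1 ℕ.* toℕ i) H.*ₗ piece b (toℕ i)) ∗ b′))
        ≈⟨ H.+ᴹ-cong (Hom.sum-homo (scaled s) {length b} (λ i → piece b (toℕ i))) (Hom.sum-homo (scaled s′) {length b} (λ i → qpow (1 ℕ.* toℕ i) H.*ₗ piece b (toℕ i))) ⟨
      s H.*ₗ (sum H.+ᴹ-rawMonoid {length b} (λ i → piece b (toℕ i)) ∗ b′) H.+ᴹ
      s′ H.*ₗ (sum H.+ᴹ-rawMonoid {length b} (λ i → qpow (1 ℕ.* toℕ i) H.*ₗ piece b (toℕ i)) ∗ b′)
        ≈⟨ H.+ᴹ-cong (H.*ₗ-congˡ (∗-cong (pieces b) H.≈ᴹ-refl)) (H.*ₗ-congˡ (∗-cong (twist-pieces 1 b) H.≈ᴹ-refl)) ⟨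
      s H.*ₗ (b ∗ b′) H.+ᴹ s′ H.*ₗ (σ b ∗ b′)
        ≈⟨ H.+ᴹ-cong (bilinear (δ 1 a) (δ 0 a′) b b′)
             (H.≈ᴹ-trans (∗-cong (twist.*ₗ-homo 1 (δ 0 a) b) H.≈ᴹ-refl) (bilinear (δ 0 a) (δ 1 a′) (σ b) b′)) ⟨
      ((δ 1 a H.*ₗ b) ∗ (δ 0 a′ H.*ₗ b′)) H.+ᴹ (σ (δ 0 a H.*ₗ b) ∗ (δ 1 a′ H.*ₗ b′)) ∎
      where
      s = δ 1 a R.* δ 0 a′
      s′ = δ 0 a R.* δ 1 a′
      bilinear : ∀ c d u v → (c H.*ₗ u) ∗ (d H.*ₗ v) H.≈ᴹ (c R.* d) H.*ₗ (u ∗ v)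
      bilinear c d u v = H.≈ᴹ-trans (∗-scalarˡ c u _) (H.≈ᴹ-trans (H.*ₗ-congˡ (∗-scalarʳ d u v)) (H.≈ᴹ-sym (H.*ₗ-assoc c d _)))
      scaled : R.Carrier → LeftModuleHom H H
      scaled c = mkHom (λ u → c H.*ₗ (u ∗ b′)) (λ e → H.*ₗ-congˡ (∗-cong e H.≈ᴹ-refl))
        (λ u v → H.≈ᴹ-trans (H.*ₗ-congˡ (∗-distribʳ b′ u v)) (H.*ₗ-distribˡ c _ _))
        (λ p u → H.≈ᴹ-trans (H.*ₗ-congˡ (∗-scalarˡ p u b′)) (H.≈ᴹ-trans (H.≈ᴹ-sym (H.*ₗ-assoc c p _))
          (H.≈ᴹ-trans (H.*ₗ-congʳ (R.*-comm c p)) (H.*ₗ-assoc p c _))))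
      -- The power of q is attached to the piece of b, with exponent written `1 ℕ.* i`, to match the
      -- expansion of σ b in `twist-pieces 1`.
      regroup : ∀ i → (qpow i R.* s′) H.*ₗ (piece b i ∗ b′) H.≈ᴹ s′ H.*ₗ ((qpow (1 ℕ.* i) H.*ₗ piece b i) ∗ b′)
      regroup i = H.≈ᴹ-trans (H.*ₗ-congʳ (R.*-comm _ s′)) (H.≈ᴹ-trans (H.*ₗ-assoc s′ _ _) (H.*ₗ-congˡ
        (H.≈ᴹ-trans (H.≈ᴹ-sym (∗-scalarˡ (qpow i) _ b′)) (∗-cong (H.*ₗ-congʳ (R.reflexive (≡.cong qpow (≡.sym (ℕ.*-identityˡ i))))) H.≈ᴹ-refl))))

    left : ∀ a b → C 1 (extend HH.+ᴹ-abelianGroup (term a b) t′) H.≈ᴹ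
                   ((δ 1 a H.*ₗ b) ∗ C 0 t′) H.+ᴹ (σ (δ 0 a H.*ₗ b) ∗ C 1 t′)
    left a b = begin
      C 1 (extend HH.+ᴹ-abelianGroup (term a b) t′)
        ≈⟨ extend-homo (contractBy 1) (term a b) t′ ⟩
      extend H.+ᴹ-abelianGroup (C 1 ∘ term a b) t′
        ≈⟨ extend-≈ H.+ᴹ-abelianGroup (λ (a′ , b′) → pointwise a b a′ b′) t′ ⟩
      extend H.+ᴹ-abelianGroup (λ (a′ , b′) → ((δ 1 a H.*ₗ b) ∗ (δ 0 a′ H.*ₗ b′)) H.+ᴹ (σ (δ 0 a H.*ₗ b) ∗ (δ 1 a′ H.*ₗ b′))) t′
        ≈⟨ extend-+ H.+ᴹ-abelianGroup t′ ⟩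
      extend H.+ᴹ-abelianGroup (λ (a′ , b′) → (δ 1 a H.*ₗ b) ∗ (δ 0 a′ H.*ₗ b′)) t′ H.+ᴹ
      extend H.+ᴹ-abelianGroup (λ (a′ , b′) → σ (δ 0 a H.*ₗ b) ∗ (δ 1 a′ H.*ₗ b′)) t′
        ≈⟨ H.+ᴹ-cong (extend-homo ((δ 1 a H.*ₗ b) ∗ʰ) _ t′) (extend-homo (σ (δ 0 a H.*ₗ b) ∗ʰ) _ t′) ⟨
      ((δ 1 a H.*ₗ b) ∗ C 0 t′) H.+ᴹ (σ (δ 0 a H.*ₗ b) ∗ C 1 t′) ∎

  -- The data on which ∂ depends. The field `δ-Δ` is the trace left by restriction to A₁ ⊗ Aₗ, which
  -- preserves dimension.
  record CompatibleCoproduct : Set (r ⊔ ℓr ⊔ m ⊔ ℓm ⊔ a ⊔ ℓ) where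
    field
      ΔHom : LeftModuleHom H HH
    module Δ = Hom ΔHom
    field
      Δ-∗  : ∀ u v → Δ.⟦ u ∗ v ⟧ HH.≈ᴹ twistedProduct′ Δ.⟦ u ⟧ Δ.⟦ v ⟧
      Δ-𝟙  : Δ.⟦ 𝟙 ⟧ HH.≈ᴹ gen (𝟙 , 𝟙)
      Δ-ι₁ : ∀ x → Span HH (λ t → ∃[ k ] ∃[ l ] k ℕ.+ l ≡ 1 × Σ (LeftModule.Carrierᴹ (Hₙ k)) λ u →
               Σ (LeftModule.Carrierᴹ (Hₙ l)) λ v → t ≡ gen (LeftModuleHom.⟦_⟧ (ιHom k) u , LeftModuleHom.⟦_⟧ (ιHom l) v))
               Δ.⟦ ιᴴ 1 x ⟧
      εHom : LeftModuleHom H (self R)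
    module ε = Hom εHom
    field
      ε-𝟙    : ε.⟦ 𝟙 ⟧ R.≈ R.1#
      ε-ι    : ∀ n x → ε.⟦ ιᴴ (suc n) x ⟧ R.≈ R.0#
      ε-left : ∀ u → extend H.+ᴹ-abelianGroup (λ (a , b) → ε.⟦ a ⟧ H.*ₗ b) Δ.⟦ u ⟧ H.≈ᴹ u
      δ-Δ    : ∀ l u → δ l (C 1 Δ.⟦ u ⟧) R.≈ δ (suc l) u

  module _ (coproduct : CompatibleCoproduct) where
    open CompatibleCoproduct coproduct

    -- Both functionals vanish in positive degree and equal 1 on 𝟙, which spans degree 0. The counit
    -- axiom thereby becomes a statement about contraction with δ₀, namely `C₀-Δ`.
    ε≈δ₀ : ∀ u → ε.⟦ u ⟧ R.≈ δ 0 u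
    ε≈δ₀ = induction (λ u → ε.⟦ u ⟧ R.≈ δ 0 u)
      (λ e q → R.trans (ε.⟦⟧-cong (H.≈ᴹ-sym e)) (R.trans q (δ.⟦⟧-cong 0 e)))
      (R.trans ε.0ᴹ-homo (R.sym (δ.0ᴹ-homo 0)))
      (λ q q′ → R.trans (ε.+ᴹ-homo _ _) (R.trans (R.+-cong q q′) (R.sym (δ.+ᴹ-homo 0 _ _))))
      λ where
        zero x → R.trans (ε.⟦⟧-cong (scalar-part x)) (R.trans (ε.*ₗ-homo _ 𝟙) (R.trans (R.*-congˡ ε-𝟙) (R.*-identityʳ _)))
        (suc n) x → R.trans (ε-ι n x) (R.sym (δ-ι-≢ x λ ()))

    ∂ : H.Carrierᴹ → H.Carrierᴹ
    ∂ u = C 1 Δ.⟦ u ⟧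

    private
      C₀-Δ : ∀ u → C 0 Δ.⟦ u ⟧ H.≈ᴹ u
      C₀-Δ u = H.≈ᴹ-trans (extend-≈ H.+ᴹ-abelianGroup (λ (a , b) → H.*ₗ-congʳ (R.sym (ε≈δ₀ a))) Δ.⟦ u ⟧) (ε-left u)

    -- The contractions by δ₀ in `contract-twistedProduct` disappear by the counit axiom.
    ∂-∗ : ∀ u v → ∂ (u ∗ v) H.≈ᴹ (∂ u ∗ v) H.+ᴹ (σ u ∗ ∂ v)
    ∂-∗ u v = H.≈ᴹ-trans (C.⟦⟧-cong 1 (Δ-∗ u v)) (H.≈ᴹ-trans (contract-twistedProduct Δ.⟦ u ⟧ Δ.⟦ v ⟧)
      (H.+ᴹ-cong (∗-cong H.≈ᴹ-refl (C₀-Δ v)) (∗-cong (twist.⟦⟧-cong 1 (C₀-Δ u)) H.≈ᴹ-refl)))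

    ∂-𝟙 : ∂ 𝟙 H.≈ᴹ H.0ᴹ
    ∂-𝟙 = H.≈ᴹ-trans (C.⟦⟧-cong 1 Δ-𝟙) (H.≈ᴹ-trans (H.*ₗ-congʳ (δ-ι-≢ one λ ())) (H.*ₗ-zeroˡ 𝟙))

    -- Δ maps degree 1 into bidegrees (0, 1) and (1, 0). Contraction with δ₁ kills the first and
    -- leaves degree 0 from the second, that is, a multiple of 𝟙; its coefficient is found by
    -- applying δ₀ and `δ-Δ`.
    ∂-ι₁ : ∀ x → ∂ (ιᴴ 1 x) H.≈ᴹ δ 1 (ιᴴ 1 x) H.*ₗ 𝟙
    ∂-ι₁ x = H.≈ᴹ-trans (scalar (Δ-ι₁ x)) (H.*ₗ-congʳ (δ-Δ 0 (ιᴴ 1 x)))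
      where
      IsScalar : H.Carrierᴹ → Set _
      IsScalar u = u H.≈ᴹ δ 0 u H.*ₗ 𝟙
      resp : ∀ {u v} → u H.≈ᴹ v → IsScalar u → IsScalar v
      resp e q = H.≈ᴹ-trans (H.≈ᴹ-sym e) (H.≈ᴹ-trans q (H.*ₗ-congʳ (δ.⟦⟧-cong 0 e)))
      multiple : ∀ c {u} → IsScalar u → IsScalar (c H.*ₗ u)
      multiple c q = H.≈ᴹ-trans (H.*ₗ-congˡ q) (H.≈ᴹ-trans (H.≈ᴹ-sym (H.*ₗ-assoc c _ 𝟙)) (H.*ₗ-congʳ (R.sym (δ.*ₗ-homo 0 c _))))
      isScalar-0 : IsScalar H.0ᴹ
      isScalar-0 = H.≈ᴹ-sym (H.≈ᴹ-trans (H.*ₗ-congʳ (δ.0ᴹ-homo 0)) (H.*ₗ-zeroˡ 𝟙))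
      pure : ∀ k l u v → k ℕ.+ l ≡ 1 → IsScalar (δ 1 (LeftModuleHom.⟦_⟧ (ιHom k) u) H.*ₗ LeftModuleHom.⟦_⟧ (ιHom l) v)
      pure zero       l       u v e = resp (H.≈ᴹ-sym (H.≈ᴹ-trans (H.*ₗ-congʳ (δ-ι-≢ u λ ())) (H.*ₗ-zeroˡ _))) isScalar-0
      pure (suc zero) zero    u v e = multiple _ (scalar-part v)
      scalar : ∀ {t} → Span HH _ t → IsScalar (C 1 t)
      scalar (incl (k , l , e , u , v , ≡.refl)) = pure k l u v e
      scalar 0-span = isScalar-0
      scalar (+-span {t} {t′} s s′) = H.≈ᴹ-trans (H.+ᴹ-cong (scalar s) (scalar s′))
        (H.≈ᴹ-trans (H.≈ᴹ-sym (H.*ₗ-distribʳ 𝟙 _ _)) (H.*ₗ-congʳ (R.sym (δ.+ᴹ-homo 0 (C 1 t) (C 1 t′)))))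
      scalar (*-span c {t} s) = resp (H.≈ᴹ-sym (C.*ₗ-homo 1 c t)) (multiple c (scalar s))
      scalar (≈-span e s) = resp (C.⟦⟧-cong 1 e) (scalar s)

    module _ (x : LeftModule.Carrierᴹ (Hₙ 1)) {power : ℕ → H.Carrierᴹ}
             (power-0 : power 0 H.≈ᴹ 𝟙) (power-suc : ∀ n → power (suc n) H.≈ᴹ ιᴴ 1 x ∗ power n)
             {qnumber : ℕ → R.Carrier} (qnumber-0 : qnumber 0 R.≈ R.0#)
             (qnumber-suc : ∀ n → qnumber (suc n) R.≈ R.1# R.+ qpow 1 R.* qnumber n) where
      private
        β = ιᴴ 1 x
        b = δ 1 β

      -- By the Leibniz rule ∂ β = b 𝟙 contributes b and σ β = q β contributes q b [n], which add up
      -- to b [n+1].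
      ∂-power : ∀ n → ∂ (power (suc n)) H.≈ᴹ (b R.* qnumber (suc n)) H.*ₗ power n
      -- Multiplying by β on the left avoids the power β^(n-1), so that n = 0 is covered: there both
      -- sides vanish because [0] = 0.
      ∗-∂-power : ∀ n → β ∗ ∂ (power n) H.≈ᴹ (b R.* qnumber n) H.*ₗ power n

      ∂-power n = begin
        ∂ (power (suc n))
          ≈⟨ C.⟦⟧-cong 1 (Δ.⟦⟧-cong (power-suc n)) ⟩
        ∂ (β ∗ power n)
          ≈⟨ ∂-∗ β (power n) ⟩
        (∂ β ∗ power n) H.+ᴹ (σ β ∗ ∂ (power n))
          ≈⟨ H.+ᴹ-cong
               (H.≈ᴹ-trans (∗-cong (∂-ι₁ x) H.≈ᴹ-refl) (H.≈ᴹ-trans (∗-scalarˡ b 𝟙 _) (H.*ₗ-congˡ (identityˡ _))))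
               (H.≈ᴹ-trans (∗-cong (twist-ι 1 1 x) H.≈ᴹ-refl) (∗-scalarˡ _ β _)) ⟩
        b H.*ₗ power n H.+ᴹ qpow 1 H.*ₗ (β ∗ ∂ (power n))
          ≈⟨ H.+ᴹ-congˡ (H.≈ᴹ-trans (H.*ₗ-congˡ (∗-∂-power n)) (H.≈ᴹ-sym (H.*ₗ-assoc _ _ _))) ⟩
        b H.*ₗ power n H.+ᴹ (qpow 1 R.* (b R.* qnumber n)) H.*ₗ power n
          ≈⟨ H.*ₗ-distribʳ (power n) b _ ⟨
        (b R.+ qpow 1 R.* (b R.* qnumber n)) H.*ₗ power n
          ≈⟨ H.*ₗ-congʳ (R.+-cong (R.sym (R.*-identityʳ b)) (RC.x∙yz≈y∙xz _ _ _)) ⟩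
        (b R.* R.1# R.+ b R.* (qpow 1 R.* qnumber n)) H.*ₗ power n
          ≈⟨ H.*ₗ-congʳ (R.trans (R.*-congˡ (qnumber-suc n)) (R.distribˡ b _ _)) ⟨
        (b R.* qnumber (suc n)) H.*ₗ power n ∎
        where open SetoidReasoning H.≈ᴹ-setoid

      ∗-∂-power zero = H.≈ᴹ-trans
        (H.≈ᴹ-trans (∗-cong H.≈ᴹ-refl (H.≈ᴹ-trans (C.⟦⟧-cong 1 (Δ.⟦⟧-cong power-0)) ∂-𝟙)) (Hom.0ᴹ-homo (β ∗ʰ)))
        (H.≈ᴹ-sym (H.≈ᴹ-trans (H.*ₗ-congʳ (R.trans (R.*-congˡ qnumber-0) (R.zeroʳ b))) (H.*ₗ-zeroˡ _)))
      ∗-∂-power (suc n) = H.≈ᴹ-trans (∗-cong H.≈ᴹ-refl (∂-power n))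
        (H.≈ᴹ-trans (∗-scalarʳ _ β (power n)) (H.*ₗ-congˡ (H.≈ᴹ-sym (power-suc n))))

      δ-power-suc : ∀ n → δ (suc n) (power (suc n)) R.≈ (b R.* qnumber (suc n)) R.* δ n (power n)
      δ-power-suc n = R.trans (R.sym (δ-Δ n (power (suc n)))) (R.trans (δ.⟦⟧-cong n (∂-power n)) (δ.*ₗ-homo n _ _))

-- Linear maps out of an extension of scalars to ℤ[q]

constant : ∀ {c d} → c ≡ d → const c ≈ₚ const d
constant e = ℤ[q].reflexive (≡.cong const e)

module _ {X : Set x} {R : FreeAb X → FreeAb X → Set r} {Y : LeftModule ℤ[q]-ring m ℓm} where
  private
    G = Ab⟨ X ∣ R ⟩
    module Y = LeftModule Y
    module Gq = LeftModule (G [q])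

  -- The elements 1 ⊗ y, for y a generator of G, generate G [q] over ℤ[q]: the polynomial in p ⊗ y
  -- is pulled out as a scalar, and sums and negatives in the second factor are split by the tensor
  -- relations.
  [q]-ext : (f g : LeftModuleHom (G [q]) Y) →
            (∀ y → LeftModuleHom.⟦_⟧ f (gen (const 1ℤ , gen y)) Y.≈ᴹ LeftModuleHom.⟦_⟧ g (gen (const 1ℤ , gen y))) →
            ∀ t → LeftModuleHom.⟦_⟧ f t Y.≈ᴹ LeftModuleHom.⟦_⟧ g t
  [q]-ext f g base = go
    where
    module f = Hom f
    module g = Hom g
    Agree : Gq.Carrierᴹ → Set _
    Agree t = f.⟦ t ⟧ Y.≈ᴹ g.⟦ t ⟧
    resp : ∀ {t u} → u Gq.≈ᴹ t → Agree t → Agree u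
    resp e q = Y.≈ᴹ-trans (f.⟦⟧-cong e) (Y.≈ᴹ-trans q (Y.≈ᴹ-sym (g.⟦⟧-cong e)))
    zero-case : Agree 0ᶠ
    zero-case = Y.≈ᴹ-trans f.0ᴹ-homo (Y.≈ᴹ-sym g.0ᴹ-homo)
    plus : ∀ {t u} → Agree t → Agree u → Agree (t +ᶠ u)
    plus q q′ = Y.≈ᴹ-trans (f.+ᴹ-homo _ _) (Y.≈ᴹ-trans (Y.+ᴹ-cong q q′) (Y.≈ᴹ-sym (g.+ᴹ-homo _ _)))
    minus : ∀ {t} → Agree t → Agree (-ᶠ t)
    minus q = Y.≈ᴹ-trans (f.-ᴹ-homo _) (Y.≈ᴹ-trans (Y.-ᴹ‿cong q) (Y.≈ᴹ-sym (g.-ᴹ-homo _)))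
    tensor-neg : ∀ p y → gen (p , -ᶠ y) Gq.≈ᴹ -ᶠ gen (p , y)
    tensor-neg p y = AbelianGroupProperties.inverseˡ-unique Gq.+ᴹ-abelianGroup _ _
      (transᶠ (symᶠ (rel (⊗-distribˡ p (-ᶠ y) y))) (transᶠ (rel (⊗-cong ℤ[q].refl (+ᶠ-invˡ y))) (tensor-zeroʳ (viaHom constants) (ℤ-module G) p)))
    pure : ∀ p y → Agree (gen (p , y))
    pure p (gen y)  = resp (rel (⊗-cong (ℤ[q].sym (ℤ[q].*-identityʳ p)) reflᶠ))
      (Y.≈ᴹ-trans (f.*ₗ-homo p (gen (const 1ℤ , gen y))) (Y.≈ᴹ-trans (Y.*ₗ-congˡ (base y)) (Y.≈ᴹ-sym (g.*ₗ-homo p (gen (const 1ℤ , gen y))))))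
    pure p 0ᶠ       = resp (tensor-zeroʳ (viaHom constants) (ℤ-module G) p) zero-case
    pure p (y +ᶠ z) = resp (rel (⊗-distribˡ p y z)) (plus (pure p y) (pure p z))
    pure p (-ᶠ y)   = resp (tensor-neg p y) (minus (pure p y))
    go : ∀ t → Agree t
    go (gen (p , y)) = pure p y
    go 0ᶠ = zero-case
    go (t +ᶠ u) = plus (go t) (go u)
    go (-ᶠ t) = minus (go t)

extend-const : {X : Set x} (f : X → ℤ) (t : FreeAb X) →
               extend ℤ[q].+-abelianGroup (const ∘ f) t ≈ₚ const (extend ℤ.+-0-abelianGroup f t)
extend-const f (gen y)  = ℤ[q].refl
extend-const f 0ᶠ       = ℤ[q].sym (RingHom.0#-homo constants)
extend-const f (t +ᶠ u) = ℤ[q].+-cong (extend-const f t) (extend-const f u)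
extend-const f (-ᶠ t)   = ℤ[q].-‿cong (extend-const f t)

-- Dimension on the Grothendieck group of a tower

module GradedDimension (em : ExcludedMiddle 0ℓ) (K : Field) (𝒯 : Towers.Tower em K) where
  open Combinations em K using (VectorSpace; Basis; basis-image; basis-unique)
  open Dimensions em K
  open Towers em K
  open Tower 𝒯
  private
    module K = Field K
    module A n = Algebra (A n)
    module Gq n = LeftModule (Gq n)
    module ℋ = LeftModule ℋ
    ℤ[q]¹ = self ℤ[q]

  -- Sends p ⊗ [M] to p dim M; it is balanced because dimension turns integer multiples of classes
  -- into integer multiples.
  dimₙ : ∀ n → LeftModuleHom (Gq n) ℤ[q]¹
  dimₙ n = mkHom (extend ℤ[q].+-abelianGroup value) (extend-cong ℤ[q].+-abelianGroup value respects) (λ _ _ → ℤ[q].refl) scalar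
    where
    value : Poly × FreeAb (FGMod (A n)) → Poly
    value (p , x) = p *ₚ const (dim₀ (A n) x)
    respects : ∀ {t u} → TensorRel (viaHom constants) (ℤ-module (G₀ (A n))) t u →
               extend ℤ[q].+-abelianGroup value t ≈ₚ extend ℤ[q].+-abelianGroup value u
    respects (⊗-cong e e′)       = ℤ[q].*-cong e (constant (dim₀-cong (A n) e′))
    respects (⊗-distribʳ p p′ x) = ℤ[q].distribʳ (const (dim₀ (A n) x)) p p′
    respects (⊗-distribˡ p x y)  = ℤ[q].distribˡ p (const (dim₀ (A n) x)) (const (dim₀ (A n) y))
    respects (⊗-balanced p c x)  = ℤ[q].trans (ℤ[q].*-assoc p (const c) (const (dim₀ (A n) x)))
      (ℤ[q].*-congˡ {p} (ℤ[q].trans (ℤ[q].sym (RingHom.*-homo constants c (dim₀ (A n) x))) (constant (≡.sym (dim₀-×ℤ (A n) c x)))))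
    scalar : ∀ p t → extend ℤ[q].+-abelianGroup value (Gq._*ₗ_ n p t) ≈ₚ p *ₚ extend ℤ[q].+-abelianGroup value t
    scalar p (gen (p′ , x)) = ℤ[q].*-assoc p p′ (const (dim₀ (A n) x))
    scalar p 0ᶠ       = ℤ[q].sym (ℤ[q].zeroʳ p)
    scalar p (t +ᶠ u) = ℤ[q].trans (ℤ[q].+-cong (scalar p t) (scalar p u)) (ℤ[q].sym (ℤ[q].distribˡ p _ _))
    scalar p (-ᶠ t)   = ℤ[q].trans (ℤ[q].-‿cong (scalar p t)) (ℤ[q].sym (*-neg ℤ[q]¹ p (extend ℤ[q].+-abelianGroup value t)))

  δHom : ℕ → LeftModuleHom ℋ ℤ[q]¹
  δHom n = dimₙ n ⊙ componentHom Gq n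

  module δ n = Hom (δHom n)

  δ : ℕ → ℋ.Carrierᴹ → Poly
  δ n = δ.⟦_⟧ n

  δ-ι : ∀ n x → δ n (ι Gq n x) ≡ LeftModuleHom.⟦_⟧ (dimₙ n) x
  δ-ι n x = ≡.cong (LeftModuleHom.⟦_⟧ (dimₙ n)) (component-ι Gq n x)

  δ-ι-const : ∀ n x → δ n (q^ 0 ∙[ n ] x) ≈ₚ const (dim₀ (A n) x)
  δ-ι-const n x = ℤ[q].trans (ℤ[q].reflexive (δ-ι n _)) (ℤ[q].*-identityˡ (const (dim₀ (A n) x)))

  δ-ι-≢ : ∀ {n i} x → n ≢ i → δ i (ι Gq n x) ≈ₚ []
  δ-ι-≢ {n} {i} x n≢i = ℤ[q].reflexive (≡.cong (LeftModuleHom.⟦_⟧ (dimₙ i)) (component-ι-≢ Gq x n≢i))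

  -- Reduces identities between linear maps to classes of modules, the only elements on which the
  -- coproduct is prescribed.
  ℋ-ext : {Y : LeftModule ℤ[q]-ring m ℓm} (f g : LeftModuleHom ℋ Y) →
          (∀ n M → LeftModule._≈ᴹ_ Y (LeftModuleHom.⟦_⟧ f (classOf n M)) (LeftModuleHom.⟦_⟧ g (classOf n M))) →
          ∀ u → LeftModule._≈ᴹ_ Y (LeftModuleHom.⟦_⟧ f u) (LeftModuleHom.⟦_⟧ g u)
  ℋ-ext {Y = Y} f g base = ⨁-induction Gq (λ u → f.⟦ u ⟧ Y.≈ᴹ g.⟦ u ⟧)
      (λ {u} {v} e q → Y.≈ᴹ-trans (f.⟦⟧-cong {v} {u} (ℋ.≈ᴹ-sym {u} {v} e)) (Y.≈ᴹ-trans q (g.⟦⟧-cong {u} {v} e)))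
      (Y.≈ᴹ-trans f.0ᴹ-homo (Y.≈ᴹ-sym g.0ᴹ-homo))
      (λ {u} {v} q q′ → Y.≈ᴹ-trans (f.+ᴹ-homo u v) (Y.≈ᴹ-trans (Y.+ᴹ-cong q q′) (Y.≈ᴹ-sym (g.+ᴹ-homo u v))))
      (λ n → [q]-ext (f ⊙ ι-hom Gq n) (g ⊙ ι-hom Gq n) (base n))
    where
    module Y = LeftModule Y
    module f = Hom f
    module g = Hom g

  dim-restricted : ∀ {n} k l (e : k ℕ.+ l ≡ n) (N : FGMod (A n)) →
                   Algebra.dim (A k ⊗ᴬ A l) (restricted k l e N) ≡ A.dim n N
  dim-restricted k l ≡.refl N = dim-Res (ρ k l) N

  private
    contractBy : ℕ → LeftModuleHom (ℋ ⊗ ℋ) ℋ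
    contractBy k = contract ℤ[q] {V = ℋ} {W = ℋ} (δHom k)

    -- This is δₖ ⊗ δₗ, built as a contraction followed by a functional so that it refers to the
    -- same contraction as ∂.
    bidegree : ℕ → ℕ → LeftModuleHom (ℋ ⊗ ℋ) ℤ[q]¹
    bidegree k l = δHom l ⊙ contractBy k

    bidegree-embed : ∀ k l i j t → LeftModuleHom.⟦_⟧ (bidegree k l) (embed i j t) ≈ₚ
      extend ℤ[q].+-abelianGroup (λ (x , y) → δ k (q^ 0 ∙[ i ] x) *ₚ δ l (q^ 0 ∙[ j ] y)) t
    bidegree-embed k l i j t = ℤ[q].trans (extend-homo (bidegree k l) _ t)
      (extend-≈ ℤ[q].+-abelianGroup (λ (x , y) → δ.*ₗ-homo l (δ k (q^ 0 ∙[ i ] x)) (q^ 0 ∙[ j ] y)) t)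

    -- On the component of bidegree (k, l), δₖ ⊗ δₗ factors through `exterior`, since both sides
    -- multiply the dimensions of the factors. The value thus depends only on the image of `t` in G₀
    -- of the tensor product algebra.
    bidegree-match : ∀ k l t → LeftModuleHom.⟦_⟧ (bidegree k l) (embed k l t) ≈ₚ const (dim₀ (A k ⊗ᴬ A l) (exterior (A k) (A l) t))
    bidegree-match k l t = ℤ[q].trans (bidegree-embed k l k l t) (ℤ[q].trans
      (extend-≈ ℤ[q].+-abelianGroup (λ (x , y) → ℤ[q].trans (ℤ[q].*-cong (δ-ι-const k x) (δ-ι-const l y))
        (ℤ[q].sym (RingHom.*-homo constants (dim₀ (A k) x) (dim₀ (A l) y)))) t)
      (ℤ[q].trans (extend-const _ t) (constant (≡.sym (dim₀-exterior {A k} {A l} t)))))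

    -- The implication encodes (i, j) ≠ (k, l): if the first degrees differ, the first factor of the
    -- product vanishes, and otherwise the second does.
    bidegree-≢ : ∀ k l i j t → (i ≡ k → j ≢ l) → LeftModuleHom.⟦_⟧ (bidegree k l) (embed i j t) ≈ₚ []
    bidegree-≢ k l i j t mismatch = ℤ[q].trans (bidegree-embed k l i j t) (ℤ[q].trans
      (extend-≈ ℤ[q].+-abelianGroup (λ (x , y) → vanish (i ℕ.≟ k) x y) t) (extend-0 ℤ[q].+-abelianGroup t))
      where
      vanish : Dec (i ≡ k) → ∀ x y → δ k (q^ 0 ∙[ i ] x) *ₚ δ l (q^ 0 ∙[ j ] y) ≈ₚ []
      vanish (yes i≡k) x y = ℤ[q].trans (ℤ[q].*-congˡ {δ k (q^ 0 ∙[ i ] x)} (δ-ι-≢ _ (mismatch i≡k))) (ℤ[q].zeroʳ (δ k (q^ 0 ∙[ i ] x)))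
      vanish (no i≢k)  x y = ℤ[q].*-congʳ {δ l (q^ 0 ∙[ j ] y)} (δ-ι-≢ _ i≢k)

  module _ (Δ : LeftModuleHom ℋ (ℋ ⊗ ℋ)) (extends : ExtendsCoproduct Δ) where

    -- On [N] only the restriction to Aₖ ⊗ Aₗ is seen by δₖ ⊗ δₗ, and it occurs exactly when N has
    -- degree k + l; its dimension is that of N.
    δ-Δ : ∀ k l u → δ l (LeftModuleHom.⟦_⟧ (contractBy k) (LeftModuleHom.⟦_⟧ Δ u)) ≈ₚ δ (k ℕ.+ l) u
    δ-Δ k l = ℋ-ext (bidegree k l ⊙ Δ) (δHom (k ℕ.+ l)) on-classes
      where
      on-classes : ∀ n N → LeftModuleHom.⟦_⟧ (bidegree k l) (LeftModuleHom.⟦_⟧ Δ (classOf n N)) ≈ₚ δ (k ℕ.+ l) (classOf n N)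
      on-classes n N = ℤ[q].trans (Hom.⟦⟧-cong (bidegree k l) Δ-class)
          (ℤ[q].trans (Hom.sum-homo (bidegree k l) (λ i → embed (toℕ i) (n ∸ toℕ i) (xs i))) (total (n ℕ.≟ k ℕ.+ l)))
        where
        xs = proj₁ (extends n N)
        exterior-xs = proj₁ (proj₂ (extends n N))
        Δ-class = proj₂ (proj₂ (extends n N))
        summand : Fin (suc n) → Poly
        summand i = LeftModuleHom.⟦_⟧ (bidegree k l) (embed (toℕ i) (n ∸ toℕ i) (xs i))
        summand-zero : ∀ i → (toℕ i ≡ k → n ∸ toℕ i ≢ l) → summand i ≈ₚ []
        summand-zero i = bidegree-≢ k l (toℕ i) (n ∸ toℕ i) (xs i)
        summand-match : ∀ i → toℕ i ≡ k → n ∸ toℕ i ≡ l → summand i ≈ₚ const (ℤ.+ A.dim n N)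
        summand-match i ≡.refl ≡.refl = ℤ[q].trans (bidegree-match (toℕ i) (n ∸ toℕ i) (xs i))
          (constant (≡.trans (dim₀-cong (A (toℕ i) ⊗ᴬ A (n ∸ toℕ i)) (exterior-xs i)) (≡.cong ℤ.+_ (dim-restricted (toℕ i) (n ∸ toℕ i) _ N))))
        total : Dec (n ≡ k ℕ.+ l) → sum ℤ[q].+-rawMonoid summand ≈ₚ δ (k ℕ.+ l) (classOf n N)
        total (no n≢k+l) = ℤ[q].trans
          (sum-zero ℤ[q].+-commutativeMonoid {f = summand} λ i → summand-zero i λ i≡k n∸i≡l →
            n≢k+l (≡.trans (≡.sym (ℕ.m+[n∸m]≡n (toℕ≤pred[n] i))) (≡.cong₂ ℕ._+_ i≡k n∸i≡l)))
          (ℤ[q].sym (δ-ι-≢ _ n≢k+l))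
        -- The surviving index is k itself, which lies in `Fin (suc n)` because k ≤ k + l = n.
        total (yes n≡k+l) = ℤ[q].trans
          (sum-single ℤ[q].+-commutativeMonoid summand index λ j j≢ → summand-zero j λ j≡k →
            ⊥-elim (j≢ (toℕ-injective (≡.trans j≡k (≡.sym index≡k)))))
          (ℤ[q].trans (summand-match index index≡k (≡.trans (≡.cong₂ _∸_ n≡k+l index≡k) (ℕ.m+n∸m≡n k l)))
            (≡.subst (λ m → const (ℤ.+ A.dim n N) ≈ₚ δ m (classOf n N)) n≡k+l (ℤ[q].sym (δ-ι-const n (gen N)))))
          where
          k<1+n : k < suc n
          k<1+n = s≤s (≡.subst (k ≤_) (≡.sym n≡k+l) (ℕ.m≤m+n k l))
          index : Fin (suc n)
          index = fromℕ< k<1+n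
          index≡k : toℕ index ≡ k
          index≡k = toℕ-fromℕ< k<1+n

    module _ (_∗_ : Op₂ ℋ.Carrierᴹ) (hopf : IsQTwistedHopfAlgebra _∗_ Δ) where
      open IsQTwistedHopfAlgebra hopf
      private
        module ∗ = IsGradedProduct isGradedProduct

        base-basis : Basis (Algebra.space base (Algebra.regular base)) 1
        base-basis = record
          { vectors = λ _ → K.1#
          ; independent = λ { c e zero → K.trans (K.sym (K.trans (K.+-identityʳ _) (K.*-identityʳ (c zero)))) e }
          ; spanning = λ u → (λ _ → u) , K.sym (K.trans (K.+-identityʳ _) (K.*-identityʳ u))
          }

        dim-A₀ : A.dim 0 (A.regularᶠᵍ 0) ≡ 1
        dim-A₀ = basis-unique (Algebra.space base (Algebra.regular base))
            (basis-image linear injective (λ w → let (u , e) = surjective w in u , e (A.refl 0)) (dim-basis (A 0) (A.regularᶠᵍ 0)))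
            base-basis
          where
          module h = AlgebraHom (proj₁ A₀≅base)
          injective = proj₁ (proj₂ A₀≅base)
          surjective = proj₂ (proj₂ A₀≅base)
          linear : LeftModuleHom (A.space 0 (A.regular 0)) (Algebra.space base (Algebra.regular base))
          linear = mkHom h.⟦_⟧ h.⟦⟧-cong h.+-homo (λ c u → K.trans (h.*-homo _ u) (K.*-congʳ (h.scalar-homo c)))

      -- Applied to Δ 𝟙 = 𝟙 ⊗ 𝟙, the compatibility of dimension with restriction makes e = dim 𝟙 idempotent;
      -- it is invertible because [A₀] is a multiple of 𝟙.
      δ-𝟙 : δ 0 𝟙 ≈ₚ const 1ℤ
      δ-𝟙 = begin
        e                  ≈⟨ ℤ[q].*-identityˡ e ⟨
        const 1ℤ *ₚ e      ≈⟨ ℤ[q].*-congʳ {e} invertible ⟨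
        (c *ₚ e) *ₚ e      ≈⟨ ℤ[q].*-assoc c e e ⟩
        c *ₚ (e *ₚ e)      ≈⟨ ℤ[q].*-congˡ {c} idempotent ⟩
        c *ₚ e             ≈⟨ invertible ⟩
        const 1ℤ           ∎
        where
        open SetoidReasoning ℤ[q].setoid
        e = δ 0 𝟙
        [A₀] = gen (q^ 0 , gen (A.regularᶠᵍ 0))
        c = proj₁ (connected-surjective [A₀])
        idempotent : e *ₚ e ≈ₚ e
        idempotent = ℤ[q].trans (ℤ[q].sym (δ.*ₗ-homo 0 e 𝟙)) (ℤ[q].trans
          (ℤ[q].sym (Hom.⟦⟧-cong (bidegree 0 0) Δ-𝟙)) (δ-Δ 0 0 𝟙))
        invertible : c *ₚ e ≈ₚ const 1ℤ
        invertible = begin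
          c *ₚ e                                                      ≡⟨ ≡.cong (c *ₚ_) (δ-ι 0 one) ⟩
          c *ₚ LeftModuleHom.⟦_⟧ (dimₙ 0) one                         ≈⟨ Hom.*ₗ-homo (dimₙ 0) c one ⟨
          LeftModuleHom.⟦_⟧ (dimₙ 0) (Gq._*ₗ_ 0 c one)                ≈⟨ Hom.⟦⟧-cong (dimₙ 0) (proj₂ (connected-surjective [A₀])) ⟨
          LeftModuleHom.⟦_⟧ (dimₙ 0) [A₀]                             ≈⟨ ℤ[q].*-identityˡ _ ⟩
          const (ℤ.+ A.dim 0 (A.regularᶠᵍ 0))                         ≈⟨ constant (≡.cong ℤ.+_ dim-A₀) ⟩
          const 1ℤ                                                    ∎

      gradedAlgebra : ConnectedGradedAlgebra ℤ[q] Gq ℋ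
      gradedAlgebra = record
        { ιHom = ι-hom Gq
        ; induction = ⨁-induction Gq
        ; length = bound
        ; piece = λ u i → ι Gq i (component u i)
        ; pieces = decompose Gq
        ; qpow = q^_
        ; qpow-0 = ℤ[q].refl
        ; twist = ⨁-twist Gq
        ; twist-pieces = ⨁-decompose-twist Gq
        ; twist-ι = ⨁-twist-ι Gq
        ; _∗_ = _∗_
        ; ∗-cong = λ {u} {u′} {v} {v′} → ∗.∗-cong {u} {u′} {v} {v′}
        ; ∗-distribˡ = ∗.∗-distribˡ
        ; ∗-distribʳ = ∗.∗-distribʳ
        ; ∗-scalarˡ = ∗.∗-scalarˡ
        ; ∗-scalarʳ = ∗.∗-scalarʳ
        ; ∗-graded = ∗.∗-graded
        ; one = one
        ; identityˡ = ∗-identityˡ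
        ; identityʳ = ∗-identityʳ
        ; connected = connected-surjective
        ; δHom = δHom
        ; δ-ι-≢ = δ-ι-≢
        ; δ-twist = λ k i u → Hom.*ₗ-homo (dimₙ i) (q^ (k ℕ.* i)) (component u i)
        ; δ-one = δ-𝟙
        }

      compatibleCoproduct : Derivation.CompatibleCoproduct gradedAlgebra
      compatibleCoproduct = record
        { ΔHom = Δ
        ; Δ-∗ = Δ-∗
        ; Δ-𝟙 = Δ-𝟙
        ; Δ-ι₁ = Δ-graded 1
        ; εHom = counit
        ; ε-𝟙 = ε-𝟙
        ; ε-ι = ε-graded
        ; ε-left = ε-left
        ; δ-Δ = δ-Δ 1
        }

      -- Each step down from n+1 to n by ∂ contributes a factor b [n+1]; the induction starts from
      -- δ₀ 𝟙 = 1.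
      δ-^∗ : ∀ {b} x → dim₀ (A 1) x ≡ ℤ.+ b → ∀ n → δ n ((q^ 0 ∙[ 1 ] x) ^∗ n) ≈ₚ const (ℤ.+ (b ℕ.^ n)) *ₚ [ n ]q!
      δ-^∗ {b} x dim-x = go
        where
        open SetoidReasoning ℤ[q].setoid
        β = q^ 0 ∙[ 1 ] x
        β₁ = gen (q^ 0 , x)
        δ-suc : ∀ n → δ (suc n) (β ^∗ suc n) ≈ₚ (δ 1 β *ₚ [ suc n ]q) *ₚ δ n (β ^∗ n)
        δ-suc = Derivation.δ-power-suc gradedAlgebra compatibleCoproduct β₁ {power = β ^∗_}
          (ℋ.≈ᴹ-refl {𝟙}) (λ n → ℋ.≈ᴹ-refl {β ^∗ suc n}) {qnumber = [_]q} ℤ[q].refl [suc]q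
        β-dim : δ 1 β ≈ₚ const (ℤ.+ b)
        β-dim = ℤ[q].trans (δ-ι-const 1 x) (constant dim-x)
        go : ∀ n → δ n (β ^∗ n) ≈ₚ const (ℤ.+ (b ℕ.^ n)) *ₚ [ n ]q!
        go zero = ℤ[q].trans δ-𝟙 (ℤ[q].sym (ℤ[q].*-identityˡ (const 1ℤ)))
        go (suc n) = begin
          δ (suc n) (β ^∗ suc n)
            ≈⟨ δ-suc n ⟩
          (δ 1 β *ₚ [ suc n ]q) *ₚ δ n (β ^∗ n)
            ≈⟨ ℤ[q].*-cong (ℤ[q].*-congʳ {[ suc n ]q} β-dim) (go n) ⟩
          (const (ℤ.+ b) *ₚ [ suc n ]q) *ₚ (const (ℤ.+ (b ℕ.^ n)) *ₚ [ n ]q!)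
            ≈⟨ interchange (const (ℤ.+ b)) [ suc n ]q (const (ℤ.+ (b ℕ.^ n))) [ n ]q! ⟩
          (const (ℤ.+ b) *ₚ const (ℤ.+ (b ℕ.^ n))) *ₚ ([ suc n ]q *ₚ [ n ]q!)
            ≈⟨ ℤ[q].*-congʳ {[ suc n ]q!} (RingHom.*-homo constants (ℤ.+ b) (ℤ.+ (b ℕ.^ n))) ⟨
          const (ℤ.+ b ℤ.* ℤ.+ (b ℕ.^ n)) *ₚ [ suc n ]q!
            ≈⟨ ℤ[q].*-congʳ {[ suc n ]q!} (constant (ℤ.pos-* b (b ℕ.^ n))) ⟨
          const (ℤ.+ (b ℕ.^ suc n)) *ₚ [ suc n ]q! ∎
          where open CommutativeSemigroupProperties ℤ[q].*-commutativeSemigroup using (interchange)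

-- Constant coefficients

coeff₀-+ : ∀ f g → coeff (f +ₚ g) 0 ≡ coeff f 0 ℤ.+ coeff g 0
coeff₀-+ []      g       = ≡.sym (ℤ.+-identityˡ _)
coeff₀-+ (c ∷ f) []      = ≡.sym (ℤ.+-identityʳ c)
coeff₀-+ (c ∷ f) (d ∷ g) = ≡.refl

coeff₀-sum : ∀ {k} (f : Vector Poly k) → (∀ i → coeff (f i) 0 ≡ 0ℤ) → coeff (sum ℤ[q].+-rawMonoid f) 0 ≡ 0ℤ
coeff₀-sum {zero}  f e = ≡.refl
coeff₀-sum {suc k} f e = ≡.trans (coeff₀-+ (f zero) _) (≡.cong₂ ℤ._+_ (e zero) (coeff₀-sum (f ∘ suc) (e ∘ suc)))

-- The first alternative is the empty sum. As soon as there is a term, only that of q⁰ has a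
-- constant coefficient.
coeff₀-series : ∀ k (c : ℕ → ℤ) → let f = sum ℤ[q].+-rawMonoid {k} (λ i → c (toℕ i) ·ₚ (q^ toℕ i)) in
                coeff f 0 ≡ 0ℤ ⊎ coeff f 0 ≡ c 0
coeff₀-series zero    c = inj₁ ≡.refl
coeff₀-series (suc k) c = inj₂ (≡.trans (coeff₀-+ (c 0 ·ₚ (q^ 0)) (sum ℤ[q].+-rawMonoid {k} (λ i → c (toℕ (suc i)) ·ₚ (q^ toℕ (suc i)))))
  (≡.trans (≡.cong₂ ℤ._+_ (ℤ.*-identityʳ (c 0)) (coeff₀-sum {k} (λ i → c (toℕ (suc i)) ·ₚ (q^ toℕ (suc i))) (λ i → ℤ.*-zeroʳ (c (toℕ (suc i))))))
    (ℤ.+-identityʳ (c 0))))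

sum-pos : ∀ {k} (f : Vector ℕ k) → sum (AbelianGroup.rawMonoid ℤ.+-0-abelianGroup) (λ i → + f i) ≡ + sum ℕ.+-0-rawMonoid f
sum-pos {zero}  f = ≡.refl
sum-pos {suc k} f = ≡.cong (λ z → + f zero ℤ.+ z) (sum-pos (f ∘ suc))

-- The graded dimension of a filtered tower

module FilteredTowers (em : ∀ ℓ → ExcludedMiddle ℓ) (K : Field) (𝒜 : Towers.FilteredTower (em 0ℓ) K) where
  open Dimensions (em 0ℓ) K
  open Towers (em 0ℓ) K
  open FilteredTower 𝒜
  open GradedDimension (em 0ℓ) K tower
  private
    module A n = Algebra (A n)
    module ℋ = LeftModule ℋ

  dim₀-beta : ∀ {t} (S P : Fin t → FGMod (A 1)) →
              dim₀ (A 1) (betaClass (A 1) S P) ≡ + sum ℕ.+-0-rawMonoid (λ i → A.dim 1 (S i) ℕ.* A.dim 1 (P i))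
  dim₀-beta {t} S P = ≡.trans (terms (λ i → A.dim 1 (P i) ×′ gen (S i)))
      (≡.trans (≡.sym (MonoidSum.sum-cong-≗ ℤ.+-0-commutativeMonoid pointwise)) (sum-pos (λ i → A.dim 1 (S i) ℕ.* A.dim 1 (P i))))
    where
    open MultProperties (AbelianGroup.monoid (G₀ (A 1))) using () renaming (_×_ to _×′_)
    pointwise : ∀ i → + (A.dim 1 (S i) ℕ.* A.dim 1 (P i)) ≡ dim₀ (A 1) (A.dim 1 (P i) ×′ gen (S i))
    pointwise i = ≡.trans (≡.cong +_ (ℕ.*-comm (A.dim 1 (S i)) (A.dim 1 (P i)))) (≡.trans (ℤ.pos-* (A.dim 1 (P i)) (A.dim 1 (S i))) (≡.sym (dim₀-× (A 1) (A.dim 1 (P i)) (gen (S i)))))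
    terms : ∀ {k} (x : Vector (FreeAb (FGMod (A 1))) k) →
            dim₀ (A 1) (sum (AbelianGroup.rawMonoid (G₀ (A 1))) x) ≡ sum (AbelianGroup.rawMonoid ℤ.+-0-abelianGroup) (dim₀ (A 1) ∘ x)
    terms {zero}  x = ≡.refl
    terms {suc k} x = ≡.cong (λ z → dim₀ (A 1) (x zero) ℤ.+ z) (terms (x ∘ suc))

  δ-layer : ∀ n i → δ n (q^ i ∙[ n ] gen (layer n i)) ≈ₚ (+ A.dim n (layer n i)) ·ₚ (q^ i)
  δ-layer n i = ℤ[q].trans (ℤ[q].reflexive (δ-ι n _))
    (ℤ[q].trans (ℤ[q].*-comm (q^ i) (const (+ A.dim n (layer n i)))) (ℤ[q].sym (·ₚ-const (+ A.dim n (layer n i)) (q^ i))))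

  -- Being linear, δₙ carries the finite expansion of [Aₙ]_q, together with the vanishing of its
  -- remaining terms, to the graded dimension.
  δ-graded-class : ∀ n u → IsGradedClass n u → IsSumOf ℤ[q].+-abelianGroup (λ i → (+ A.dim n (layer n i)) ·ₚ (q^ i)) (δ n u)
  δ-graded-class n u class = record
    { terms = terms
    ; restVanish = λ {i} l → ℤ[q].trans (ℤ[q].sym (δ-layer n i))
        (ℤ[q].trans (δ.⟦⟧-cong n {q^ i ∙[ n ] gen (layer n i)} {ℋ.0ᴹ} (restVanish l)) (δ.0ᴹ-homo n))
    ; partialSum = ℤ[q].trans (δ.⟦⟧-cong n {u} {sum ℋ.+ᴹ-rawMonoid {terms} (λ i → q^ toℕ i ∙[ n ] gen (layer n (toℕ i)))} partialSum)
        (ℤ[q].trans (δ.sum-homo n {terms} (λ i → q^ toℕ i ∙[ n ] gen (layer n (toℕ i)))) (MonoidSum.sum-cong-≋ ℤ[q].+-commutativeMonoid {terms} (λ i → δ-layer n (toℕ i))))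
    }
    where
    open IsSumOf class

  -- The filtration starts with the whole algebra, so its top layer is a quotient of the regular
  -- module.
  dim-layer-≤ : ∀ n → A.dim n (layer n 0) ≤ A.dim n (A.regularᶠᵍ n)
  dim-layer-≤ n = dim-surjection (A n) {A.regularᶠᵍ n} {layer n 0}
      (mkHom (λ u → u , all n u) layer-cong (λ u v → layer-cong (A.refl n)) (λ p u → layer-cong (A.refl n)))
      λ (u , u∈) → u , layer-cong (A.refl n)
    where
    module U₁ = Submodule (filtration n 1)
    layer-cong : ∀ {u v} → A._≈_ n u v → U₁.Member (A._+_ n u (A.-_ n v))
    layer-cong e = U₁.resp (A.sym n (A.trans n (A.+-congʳ n e) (A.-‿inverseʳ n _))) U₁.0∈

  module _ {t} (S P : Fin t → FGMod (A 1)) (simples : IsListOfSimples S) (covers : ∀ i → ProjectiveCover (P i) (S i))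
           (_∗_ : Op₂ ℋ.Carrierᴹ) (Δ : LeftModuleHom ℋ (ℋ ⊗ ℋ)) (extends : ExtendsCoproduct Δ) (hopf : IsQTwistedHopfAlgebra _∗_ Δ) where
    open IsQTwistedHopfAlgebra hopf using (_^∗_; ∗-identityʳ)
    private
      β = q^ 0 ∙[ 1 ] betaClass (A 1) S P
      r₁ = A.dim 1 (A.regularᶠᵍ 1)
      b = sum ℕ.+-0-rawMonoid (λ i → A.dim 1 (S i) ℕ.* A.dim 1 (P i))

    -- Over an arbitrary field only r ≤ b holds in general; the converse comes from comparing the coefficients of q⁰ in (Q3) for n = 1.
    b≡r₁ : IsGradedClass 1 (β ^∗ 1) → b ≡ r₁
    b≡r₁ class = ℕ.≤-antisym (compare (coeff₀-series terms (λ i → + A.dim 1 (layer 1 i))))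
        (SimpleModules.dim-regular-≤ em K (A 1) S P simples covers)
      where
      open IsSumOf (δ-graded-class 1 (β ^∗ 1) class)
      δ-β : const (+ b) ≈ₚ δ 1 (β ^∗ 1)
      δ-β = ℤ[q].trans (ℤ[q].sym (ℤ[q].trans (δ-ι-const 1 (betaClass (A 1) S P)) (constant (dim₀-beta S P))))
        (δ.⟦⟧-cong 1 {β} {β ^∗ 1} (ℋ.≈ᴹ-sym {β ^∗ 1} {β} (∗-identityʳ β)))
      coefficient : + b ≡ coeff (sum ℤ[q].+-rawMonoid {terms} (λ i → (+ A.dim 1 (layer 1 (toℕ i))) ·ₚ (q^ toℕ i))) 0
      coefficient = at (ℤ[q].trans δ-β partialSum) 0
      compare : _ ⊎ _ → b ≤ r₁
      -- The expansion in (Q3) may have been given with no terms at all, in which case b = 0.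
      compare (inj₁ e) = ≡.subst (_≤ r₁) (≡.sym (ℤ.+-injective (≡.trans coefficient e))) z≤n
      compare (inj₂ e) = ≡.subst (_≤ r₁) (≡.sym (ℤ.+-injective (≡.trans coefficient e))) (dim-layer-≤ 1)

    -- The two evaluations of δₙ on βⁿ, by ∂ and by (Q3), are equated; the number of terms is the
    -- one supplied by (Q3).
    graded-dimension : (∀ n → IsGradedClass n (β ^∗ n)) → ∀ n →
                       IsSumOf ℤ[q].+-abelianGroup (λ i → (+ A.dim n (layer n i)) ·ₚ (q^ i)) ((+ (r₁ ^ n)) ·ₚ [ n ]q!)
    graded-dimension classes n = record
      { terms = terms
      ; restVanish = restVanish
      ; partialSum = ℤ[q].trans (·ₚ-const (+ (r₁ ^ n)) [ n ]q!) (ℤ[q].trans (ℤ[q].sym δ-power) partialSum)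
      }
      where
      open IsSumOf (δ-graded-class n (β ^∗ n) (classes n))
      δ-power : δ n (β ^∗ n) ≈ₚ const (+ (r₁ ^ n)) *ₚ [ n ]q!
      δ-power = δ-^∗ Δ extends _∗_ hopf (betaClass (A 1) S P)
        (≡.trans (dim₀-beta S P) (≡.cong +_ (b≡r₁ (classes 1)))) n

theorem7p2 :
  (em : ∀ ℓ → ExcludedMiddle ℓ) (ℝ : CompleteOrderedField) →
  let open Towers (em 0ℓ) (Complex.ℂ (em 0ℓ) ℝ) in
  (𝒜 : FilteredTower) →
  let open FilteredTower 𝒜 in
  -- the simple A₁-modules and their projective covers
  {t : ℕ} (S P : Fin t → FGMod (A 1)) →
  IsListOfSimples S → (∀ i → ProjectiveCover (P i) (S i)) →
  -- the product ∗ on G(A)_q and the ℤ[q]-linear extension Δ of the coproduct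
  (_∗_ : Op₂ (LeftModule.Carrierᴹ ℋ)) →
  IsGradedProduct _∗_ → Quantizes _∗_ →
  (Δ : LeftModuleHom ℋ (ℋ ⊗ ℋ)) → ExtendsCoproduct Δ →
  -- (Q1)
  (∀ u v w → LeftModule._≈ᴹ_ ℋ ((u ∗ v) ∗ w) (u ∗ (v ∗ w))) →
  -- (Q2)
  (hopf : IsQTwistedHopfAlgebra _∗_ Δ) →
  let open IsQTwistedHopfAlgebra hopf using (_^∗_)
      β = q^ 0 ∙[ 1 ] betaClass (A 1) S P
      r = Algebra.dim (A 1) (Algebra.regularᶠᵍ (A 1))
  in
  -- (Q3)
  (∀ n → IsGradedClass n (β ^∗ n)) →
  ∀ n → IsSumOf (CommutativeRing.+-abelianGroup ℤ[q])
                (λ i → (+ Algebra.dim (A n) (layer n i)) ·ₚ (q^ i))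
                ((+ (r ^ n)) ·ₚ [ n ]q!)
theorem7p2 em ℝ 𝒜 S P simples covers _∗_ _ _ Δ extends _ hopf = graded-dimension S P simples covers _∗_ Δ extends hopf
  where
  -- A module application keeps ℂ (em 0ℓ) ℝ as it stands in the type; passed as an argument of a function it is elaborated to
  -- ℂ (λ {P} → em 0ℓ {P}) ℝ, and the conversion check then unfolds the field everywhere.
  open FilteredTowers em (Complex.ℂ (em 0ℓ) ℝ) 𝒜
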